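{- Let $r\ge 0$ be an integer. Define the sequence $\{h_r(n)\}_{n\ge 0}$ by $$h_r(n)=\begin{cases}\dfrac{H_{2n}-H_{n+r}}{n-r} & \text{if } n\ne r,\\[2mm] \dfrac{\pi^2}{6}-\displaystyle\sum_{1\le k\le 2r}\frac1{k^2} & \text{if } n=r.\end{cases}$$ Then $$\sum_{n=0}^{+\infty}c_n h_r(n)=\frac{1}{r+1}.$$
   Context: $H_m=1+\frac12+\ldots+\frac1m$ is the $m$-th harmonic number, with $H_0=0$; empty sums are $0$. Let $\mathcal H=L^2([0,1],dx)$ (complex-valued functions, Lebesgue measure) with its norm $\|\cdot\|$. The sequence $(c_n)_{n\ge 0}$ is defined recursively: $c_0=1$, and, writing $p_n(x)=c_0+c_1x+\ldots+c_nx^n$, for each $n\ge 0$ the number $c_{n+1}$ is the unique complex number $c$ for which the norm $\|p_n(x)+c\,x^{n+1}\|$ is minimal among all $c\in\mathbb C$. Equivalently, $c_0=1$ and $\frac{c_0}{n+1}+\frac{c_1}{n+2}+\ldots+\frac{c_n}{2n+1}=0$ for all $n\ge 1$. -}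

module Defs where

open import Algebra.Bundles.Raw using (RawMonoid; RawSemiring)
import Algebra.Definitions.RawMonoid as RawMonoidDefs
import Algebra.Definitions.RawSemiring as RawSemiringDefs
open import Data.Fin.Base using (toℕ)
open import Data.Integer.Base as ℤ using (+_)
import Data.Integer.GCD as ℤGCD
import Data.Integer.Properties as ℤₚ
open import Data.Nat.Base as ℕ using (ℕ; zero; suc)
import Data.Nat.Properties as ℕₚ
open import Data.Product.Base using (∃; _×_; _,_)
open import Data.Rational.Base as ℚ using (ℚ; 0ℚ; 1ℚ)
import Data.Rational.Properties as ℚₚ
open import Data.Rational.Unnormalised.Base as ℚᵘ using (mkℚᵘ)
import Data.Rational.Unnormalised.Properties as ℚᵘₚ
open import Data.Rational.Solver using (module +-*-Solver)
open import Level using (0ℓ)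
open import Relation.Binary.PropositionalEquality
  using (_≡_; _≢_; refl; sym; trans; cong; cong₂; subst; subst₂; module ≡-Reasoning)
open import Relation.Nullary.Decidable.Core using (yes; no)

-- ∑< n f  =  f 0 + … + f (n - 1)

module Sum {a ℓ} (M : RawMonoid a ℓ) where
  open RawMonoid M using (Carrier)

  ∑< : ℕ → (ℕ → Carrier) → Carrier
  ∑< n f = RawMonoidDefs.sum M {n} (λ k → f (toℕ k))

open Sum ℚ.+-0-rawMonoid using () renaming (∑< to ∑ℚ) public
open RawSemiringDefs ℚ.+-*-rawSemiring using () renaming (_^_ to _^ℚ_) public

-- There is no library type of real numbers.  Here a real is a Cauchy sequence
-- of rationals with a modulus of convergence; equality is the setoid _≈_.

IsCauchy : (ℕ → ℚ) → Set
IsCauchy x = ∀ ε → 0ℚ ℚ.< ε →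
  ∃ λ N → ∀ m n → N ℕ.≤ m → N ℕ.≤ n → ℚ.∣ x m ℚ.- x n ∣ ℚ.≤ ε

record ℝ : Set where
  constructor mkℝ
  field
    seq    : ℕ → ℚ
    cauchy : IsCauchy seq

open ℝ public

infix 4 _≤_ _≈_

record _≤_ (x y : ℝ) : Set where
  constructor mk≤
  field
    eventually-≤ : ∀ ε → 0ℚ ℚ.< ε →
      ∃ λ N → ∀ n → N ℕ.≤ n → seq x n ℚ.≤ seq y n ℚ.+ ε

open _≤_ public

_≈_ : ℝ → ℝ → Set
x ≈ y = (x ≤ y) × (y ≤ x)

fromℚ : ℚ → ℝ
fromℚ q = mkℝ (λ _ → q) λ ε 0<ε → 0 , λ _ _ _ _ →
  subst (λ d → ℚ.∣ d ∣ ℚ.≤ ε) (sym (ℚₚ.+-inverseʳ q)) (ℚₚ.<⇒≤ 0<ε)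

private
  abstract
    half : ∀ ε → ℚ.½ ℚ.* ε ℚ.+ ℚ.½ ℚ.* ε ≡ ε
    half ε = trans (sym (ℚₚ.*-distribʳ-+ ε ℚ.½ ℚ.½)) (ℚₚ.*-identityˡ ε)

    *-pos : ∀ {p q} → 0ℚ ℚ.< p → 0ℚ ℚ.< q → 0ℚ ℚ.< p ℚ.* q
    *-pos {p} {q} 0<p 0<q =
      ℚₚ.positive⁻¹ (p ℚ.* q)
        {{ℚₚ.pos*pos⇒pos p {{ℚ.positive 0<p}} q {{ℚ.positive 0<q}}}}

    half-pos : ∀ {ε} → 0ℚ ℚ.< ε → 0ℚ ℚ.< ℚ.½ ℚ.* ε
    half-pos = *-pos (ℚₚ.positive⁻¹ ℚ.½)

    +-cauchy : ∀ {x y} → IsCauchy x → IsCauchy y → IsCauchy (λ n → x n ℚ.+ y n)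
    +-cauchy {x} {y} cx cy ε 0<ε
      with cx (ℚ.½ ℚ.* ε) (half-pos 0<ε) | cy (ℚ.½ ℚ.* ε) (half-pos 0<ε)
    ... | M , hM | N , hN = M ℕ.⊔ N , λ m n M⊔N≤m M⊔N≤n → begin
      ℚ.∣ (x m ℚ.+ y m) ℚ.- (x n ℚ.+ y n) ∣
        ≡⟨ cong ℚ.∣_∣ (regroup (x m) (y m) (x n) (y n)) ⟩
      ℚ.∣ (x m ℚ.- x n) ℚ.+ (y m ℚ.- y n) ∣
        ≤⟨ ℚₚ.∣p+q∣≤∣p∣+∣q∣ (x m ℚ.- x n) (y m ℚ.- y n) ⟩
      ℚ.∣ x m ℚ.- x n ∣ ℚ.+ ℚ.∣ y m ℚ.- y n ∣
        ≤⟨ ℚₚ.+-mono-≤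
             (hM m n (ℕₚ.m⊔n≤o⇒m≤o M N M⊔N≤m) (ℕₚ.m⊔n≤o⇒m≤o M N M⊔N≤n))
             (hN m n (ℕₚ.m⊔n≤o⇒n≤o M N M⊔N≤m) (ℕₚ.m⊔n≤o⇒n≤o M N M⊔N≤n)) ⟩
      ℚ.½ ℚ.* ε ℚ.+ ℚ.½ ℚ.* ε
        ≡⟨ half ε ⟩
      ε ∎
      where
      open ℚₚ.≤-Reasoning
      open +-*-Solver
      regroup : ∀ a b c d → (a ℚ.+ b) ℚ.- (c ℚ.+ d) ≡ (a ℚ.- c) ℚ.+ (b ℚ.- d)
      regroup = solve 4
        (λ a b c d → (a :+ b) :- (c :+ d) := (a :- c) :+ (b :- d)) refl

    neg-cauchy : ∀ {x} → IsCauchy x → IsCauchy (λ n → ℚ.- x n)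
    neg-cauchy {x} cx ε 0<ε with cx ε 0<ε
    ... | N , hN = N , λ m n N≤m N≤n →
      subst (ℚ._≤ ε) (sym (neg-dist (x m) (x n))) (hN m n N≤m N≤n)
      where
      neg-dist : ∀ a b → ℚ.∣ (ℚ.- a) ℚ.- (ℚ.- b) ∣ ≡ ℚ.∣ a ℚ.- b ∣
      neg-dist a b =
        trans (cong ℚ.∣_∣ (sym (ℚₚ.neg-distrib-+ a (ℚ.- b)))) (ℚₚ.∣-p∣≡∣p∣ (a ℚ.- b))

    eventually-bounded : ∀ {x} → IsCauchy x →
      ∃ λ B → 0ℚ ℚ.< B × ∃ λ N → ∀ n → N ℕ.≤ n → ℚ.∣ x n ∣ ℚ.≤ B
    eventually-bounded {x} cx with cx 1ℚ (ℚₚ.positive⁻¹ 1ℚ)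
    ... | N , hN = 1ℚ ℚ.+ ℚ.∣ x N ∣ , 0<B , N , λ n N≤n → begin
      ℚ.∣ x n ∣
        ≡⟨ cong ℚ.∣_∣ (split (x n) (x N)) ⟩
      ℚ.∣ (x n ℚ.- x N) ℚ.+ x N ∣
        ≤⟨ ℚₚ.∣p+q∣≤∣p∣+∣q∣ (x n ℚ.- x N) (x N) ⟩
      ℚ.∣ x n ℚ.- x N ∣ ℚ.+ ℚ.∣ x N ∣
        ≤⟨ ℚₚ.+-monoˡ-≤ ℚ.∣ x N ∣ (hN n N N≤n ℕₚ.≤-refl) ⟩
      1ℚ ℚ.+ ℚ.∣ x N ∣ ∎
      where
      open ℚₚ.≤-Reasoning
      open +-*-Solver
      split : ∀ a b → a ≡ (a ℚ.- b) ℚ.+ b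
      split = solve 2 (λ a b → a := (a :- b) :+ b) refl
      0<B : 0ℚ ℚ.< 1ℚ ℚ.+ ℚ.∣ x N ∣
      0<B = ℚₚ.+-mono-<-≤ (ℚₚ.positive⁻¹ 1ℚ) (ℚₚ.0≤∣p∣ (x N))

    ∣*∣-mono : ∀ p q {P Q} → 0ℚ ℚ.< P → ℚ.∣ p ∣ ℚ.≤ P → ℚ.∣ q ∣ ℚ.≤ Q →
              ℚ.∣ p ℚ.* q ∣ ℚ.≤ P ℚ.* Q
    ∣*∣-mono p q {P} {Q} 0<P p≤P q≤Q = begin
      ℚ.∣ p ℚ.* q ∣
        ≡⟨ ℚₚ.∣p*q∣≡∣p∣*∣q∣ p q ⟩
      ℚ.∣ p ∣ ℚ.* ℚ.∣ q ∣
        ≤⟨ ℚₚ.*-monoʳ-≤-nonNeg ℚ.∣ q ∣ {{ℚₚ.∣-∣-nonNeg q}} p≤P ⟩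
      P ℚ.* ℚ.∣ q ∣
        ≤⟨ ℚₚ.*-monoˡ-≤-nonNeg P {{ℚ.nonNegative (ℚₚ.<⇒≤ 0<P)}} q≤Q ⟩
      P ℚ.* Q ∎
      where open ℚₚ.≤-Reasoning

    *-dist : ∀ a b c d → a ℚ.* b ℚ.- c ℚ.* d ≡ a ℚ.* (b ℚ.- d) ℚ.+ d ℚ.* (a ℚ.- c)
    *-dist = solve 4
      (λ a b c d → a :* b :- c :* d := a :* (b :- d) :+ d :* (a :- c)) refl
      where open +-*-Solver

    *-close : ∀ a b c d {A B δ} → 0ℚ ℚ.< A → 0ℚ ℚ.< B →
              ℚ.∣ a ∣ ℚ.≤ A → ℚ.∣ d ∣ ℚ.≤ B →
              ℚ.∣ a ℚ.- c ∣ ℚ.≤ δ → ℚ.∣ b ℚ.- d ∣ ℚ.≤ δ →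
              ℚ.∣ a ℚ.* b ℚ.- c ℚ.* d ∣ ℚ.≤ (A ℚ.+ B) ℚ.* δ
    *-close a b c d {A} {B} {δ} 0<A 0<B a≤A d≤B ac≤δ bd≤δ = begin
      ℚ.∣ a ℚ.* b ℚ.- c ℚ.* d ∣
        ≡⟨ cong ℚ.∣_∣ (*-dist a b c d) ⟩
      ℚ.∣ a ℚ.* (b ℚ.- d) ℚ.+ d ℚ.* (a ℚ.- c) ∣
        ≤⟨ ℚₚ.∣p+q∣≤∣p∣+∣q∣ (a ℚ.* (b ℚ.- d)) (d ℚ.* (a ℚ.- c)) ⟩
      ℚ.∣ a ℚ.* (b ℚ.- d) ∣ ℚ.+ ℚ.∣ d ℚ.* (a ℚ.- c) ∣
        ≤⟨ ℚₚ.+-mono-≤ (∣*∣-mono a (b ℚ.- d) 0<A a≤A bd≤δ)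
                       (∣*∣-mono d (a ℚ.- c) 0<B d≤B ac≤δ) ⟩
      A ℚ.* δ ℚ.+ B ℚ.* δ
        ≡⟨ sym (ℚₚ.*-distribʳ-+ δ A B) ⟩
      (A ℚ.+ B) ℚ.* δ ∎
      where open ℚₚ.≤-Reasoning

    divide : ∀ {C ε} → 0ℚ ℚ.< C → 0ℚ ℚ.< ε → ∃ λ δ → 0ℚ ℚ.< δ × C ℚ.* δ ≡ ε
    divide {C} {ε} 0<C 0<ε = (ℚ.1/ C) ℚ.* ε ,
      *-pos (ℚₚ.positive⁻¹ (ℚ.1/ C) {{ℚₚ.1/pos⇒pos C}}) 0<ε , (begin
        C ℚ.* ((ℚ.1/ C) ℚ.* ε)    ≡⟨ sym (ℚₚ.*-assoc C (ℚ.1/ C) ε) ⟩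
        (C ℚ.* (ℚ.1/ C)) ℚ.* ε    ≡⟨ cong (ℚ._* ε) (ℚₚ.*-inverseʳ C) ⟩
        1ℚ ℚ.* ε                  ≡⟨ ℚₚ.*-identityˡ ε ⟩
        ε                         ∎)
      where
      open ≡-Reasoning
      instance
        C-pos : ℚ.Positive C
        C-pos = ℚ.positive 0<C
        C-nonZero : ℚ.NonZero C
        C-nonZero = ℚₚ.pos⇒nonZero C

    *-cauchy : ∀ {x y} → IsCauchy x → IsCauchy y → IsCauchy (λ n → x n ℚ.* y n)
    *-cauchy {x} {y} cx cy ε 0<ε =
      let A , 0<A , K , hK = eventually-bounded cx
          B , 0<B , L , hL = eventually-bounded cy
          δ , 0<δ , Cδ≡ε   = divide (ℚₚ.+-mono-< 0<A 0<B) 0<ε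
          M , hM           = cx δ 0<δ
          N , hN           = cy δ 0<δ
      in (K ℕ.⊔ L) ℕ.⊔ (M ℕ.⊔ N) , λ m n ≤m ≤n →
      ℚₚ.≤-trans
        (*-close (x m) (y m) (x n) (y n) 0<A 0<B
          (hK m (ℕₚ.m⊔n≤o⇒m≤o K L (left K L M N ≤m)))
          (hL n (ℕₚ.m⊔n≤o⇒n≤o K L (left K L M N ≤n)))
          (hM m n (ℕₚ.m⊔n≤o⇒m≤o M N (right K L M N ≤m)) (ℕₚ.m⊔n≤o⇒m≤o M N (right K L M N ≤n)))
          (hN m n (ℕₚ.m⊔n≤o⇒n≤o M N (right K L M N ≤m)) (ℕₚ.m⊔n≤o⇒n≤o M N (right K L M N ≤n))))
        (ℚₚ.≤-reflexive Cδ≡ε)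
      where
      left : ∀ K L M N {n} → (K ℕ.⊔ L) ℕ.⊔ (M ℕ.⊔ N) ℕ.≤ n → K ℕ.⊔ L ℕ.≤ n
      left K L M N = ℕₚ.m⊔n≤o⇒m≤o (K ℕ.⊔ L) (M ℕ.⊔ N)
      right : ∀ K L M N {n} → (K ℕ.⊔ L) ℕ.⊔ (M ℕ.⊔ N) ℕ.≤ n → M ℕ.⊔ N ℕ.≤ n
      right K L M N = ℕₚ.m⊔n≤o⇒n≤o (K ℕ.⊔ L) (M ℕ.⊔ N)

infix  8 -_
infixl 7 _*_
infixl 6 _+_ _-_

_+_ : ℝ → ℝ → ℝ
x + y = mkℝ (λ n → seq x n ℚ.+ seq y n) (+-cauchy {seq x} {seq y} (cauchy x) (cauchy y))

-_ : ℝ → ℝ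
- x = mkℝ (λ n → ℚ.- seq x n) (neg-cauchy {seq x} (cauchy x))

_-_ : ℝ → ℝ → ℝ
x - y = x + (- y)

_*_ : ℝ → ℝ → ℝ
x * y = mkℝ (λ n → seq x n ℚ.* seq y n) (*-cauchy {seq x} {seq y} (cauchy x) (cauchy y))

ℝ-+-rawMonoid : RawMonoid 0ℓ 0ℓ
ℝ-+-rawMonoid = record { Carrier = ℝ ; _≈_ = _≈_ ; _∙_ = _+_ ; ε = fromℚ 0ℚ }

open Sum ℝ-+-rawMonoid using () renaming (∑< to ∑ℝ) public

Limit : (ℕ → ℝ) → ℝ → Set
Limit x l = ∀ ε → 0ℚ ℚ.< ε →
  ∃ λ N → ∀ n → N ℕ.≤ n → (x n ≤ l + fromℚ ε) × (l ≤ x n + fromℚ ε)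

alternating : (ℕ → ℚ) → ℕ → ℚ
alternating a n = ∑ℚ n λ k → ((ℚ.- 1ℚ) ^ℚ k) ℚ.* a k

fourOverOdd : ℕ → ℚ
fourOverOdd k = + 4 ℚ./ suc (2 ℕ.* k)

private
  record Decreasing (a : ℕ → ℚ) : Set where
    constructor decreasing
    field
      nonneg : ∀ k → 0ℚ ℚ.≤ a k
      step   : ∀ k → a (suc k) ℚ.≤ a k

  open Decreasing

private
  abstract
    ∑-neg : ∀ n {f g} → (∀ k → f k ≡ ℚ.- g k) → ∑ℚ n f ≡ ℚ.- ∑ℚ n g
    ∑-neg zero    f≡-g = refl
    ∑-neg (suc n) {f} {g} f≡-g =
      trans (cong₂ ℚ._+_ (f≡-g 0) (∑-neg n λ k → f≡-g (suc k)))
            (sym (ℚₚ.neg-distrib-+ (g 0) (∑ℚ n λ k → g (suc k))))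

    alternating-suc : ∀ a n →
      alternating a (suc n) ≡ a 0 ℚ.- alternating (λ k → a (suc k)) n
    alternating-suc a n = cong₂ ℚ._+_ (ℚₚ.*-identityˡ (a 0)) (∑-neg n flip-sign)
      where
      flip-sign : ∀ k → ((ℚ.- 1ℚ) ^ℚ suc k) ℚ.* a (suc k)
                     ≡ ℚ.- (((ℚ.- 1ℚ) ^ℚ k) ℚ.* a (suc k))
      flip-sign k = trans (ℚₚ.*-assoc (ℚ.- 1ℚ) ((ℚ.- 1ℚ) ^ℚ k) (a (suc k)))
        (trans (sym (ℚₚ.neg-distribˡ-* 1ℚ (((ℚ.- 1ℚ) ^ℚ k) ℚ.* a (suc k))))
               (cong ℚ.-_ (ℚₚ.*-identityˡ (((ℚ.- 1ℚ) ^ℚ k) ℚ.* a (suc k)))))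

    shift : ∀ {a} → Decreasing a → Decreasing (λ k → a (suc k))
    shift d = decreasing (λ k → nonneg d (suc k)) (λ k → step d (suc k))

    0≤q-p : ∀ {p q} → p ℚ.≤ q → 0ℚ ℚ.≤ q ℚ.- p
    0≤q-p {p} p≤q =
      ℚₚ.≤-trans (ℚₚ.≤-reflexive (sym (ℚₚ.+-inverseʳ p))) (ℚₚ.+-monoˡ-≤ (ℚ.- p) p≤q)

    q-p≤q : ∀ {p q} → 0ℚ ℚ.≤ p → q ℚ.- p ℚ.≤ q
    q-p≤q {p} {q} 0≤p = ℚₚ.≤-trans (ℚₚ.+-monoʳ-≤ q (ℚₚ.neg-antimono-≤ 0≤p))
                                   (ℚₚ.≤-reflexive (ℚₚ.+-identityʳ q))

    alternating-bounds : ∀ {a} → Decreasing a → ∀ n →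
      (0ℚ ℚ.≤ alternating a n) × (alternating a n ℚ.≤ a 0)
    alternating-bounds d zero = ℚₚ.≤-refl , nonneg d 0
    alternating-bounds {a} d (suc n) =
      let 0≤t , t≤a₁ = alternating-bounds (shift d) n
          eq         = alternating-suc a n
      in ℚₚ.≤-trans (0≤q-p (ℚₚ.≤-trans t≤a₁ (step d 0))) (ℚₚ.≤-reflexive (sym eq))
       , ℚₚ.≤-trans (ℚₚ.≤-reflexive eq) (q-p≤q 0≤t)

    alternating-tail : ∀ {a} → Decreasing a → ∀ n j →
      ℚ.∣ alternating a (n ℕ.+ j) ℚ.- alternating a n ∣ ℚ.≤ a n
    alternating-tail {a} d zero j =
      let 0≤t , t≤a₀ = alternating-bounds d j
      in ℚₚ.≤-trans (ℚₚ.≤-reflexive (trans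
           (cong ℚ.∣_∣ (ℚₚ.+-identityʳ (alternating a j))) (ℚₚ.0≤p⇒∣p∣≡p 0≤t))) t≤a₀
    alternating-tail {a} d (suc n) j =
      ℚₚ.≤-trans (ℚₚ.≤-reflexive eq) (alternating-tail (shift d) n j)
      where
      cancel : ∀ p q r → (p ℚ.- q) ℚ.- (p ℚ.- r) ≡ ℚ.- (q ℚ.- r)
      cancel = solve 3 (λ p q r → (p :- q) :- (p :- r) := :- (q :- r)) refl
        where open +-*-Solver
      a′ : ℕ → ℚ
      a′ k = a (suc k)
      t u : ℚ
      t = alternating a′ (n ℕ.+ j)
      u = alternating a′ n
      eq : ℚ.∣ alternating a (suc n ℕ.+ j) ℚ.- alternating a (suc n) ∣ ≡ ℚ.∣ t ℚ.- u ∣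
      eq = trans
        (cong ℚ.∣_∣ (trans
          (cong₂ ℚ._-_ (alternating-suc a (n ℕ.+ j)) (alternating-suc a n))
          (cancel (a 0) t u)))
        (ℚₚ.∣-p∣≡∣p∣ (t ℚ.- u))

    alternating-cauchy : ∀ {a} → Decreasing a →
      (∀ δ → 0ℚ ℚ.< δ → ∃ λ N → a N ℚ.≤ δ) → IsCauchy (alternating a)
    alternating-cauchy {a} d small ε 0<ε =
      let N , aN≤ = small (ℚ.½ ℚ.* ε) (half-pos 0<ε)
      in N , λ m n N≤m N≤n → begin
      ℚ.∣ s m ℚ.- s n ∣
        ≡⟨ cong ℚ.∣_∣ (through (s m) (s n) (s N)) ⟩
      ℚ.∣ (s m ℚ.- s N) ℚ.- (s n ℚ.- s N) ∣
        ≤⟨ ℚₚ.∣p-q∣≤∣p∣+∣q∣ (s m ℚ.- s N) (s n ℚ.- s N) ⟩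
      ℚ.∣ s m ℚ.- s N ∣ ℚ.+ ℚ.∣ s n ℚ.- s N ∣
        ≤⟨ ℚₚ.+-mono-≤ (tail N m N≤m) (tail N n N≤n) ⟩
      a N ℚ.+ a N
        ≤⟨ ℚₚ.+-mono-≤ aN≤ aN≤ ⟩
      ℚ.½ ℚ.* ε ℚ.+ ℚ.½ ℚ.* ε
        ≡⟨ half ε ⟩
      ε ∎
      where
      open ℚₚ.≤-Reasoning
      s : ℕ → ℚ
      s = alternating a
      through : ∀ p q r → p ℚ.- q ≡ (p ℚ.- r) ℚ.- (q ℚ.- r)
      through = solve 3 (λ p q r → p :- q := (p :- r) :- (q :- r)) refl
        where open +-*-Solver
      tail : ∀ N m → N ℕ.≤ m → ℚ.∣ s m ℚ.- s N ∣ ℚ.≤ a N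
      tail N m N≤m = subst (λ k → ℚ.∣ s k ℚ.- s N ∣ ℚ.≤ a N)
        (ℕₚ.m+[n∸m]≡n N≤m) (alternating-tail d N (m ℕ.∸ N))

    fromℚᵘ-mono-≤ : ∀ {p q} → p ℚᵘ.≤ q → ℚ.fromℚᵘ p ℚ.≤ ℚ.fromℚᵘ q
    fromℚᵘ-mono-≤ {p} {q} p≤q = ℚₚ.toℚᵘ-cancel-≤
      (ℚᵘₚ.≤-respˡ-≃ (ℚᵘₚ.≃-sym (ℚₚ.toℚᵘ-fromℚᵘ p))
        (ℚᵘₚ.≤-respʳ-≃ (ℚᵘₚ.≃-sym (ℚₚ.toℚᵘ-fromℚᵘ q)) p≤q))

    fraction-≤ : ∀ a b c d → a ℕ.* suc d ℕ.≤ c ℕ.* suc b →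
                 (+ a) ℚ./ suc b ℚ.≤ (+ c) ℚ./ suc d
    fraction-≤ a b c d ad≤cb = fromℚᵘ-mono-≤ {mkℚᵘ (+ a) b} {mkℚᵘ (+ c) d}
      (ℚᵘ.*≤* (subst₂ ℤ._≤_ (ℤₚ.pos-* a (suc d)) (ℤₚ.pos-* c (suc b)) (ℤ.+≤+ ad≤cb)))

    fourOverOdd-decreasing : Decreasing fourOverOdd
    fourOverOdd-decreasing = decreasing
      (λ k → fraction-≤ 0 0 4 (2 ℕ.* k) ℕ.z≤n)
      (λ k → fraction-≤ 4 (2 ℕ.* suc k) 4 (2 ℕ.* k)
        (ℕₚ.*-monoʳ-≤ 4 (ℕ.s≤s (ℕₚ.*-monoʳ-≤ 2 (ℕₚ.n≤1+n k)))))

    fourOverOdd-small : ∀ δ → 0ℚ ℚ.< δ → ∃ λ N → fourOverOdd N ℚ.≤ δ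
    fourOverOdd-small δ@(ℚ.mkℚ (+ suc p) q c) 0<δ = N ,
      ℚₚ.≤-trans (fraction-≤ 4 (2 ℕ.* N) (suc p) q 4q≤)
                 (ℚₚ.≤-reflexive (ℚₚ.↥p/↧p≡p δ))
      where
      N : ℕ
      N = 4 ℕ.* suc q
      4q≤ : 4 ℕ.* suc q ℕ.≤ suc p ℕ.* suc (2 ℕ.* N)
      4q≤ = ℕₚ.≤-trans (ℕₚ.m≤n*m N 2)
        (ℕₚ.≤-trans (ℕₚ.n≤1+n (2 ℕ.* N)) (ℕₚ.m≤n*m (suc (2 ℕ.* N)) (suc p)))
    fourOverOdd-small (ℚ.mkℚ (+ zero)    q c) (ℚ.*<* (ℤ.+<+ ()))
    fourOverOdd-small (ℚ.mkℚ ℤ.-[1+ p ] q c) (ℚ.*<* ())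

-- Leibniz: π = 4 arctan 1 = ∑ₖ (-1)ᵏ 4/(2k+1).
π : ℝ
π = mkℝ (alternating fourOverOdd)
        (alternating-cauchy fourOverOdd-decreasing fourOverOdd-small)

record ℂ : Set where
  constructor _+i_
  field
    re : ℝ
    im : ℝ

open ℂ public

infix  4 _≈ℂ_
infixl 7 _*ℂ_
infixl 6 _+ℂ_ _-ℂ_

_≈ℂ_ : ℂ → ℂ → Set
w ≈ℂ z = (re w ≈ re z) × (im w ≈ im z)

fromℝ : ℝ → ℂ
fromℝ x = x +i fromℚ 0ℚ

0ℂ 1ℂ : ℂ
0ℂ = fromℝ (fromℚ 0ℚ)
1ℂ = fromℝ (fromℚ 1ℚ)

_+ℂ_ : ℂ → ℂ → ℂ
w +ℂ z = (re w + re z) +i (im w + im z)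

_-ℂ_ : ℂ → ℂ → ℂ
w -ℂ z = (re w - re z) +i (im w - im z)

_*ℂ_ : ℂ → ℂ → ℂ
w *ℂ z = (re w * re z - im w * im z) +i (re w * im z + im w * re z)

∣_∣² : ℂ → ℝ
∣ z ∣² = re z * re z + im z * im z

ℂ-rawSemiring : RawSemiring 0ℓ 0ℓ
ℂ-rawSemiring = record
  { Carrier = ℂ ; _≈_ = _≈ℂ_ ; _+_ = _+ℂ_ ; _*_ = _*ℂ_ ; 0# = 0ℂ ; 1# = 1ℂ }

open Sum (RawSemiring.+-rawMonoid ℂ-rawSemiring) using () renaming (∑< to ∑ℂ) public
open RawSemiringDefs ℂ-rawSemiring using () renaming (_^_ to _^ℂ_) public

-- Convergence of the partial sums in modulus: ∣ ∑< n a - s ∣ ≤ ε, squared.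
HasSum : (ℕ → ℂ) → ℂ → Set
HasSum a s = ∀ ε → 0ℚ ℚ.< ε →
  ∃ λ N → ∀ n → N ℕ.≤ n → ∣ ∑ℂ n a -ℂ s ∣² ≤ fromℚ (ε ℚ.* ε)

-- Over [0,1]: the uniform left Riemann sums converge to the integral whenever f is
-- continuous; f is only ever the squared modulus of a polynomial here.
HasIntegral₀¹ : (ℝ → ℝ) → ℝ → Set
HasIntegral₀¹ f = Limit λ m →
  fromℚ (+ 1 ℚ./ suc m) * ∑ℝ (suc m) λ k → f (fromℚ (+ k ℚ./ suc m))

HasNorm² : (ℝ → ℂ) → ℝ → Set
HasNorm² f = HasIntegral₀¹ λ x → ∣ f x ∣²

-- Norms are nonnegative, so they compare as their squares do.
‖_‖≤‖_‖ : (ℝ → ℂ) → (ℝ → ℂ) → Set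
‖ f ‖≤‖ g ‖ = ∀ {I J} → HasNorm² f I → HasNorm² g J → I ≤ J

monomial : ℂ → ℕ → ℝ → ℂ
monomial a k x = a *ℂ (fromℝ x ^ℂ k)

partialPoly : (ℕ → ℂ) → ℕ → ℝ → ℂ
partialPoly c n x = ∑ℂ (suc n) λ k → monomial (c k) k x

extend : (ℕ → ℂ) → ℕ → ℂ → ℝ → ℂ
extend c n z x = partialPoly c n x +ℂ monomial z (suc n) x

-- Minimizers are unique, so there is exactly one such sequence up to _≈ℂ_.
IsGreedy : (ℕ → ℂ) → Set
IsGreedy c =
  c 0 ≈ℂ 1ℂ ×
  (∀ n z → ‖ extend c n (c (suc n)) ‖≤‖ extend c n z ‖)

H : ℕ → ℚ
H m = ∑ℚ m λ k → + 1 ℚ./ suc k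

private
  abstract
    /1≢0 : ∀ i → i ≢ + 0 → i ℚ./ 1 ≢ 0ℚ
    /1≢0 i i≢0 i/1≡0 = i≢0 (begin
      i                                   ≡⟨ sym (ℚₚ.↥-/ i 1) ⟩
      ℚ.↥ (i ℚ./ 1) ℤ.* ℤGCD.gcd i (+ 1)  ≡⟨ cong (ℤ._* ℤGCD.gcd i (+ 1)) (cong ℚ.↥_ i/1≡0) ⟩
      + 0 ℤ.* ℤGCD.gcd i (+ 1)            ≡⟨ ℤₚ.*-zeroˡ (ℤGCD.gcd i (+ 1)) ⟩
      + 0                                 ∎)
      where open ≡-Reasoning

    /1-nonZero : ∀ {n r} → n ≢ r → ℚ.NonZero ((+ n ℤ.- + r) ℚ./ 1)
    /1-nonZero {n} {r} n≢r = ℚ.≢-nonZero (/1≢0 (+ n ℤ.- + r) λ n-r≡0 →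
      n≢r (ℤₚ.+-injective (ℤₚ.i-j≡0⇒i≡j (+ n) (+ r) n-r≡0)))

h : ℕ → ℕ → ℝ
h r n with n ℕₚ.≟ r
... | yes _   = π * π * fromℚ (+ 1 ℚ./ 6)
              - fromℚ (∑ℚ (2 ℕ.* r) λ k → + 1 ℚ./ (suc k ℕ.* suc k))
... | no  n≢r = fromℚ (((H (2 ℕ.* n) ℚ.- H (n ℕ.+ r)) ℚ.÷ ((+ n ℤ.- + r) ℚ./ 1))
                       {{/1-nonZero n≢r}})

{-# OPTIONS --safe #-}

-- Minimality means that pₙ is orthogonal to xⁿ for n ≥ 1, so the cₙ are the rationals coeff n of the
-- orthogonality recursion.  Since h_r(k) = ∑_{m ≥ k} 1/((k+m+1)(m+r+1)), the n-th partial sum of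
-- ∑ c_k h_r(k) is 1/(r+1) + ∑_{m ≥ n} ⟨p_{n-1}, xᵐ⟩/(m+r+1): orthogonality leaves a single term with
-- m < n.  By Cauchy–Schwarz and ‖p_{n-1}‖ ≤ 1 the remainder is at most ∑_{m ≥ n} 1/((m+1)√(2m+1)),
-- which tends to 0.  For k = r this needs ζ(2) = π²/6, obtained by squaring the Leibniz series.
-- Real numbers are handled index by index along their Cauchy sequences, where all algebra takes
-- place in ℚ; a minimiser is compared with the exact one through ‖p + z xᵐ‖² - ‖p + w xᵐ‖² =
-- ∣z - w∣²/(2m+1).

module Submission where

open import Defs hiding (_+_; _*_; _-_; -_; _≤_; _≈_)
import Defs as D
import Data.Integer.Base as ℤ
import Data.Integer.Properties as ℤₚ
open import Data.Nat.Base using (ℕ; zero; suc)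
import Data.Nat.Base as ℕ
import Data.Nat.Properties as ℕₚ
open import Data.Product.Base using (∃; _×_; _,_; proj₁; proj₂)
open import Data.Rational.Base
open import Data.Rational.Properties
open import Data.Rational.Solver using (module +-*-Solver)
open import Data.Rational.Unnormalised.Base as ℚᵘ using (mkℚᵘ)
import Data.Rational.Unnormalised.Properties as ℚᵘₚ
open import Data.Sum.Base using (inj₁; inj₂; [_,_]′)
open import Function.Base using (_∘_)
open import Relation.Binary.PropositionalEquality
  using (_≡_; _≢_; refl; sym; trans; cong; cong₂; subst; subst₂; module ≡-Reasoning)
open import Relation.Binary.Definitions using (tri<; tri≈; tri>)
open import Relation.Nullary.Decidable.Core using (Dec; yes; no)
open import Relation.Nullary.Negation.Core using (contradiction)

-- `IsGreedy` compares two norms only after both integrals have been exhibited, so their values must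
-- be constructed. Squared norms are quadratic forms in the moments, and the Riemann sums of xˢ tend
-- to 1/(s+1) by mean value bounds. The same passage to the limit shows that the Hilbert form is
-- nonnegative, which is where Cauchy-Schwarz comes from. Minimality yields only inequalities that
-- hold from some index on and within a tolerance. The sequence behind cₙ need not hit its rational
-- value, so every comparison is a null sequence in the index t. The same t serves as truncation
-- point of ∑ 1/((k+m+1)(m+r+1)), so that approximating cₖ and summing h_r(k) become one limit. The
-- estimate of the remainder is uniform in t; hence n can be fixed before t. For ζ(2) there is an
-- exact identity at every N: twice the squared Leibniz sum is the sum of the odd squares plus an
-- explicit defect, made of blocks of the alternating harmonic series and of size O((log N)/N).

infixr 0 _∙_
_∙_ : ∀ {p q r : ℚ} → p ≡ q → q ≡ r → p ≡ r
_∙_ = trans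

-- Natural numbers and their reciprocals

fromℚᵘ-homo-+ : ∀ p q → fromℚᵘ (p ℚᵘ.+ q) ≡ fromℚᵘ p + fromℚᵘ q
fromℚᵘ-homo-+ p q = toℚᵘ-injective (begin
  toℚᵘ (fromℚᵘ (p ℚᵘ.+ q))                ≈⟨ toℚᵘ-fromℚᵘ (p ℚᵘ.+ q) ⟩
  p ℚᵘ.+ q                                ≈⟨ ℚᵘₚ.+-cong (toℚᵘ-fromℚᵘ p) (toℚᵘ-fromℚᵘ q) ⟨
  toℚᵘ (fromℚᵘ p) ℚᵘ.+ toℚᵘ (fromℚᵘ q)    ≈⟨ toℚᵘ-homo-+ (fromℚᵘ p) (fromℚᵘ q) ⟨
  toℚᵘ (fromℚᵘ p + fromℚᵘ q)              ∎)
  where open ℚᵘₚ.≃-Reasoning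

fromℚᵘ-homo-* : ∀ p q → fromℚᵘ (p ℚᵘ.* q) ≡ fromℚᵘ p * fromℚᵘ q
fromℚᵘ-homo-* p q = toℚᵘ-injective (begin
  toℚᵘ (fromℚᵘ (p ℚᵘ.* q))                ≈⟨ toℚᵘ-fromℚᵘ (p ℚᵘ.* q) ⟩
  p ℚᵘ.* q                                ≈⟨ ℚᵘₚ.*-cong (toℚᵘ-fromℚᵘ p) (toℚᵘ-fromℚᵘ q) ⟨
  toℚᵘ (fromℚᵘ p) ℚᵘ.* toℚᵘ (fromℚᵘ q)    ≈⟨ toℚᵘ-homo-* (fromℚᵘ p) (fromℚᵘ q) ⟨
  toℚᵘ (fromℚᵘ p * fromℚᵘ q)              ∎)
  where open ℚᵘₚ.≃-Reasoning

/1-homo-+ : ∀ i j → (i ℤ.+ j) / 1 ≡ i / 1 + j / 1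
/1-homo-+ i j = fromℚᵘ-cong {mkℚᵘ (i ℤ.+ j) 0} {mkℚᵘ i 0 ℚᵘ.+ mkℚᵘ j 0}
    (ℚᵘ.*≡* (cong (ℤ._* ℤ.+ 1) (sym (cong₂ ℤ._+_ (ℤₚ.*-identityʳ i) (ℤₚ.*-identityʳ j)))))
  ∙ fromℚᵘ-homo-+ (mkℚᵘ i 0) (mkℚᵘ j 0)

/1-neg : ∀ i → (ℤ.- i) / 1 ≡ - (i / 1)
/1-neg i = begin
  (ℤ.- i) / 1                          ≡⟨ +-identityʳ _ ⟨
  (ℤ.- i) / 1 + 0ℚ                     ≡⟨ cong (λ z → (ℤ.- i) / 1 + z) (+-inverseʳ (i / 1)) ⟨
  (ℤ.- i) / 1 + (i / 1 - i / 1)        ≡⟨ +-assoc ((ℤ.- i) / 1) (i / 1) (- (i / 1)) ⟨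
  (ℤ.- i) / 1 + i / 1 - i / 1          ≡⟨ cong (_- i / 1) (/1-homo-+ (ℤ.- i) i) ⟨
  (ℤ.- i ℤ.+ i) / 1 - i / 1            ≡⟨ cong (λ j → j / 1 - i / 1) (ℤₚ.+-inverseˡ i) ⟩
  0ℚ - i / 1                           ≡⟨ +-identityˡ _ ⟩
  - (i / 1)                            ∎
  where open ≡-Reasoning

abstract
  ι : ℕ → ℚ
  ι n = ℤ.+ n / 1

  -- The shift by one makes `inv s` the moment ∫₀¹ xˢ dx and `inv (i + j)` an entry of the Hilbert
  -- matrix. Being abstract, it never unfolds into the normalisation of fractions.
  inv : ℕ → ℚ
  inv n = ℤ.+ 1 / suc n

  ι≡ : ∀ n → ι n ≡ ℤ.+ n / 1
  ι≡ n = refl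

  inv≡ : ∀ n → inv n ≡ ℤ.+ 1 / suc n
  inv≡ n = refl

  ι0 : ι 0 ≡ 0ℚ
  ι0 = refl

  ι1 : ι 1 ≡ 1ℚ
  ι1 = refl

  inv0 : inv 0 ≡ 1ℚ
  inv0 = refl

  ι-+ : ∀ m n → ι (m ℕ.+ n) ≡ ι m + ι n
  ι-+ m n = /1-homo-+ (ℤ.+ m) (ℤ.+ n)

  /-* : ∀ a b → (ℤ.+ a / suc b) * ι (suc b) ≡ ι a
  /-* a b = sym (fromℚᵘ-homo-* (mkℚᵘ (ℤ.+ a) b) (mkℚᵘ (ℤ.+ suc b) 0))
    ∙ fromℚᵘ-cong {mkℚᵘ (ℤ.+ a) b ℚᵘ.* mkℚᵘ (ℤ.+ suc b) 0} {mkℚᵘ (ℤ.+ a) 0}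
        (ℚᵘ.*≡* (trans (ℤₚ.*-identityʳ _)
          (cong (λ k → ℤ.+ a ℤ.* ℤ.+ k) (sym (ℕₚ.*-identityʳ (suc b))))))

  inv-* : ∀ n → inv n * ι (suc n) ≡ 1ℚ
  inv-* = /-* 1

  0<inv : ∀ n → 0ℚ < inv n
  0<inv n = positive⁻¹ (inv n) {{normalize-pos 1 (suc n)}}

ι-suc : ∀ n → ι (suc n) ≡ 1ℚ + ι n
ι-suc n = ι-+ 1 n ∙ cong (_+ ι n) ι1

ι-* : ∀ m n → ι (m ℕ.* n) ≡ ι m * ι n
ι-* zero    n = ι0 ∙ sym (*-zeroˡ (ι n)) ∙ cong (_* ι n) (sym ι0)
ι-* (suc m) n = ι-+ n (m ℕ.* n) ∙ cong (ι n +_) (ι-* m n)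
  ∙ solve 2 (λ x y → y :+ x :* y := (con 1ℚ :+ x) :* y) refl (ι m) (ι n)
  ∙ cong (_* ι n) (sym (ι-suc m))
  where open +-*-Solver

inverse-unique : ∀ {x y z} → x * z ≡ 1ℚ → y * z ≡ 1ℚ → x ≡ y
inverse-unique {x} {y} {z} xz yz =
  sym (*-identityʳ x) ∙ cong (x *_) (sym yz)
  ∙ solve 3 (λ x y z → x :* (y :* z) := y :* (x :* z)) refl x y z
  ∙ cong (y *_) xz ∙ *-identityʳ y
  where open +-*-Solver

*-cancel : ∀ {x y z w} → z * w ≡ 1ℚ → z * x ≡ z * y → x ≡ y
*-cancel {x} {y} {z} {w} zw eq = one x ∙ cong (w *_) eq ∙ sym (one y)
  where
  open +-*-Solver
  one : ∀ v → v ≡ w * (z * v)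
  one v = sym (*-identityˡ v) ∙ cong (_* v) (sym zw)
    ∙ solve 3 (λ z w v → (z :* w) :* v := w :* (z :* v)) refl z w v

/≡ι*inv : ∀ a b → ℤ.+ a / suc b ≡ ι a * inv b
/≡ι*inv a b = *-cancel {z = ι (suc b)} (*-comm (ι (suc b)) (inv b) ∙ inv-* b)
  (*-comm (ι (suc b)) (ℤ.+ a / suc b) ∙ /-* a b ∙ sym (*-identityʳ (ι a))
   ∙ cong (ι a *_) (sym (inv-* b))
   ∙ solve 3 (λ x y z → x :* (y :* z) := z :* (x :* y)) refl (ι a) (inv b) (ι (suc b)))
  where open +-*-Solver

inv-square : ∀ k → ℤ.+ 1 / (suc k ℕ.* suc k) ≡ inv k * inv k
inv-square k = inverse-unique {z = ι (suc k ℕ.* suc k)}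
  -- (k + 1)² is the successor of k + k (k + 1), which is therefore the index for `inv`.
  (cong (_* ι (suc k ℕ.* suc k)) (sym (inv≡ (k ℕ.+ k ℕ.* suc k))) ∙ inv-* (k ℕ.+ k ℕ.* suc k))
  (cong (inv k * inv k *_) (ι-* (suc k) (suc k))
   ∙ solve 2 (λ x y → x :* x :* (y :* y) := (x :* y) :* (x :* y)) refl (inv k) (ι (suc k))
   ∙ cong₂ _*_ (inv-* k) (inv-* k))
  where open +-*-Solver

-- Reciprocals enter through the equations x X = 1 and y Y = 1, so that partial fractions become
-- ring identities.
recip-diff : ∀ {x X y Y} → x * X ≡ 1ℚ → y * Y ≡ 1ℚ → x - y ≡ (Y - X) * (x * y)
recip-diff {x} {X} {y} {Y} xX yY = begin
  x - y                          ≡⟨ cong₂ _-_ (*-identityʳ x) (*-identityʳ y) ⟨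
  x * 1ℚ - y * 1ℚ                ≡⟨ cong₂ (λ a b → x * a - y * b) yY xX ⟨
  x * (y * Y) - y * (x * X)      ≡⟨ solve 4 (λ x X y Y → x :* (y :* Y) :- y :* (x :* X)
                                      := (Y :- X) :* (x :* y)) refl x X y Y ⟩
  (Y - X) * (x * y)              ∎
  where
  open ≡-Reasoning
  open +-*-Solver

recip-sum : ∀ {x X y Y} → x * X ≡ 1ℚ → y * Y ≡ 1ℚ → x + y ≡ (Y + X) * (x * y)
recip-sum {x} {X} {y} {Y} xX yY = begin
  x + y                          ≡⟨ cong₂ _+_ (*-identityʳ x) (*-identityʳ y) ⟨
  x * 1ℚ + y * 1ℚ                ≡⟨ cong₂ (λ a b → x * a + y * b) yY xX ⟨
  x * (y * Y) + y * (x * X)      ≡⟨ solve 4 (λ x X y Y → x :* (y :* Y) :+ y :* (x :* X)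
                                      := (Y :+ X) :* (x :* y)) refl x X y Y ⟩
  (Y + X) * (x * y)              ∎
  where
  open ≡-Reasoning
  open +-*-Solver

-- Order

0≤q-p : ∀ {p q} → p ≤ q → 0ℚ ≤ q - p
0≤q-p {p} {q} p≤q = subst (_≤ q - p) (+-inverseʳ p) (+-monoˡ-≤ (- p) p≤q)

0≤q-p⇒p≤q : ∀ {p q} → 0ℚ ≤ q - p → p ≤ q
0≤q-p⇒p≤q {p} {q} 0≤ = subst₂ _≤_ (+-identityˡ p)
  (solve 2 (λ p q → q :- p :+ p := q) refl p q) (+-monoˡ-≤ p 0≤)
  where open +-*-Solver

0≤+ : ∀ {p q} → 0ℚ ≤ p → 0ℚ ≤ q → 0ℚ ≤ p + q
0≤+ = +-mono-≤

0≤* : ∀ {p q} → 0ℚ ≤ p → 0ℚ ≤ q → 0ℚ ≤ p * q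
0≤* {p} {q} 0≤p 0≤q =
  nonNegative⁻¹ (p * q) {{nonNeg*nonNeg⇒nonNeg p {{nonNegative 0≤p}} q {{nonNegative 0≤q}}}}

0<* : ∀ {p q} → 0ℚ < p → 0ℚ < q → 0ℚ < p * q
0<* {p} {q} 0<p 0<q = positive⁻¹ (p * q) {{pos*pos⇒pos p {{positive 0<p}} q {{positive 0<q}}}}

0≤² : ∀ p → 0ℚ ≤ p * p
0≤² p with ≤-total 0ℚ p
... | inj₁ 0≤p = 0≤* 0≤p 0≤p
... | inj₂ p≤0 = subst (0ℚ ≤_) (solve 1 (λ p → (:- p) :* (:- p) := p :* p) refl p)
                   (0≤* (neg-antimono-≤ p≤0) (neg-antimono-≤ p≤0))
  where open +-*-Solver

*-monoˡ : ∀ {p q r} → 0ℚ ≤ r → p ≤ q → r * p ≤ r * q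
*-monoˡ {r = r} 0≤r = *-monoˡ-≤-nonNeg r {{nonNegative 0≤r}}

*-monoʳ : ∀ {p q r} → 0ℚ ≤ r → p ≤ q → p * r ≤ q * r
*-monoʳ {r = r} 0≤r = *-monoʳ-≤-nonNeg r {{nonNegative 0≤r}}

*-mono : ∀ {p q r s} → 0ℚ ≤ p → 0ℚ ≤ s → p ≤ q → r ≤ s → p * r ≤ q * s
*-mono 0≤p 0≤s p≤q r≤s = ≤-trans (*-monoˡ 0≤p r≤s) (*-monoʳ 0≤s p≤q)

square-cancel-≤ : ∀ {p q} → 0ℚ ≤ q → p * p ≤ q * q → p ≤ q
square-cancel-≤ {p} {q} 0≤q pp≤qq = ≮⇒≥ λ q<p →
  <-irrefl refl (<-≤-trans
    (≤-<-trans (*-monoˡ 0≤q (<⇒≤ q<p)) (*-monoˡ-<-pos p {{positive (≤-<-trans 0≤q q<p)}} q<p))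
    pp≤qq)

∣∣-² : ∀ p → ∣ p ∣ * ∣ p ∣ ≡ p * p
∣∣-² p = sym (∣p*q∣≡∣p∣*∣q∣ p p) ∙ 0≤p⇒∣p∣≡p (0≤² p)

∣∣≤-by-squares : ∀ {p q} → 0ℚ ≤ q → p * p ≤ q * q → ∣ p ∣ ≤ q
∣∣≤-by-squares {p} 0≤q pp≤qq = square-cancel-≤ 0≤q (≤-trans (≤-reflexive (∣∣-² p)) pp≤qq)

p≤∣p∣ : ∀ p → p ≤ ∣ p ∣
p≤∣p∣ p with ≤-total 0ℚ p
... | inj₁ 0≤p = ≤-reflexive (sym (0≤p⇒∣p∣≡p 0≤p))
... | inj₂ p≤0 = ≤-trans p≤0 (0≤∣p∣ p)

∣∣≤ : ∀ {p q} → p ≤ q → - p ≤ q → ∣ p ∣ ≤ q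
∣∣≤ {p} p≤q -p≤q with ∣p∣≡p∨∣p∣≡-p p
... | inj₁ eq = ≤-trans (≤-reflexive eq) p≤q
... | inj₂ eq = ≤-trans (≤-reflexive eq) -p≤q

∣p-q∣≡∣q-p∣ : ∀ p q → ∣ p - q ∣ ≡ ∣ q - p ∣
∣p-q∣≡∣q-p∣ p q = sym (∣-p∣≡∣p∣ (p - q))
  ∙ cong ∣_∣ (solve 2 (λ p q → :- (p :- q) := q :- p) refl p q)
  where open +-*-Solver

∣-∣≤⇒≤+ : ∀ {p q ε} → ∣ p - q ∣ ≤ ε → p ≤ q + ε
∣-∣≤⇒≤+ {p} {q} {ε} pq = subst (_≤ q + ε)
  (solve 2 (λ p q → q :+ (p :- q) := p) refl p q)
  (+-monoʳ-≤ q (≤-trans (p≤∣p∣ (p - q)) pq))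
  where open +-*-Solver

0≤ι : ∀ n → 0ℚ ≤ ι n
0≤ι zero    = ≤-reflexive (sym ι0)
0≤ι (suc n) = subst (0ℚ ≤_) (sym (ι-suc n)) (0≤+ (<⇒≤ (positive⁻¹ 1ℚ)) (0≤ι n))

ι-mono : ∀ {m n} → m ℕ.≤ n → ι m ≤ ι n
ι-mono {m} {n} m≤n = subst (λ k → ι m ≤ ι k) (ℕₚ.m+[n∸m]≡n m≤n)
  (subst₂ _≤_ (+-identityʳ (ι m)) (sym (ι-+ m (n ℕ.∸ m))) (+-monoʳ-≤ (ι m) (0≤ι (n ℕ.∸ m))))

0≤inv : ∀ n → 0ℚ ≤ inv n
0≤inv n = <⇒≤ (0<inv n)

inv-anti : ∀ {m n} → m ℕ.≤ n → inv n ≤ inv m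
inv-anti {m} {n} m≤n = 0≤q-p⇒p≤q (subst (0ℚ ≤_)
  (sym (recip-diff {inv m} {ι (suc m)} {inv n} {ι (suc n)} (inv-* m) (inv-* n)))
  (0≤* {ι (suc n) - ι (suc m)} {inv m * inv n} (0≤q-p (ι-mono (ℕ.s≤s m≤n)))
    (0≤* {inv m} {inv n} (0≤inv m) (0≤inv n))))

inv≤1 : ∀ n → inv n ≤ 1ℚ
inv≤1 n = ≤-trans (inv-anti {0} {n} ℕ.z≤n) (≤-reflexive inv0)

inv-small : ∀ {ε} → 0ℚ < ε → ∃ λ N → inv N ≤ ε
inv-small {ε@(mkℚ (ℤ.+ suc p) q c)} 0<ε = q , ≤-trans
  (subst₂ _≤_ (cong (_* inv q) ι1 ∙ *-identityˡ (inv q)) (sym (/≡ι*inv (suc p) q))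
    (*-monoʳ (0≤inv q) (ι-mono {1} {suc p} (ℕ.s≤s ℕ.z≤n))))
  (≤-reflexive (↥p/↧p≡p ε))
inv-small {mkℚ (ℤ.+ zero)    q c} (*<* (ℤ.+<+ ()))
inv-small {mkℚ ℤ.-[1+ p ] q c} (*<* ())

ι-large : ∀ p → ∃ λ K → p ≤ ι (suc K)
ι-large p with ≤-total p 1ℚ
... | inj₁ p≤1 = 0 , ≤-trans p≤1 (≤-reflexive (sym ι1))
ι-large p@(mkℚ (ℤ.+ a) b c) | inj₂ _ = a , ≤-trans
  (subst₂ _≤_ (sym (/≡ι*inv a b) ∙ ↥p/↧p≡p p) (*-identityʳ (ι a))
    (*-monoˡ (0≤ι a) (inv≤1 b)))
  (ι-mono (ℕₚ.n≤1+n a))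
ι-large p@(mkℚ ℤ.-[1+ a ] b c) | inj₂ 1≤p with ≤-trans (<⇒≤ (positive⁻¹ 1ℚ)) 1≤p
... | *≤* ()

0<½* : ∀ {ε} → 0ℚ < ε → 0ℚ < ½ * ε
0<½* = 0<* (positive⁻¹ ½)

½+½ : ∀ ε → ½ * ε + ½ * ε ≡ ε
½+½ = solve 1 (λ ε → con ½ :* ε :+ con ½ :* ε := ε) refl
  where open +-*-Solver

-- Finite sums

∑-cong : ∀ n {f g : ℕ → ℚ} → (∀ k → f k ≡ g k) → ∑ℚ n f ≡ ∑ℚ n g
∑-cong zero    f≡g = refl
∑-cong (suc n) f≡g = cong₂ _+_ (f≡g 0) (∑-cong n (f≡g ∘ suc))

∑-cong-< : ∀ n {f g : ℕ → ℚ} → (∀ k → k ℕ.< n → f k ≡ g k) → ∑ℚ n f ≡ ∑ℚ n g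
∑-cong-< zero    f≡g = refl
∑-cong-< (suc n) f≡g =
  cong₂ _+_ (f≡g 0 ℕ.z<s) (∑-cong-< n λ k k<n → f≡g (suc k) (ℕ.s<s k<n))

∑-last : ∀ n (f : ℕ → ℚ) → ∑ℚ (suc n) f ≡ ∑ℚ n f + f n
∑-last zero    f = +-comm (f 0) 0ℚ
∑-last (suc n) f = cong (f 0 +_) (∑-last n (f ∘ suc)) ∙ sym (+-assoc (f 0) _ _)

∑-+ : ∀ n (f g : ℕ → ℚ) → ∑ℚ n (λ k → f k + g k) ≡ ∑ℚ n f + ∑ℚ n g
∑-+ zero    f g = refl
∑-+ (suc n) f g = cong (f 0 + g 0 +_) (∑-+ n (f ∘ suc) (g ∘ suc))
  ∙ solve 4 (λ a b c d → a :+ b :+ (c :+ d) := a :+ c :+ (b :+ d)) refl (f 0) (g 0) _ _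
  where open +-*-Solver

∑-*ˡ : ∀ n a (f : ℕ → ℚ) → ∑ℚ n (λ k → a * f k) ≡ a * ∑ℚ n f
∑-*ˡ zero    a f = sym (*-zeroʳ a)
∑-*ˡ (suc n) a f = cong (a * f 0 +_) (∑-*ˡ n a (f ∘ suc)) ∙ sym (*-distribˡ-+ a (f 0) _)

∑-*ʳ : ∀ n a (f : ℕ → ℚ) → ∑ℚ n (λ k → f k * a) ≡ ∑ℚ n f * a
∑-*ʳ n a f = ∑-cong n (λ k → *-comm (f k) a) ∙ ∑-*ˡ n a f ∙ *-comm a _

∑-neg : ∀ n (f : ℕ → ℚ) → ∑ℚ n (λ k → - f k) ≡ - ∑ℚ n f
∑-neg zero    f = refl
∑-neg (suc n) f = cong (- f 0 +_) (∑-neg n (f ∘ suc)) ∙ sym (neg-distrib-+ (f 0) _)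

∑-- : ∀ n (f g : ℕ → ℚ) → ∑ℚ n (λ k → f k - g k) ≡ ∑ℚ n f - ∑ℚ n g
∑-- n f g = ∑-+ n f (λ k → - g k) ∙ cong (λ z → ∑ℚ n f + z) (∑-neg n g)

∑-zero : ∀ n → ∑ℚ n (λ _ → 0ℚ) ≡ 0ℚ
∑-zero zero    = refl
∑-zero (suc n) = cong (λ z → 0ℚ + z) (∑-zero n)

∑-swap : ∀ m n (f : ℕ → ℕ → ℚ) →
  ∑ℚ m (λ i → ∑ℚ n λ j → f i j) ≡ ∑ℚ n λ j → ∑ℚ m λ i → f i j
∑-swap zero    n f = sym (∑-zero n)
∑-swap (suc m) n f = cong (λ z → ∑ℚ n (f 0) + z) (∑-swap m n (f ∘ suc))
  ∙ sym (∑-+ n (f 0) (λ j → ∑ℚ m λ i → f (suc i) j))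

∑-split : ∀ m n (f : ℕ → ℚ) → ∑ℚ (m ℕ.+ n) f ≡ ∑ℚ m f + ∑ℚ n (λ k → f (m ℕ.+ k))
∑-split zero    n f = sym (+-identityˡ _)
∑-split (suc m) n f = cong (f 0 +_) (∑-split m n (f ∘ suc)) ∙ sym (+-assoc (f 0) _ _)

∑-mono-< : ∀ n {f g : ℕ → ℚ} → (∀ k → k ℕ.< n → f k ≤ g k) → ∑ℚ n f ≤ ∑ℚ n g
∑-mono-< zero    f≤g = ≤-refl
∑-mono-< (suc n) f≤g =
  +-mono-≤ (f≤g 0 ℕ.z<s) (∑-mono-< n λ k k<n → f≤g (suc k) (ℕ.s<s k<n))

∑-mono : ∀ n {f g : ℕ → ℚ} → (∀ k → f k ≤ g k) → ∑ℚ n f ≤ ∑ℚ n g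
∑-mono n f≤g = ∑-mono-< n λ k _ → f≤g k

0≤∑ : ∀ n {f : ℕ → ℚ} → (∀ k → 0ℚ ≤ f k) → 0ℚ ≤ ∑ℚ n f
0≤∑ n {f} 0≤f = subst (_≤ ∑ℚ n f) (∑-zero n) (∑-mono n 0≤f)

∣∑∣≤ : ∀ n (f : ℕ → ℚ) → ∣ ∑ℚ n f ∣ ≤ ∑ℚ n λ k → ∣ f k ∣
∣∑∣≤ zero    f = ≤-refl
∣∑∣≤ (suc n) f = ≤-trans (∣p+q∣≤∣p∣+∣q∣ (f 0) _) (+-monoʳ-≤ ∣ f 0 ∣ (∣∑∣≤ n (f ∘ suc)))

∑-telescope : ∀ n (f : ℕ → ℚ) → ∑ℚ n (λ k → f k - f (suc k)) ≡ f 0 - f n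
∑-telescope zero    f = sym (+-inverseʳ (f 0))
∑-telescope (suc n) f = cong (f 0 - f 1 +_) (∑-telescope n (f ∘ suc))
  ∙ solve 3 (λ a b c → a :- b :+ (b :- c) := a :- c) refl (f 0) (f 1) (f (suc n))
  where open +-*-Solver

∑-reverse : ∀ n (f : ℕ → ℚ) → ∑ℚ n (λ k → f (n ℕ.∸ suc k)) ≡ ∑ℚ n f
∑-reverse zero    f = refl
∑-reverse (suc n) f = cong (f n +_) (∑-reverse n f) ∙ +-comm (f n) _ ∙ sym (∑-last n f)

∑-const : ∀ n a → ∑ℚ n (λ _ → a) ≡ ι n * a
∑-const zero    a = sym (*-zeroˡ a) ∙ cong (_* a) (sym ι0)
∑-const (suc n) a = cong (a +_) (∑-const n a)
  ∙ solve 2 (λ x a → a :+ x :* a := (con 1ℚ :+ x) :* a) refl (ι n) a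
  ∙ cong (_* a) (sym (ι-suc n))
  where open +-*-Solver

-- Null sequences

Null : (ℕ → ℚ) → Set
Null x = ∀ ε → 0ℚ < ε → ∃ λ N → ∀ n → N ℕ.≤ n → ∣ x n ∣ ≤ ε

-- The bound is a positive integer K + 1, so `inv K` rescales a tolerance ε without any division.
Bounded : (ℕ → ℚ) → Set
Bounded x = ∃ λ K → ∃ λ N → ∀ n → N ℕ.≤ n → ∣ x n ∣ ≤ ι (suc K)

null-squeeze : ∀ {x y : ℕ → ℚ} N₀ → (∀ n → N₀ ℕ.≤ n → ∣ x n ∣ ≤ y n) → Null y → Null x
null-squeeze {x} {y} N₀ x≤y ny ε 0<ε with ny ε 0<ε
... | N , hN = N₀ ℕ.⊔ N , λ n n≥ → ≤-trans (x≤y n (ℕₚ.m⊔n≤o⇒m≤o N₀ N n≥))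
  (≤-trans (p≤∣p∣ (y n)) (hN n (ℕₚ.m⊔n≤o⇒n≤o N₀ N n≥)))

null-cong : ∀ {x y : ℕ → ℚ} → (∀ n → x n ≡ y n) → Null x → Null y
null-cong {x} {y} x≡y nx ε 0<ε with nx ε 0<ε
... | N , hN = N , λ n n≥ → subst (λ p → ∣ p ∣ ≤ ε) (x≡y n) (hN n n≥)

null-0 : Null (λ _ → 0ℚ)
null-0 ε 0<ε = 0 , λ _ _ → <⇒≤ 0<ε

null-+ : ∀ {x y : ℕ → ℚ} → Null x → Null y → Null (λ n → x n + y n)
null-+ {x} {y} nx ny ε 0<ε with nx (½ * ε) (0<½* 0<ε) | ny (½ * ε) (0<½* 0<ε)
... | M , hM | N , hN = M ℕ.⊔ N , λ n n≥ →
  ≤-trans (∣p+q∣≤∣p∣+∣q∣ (x n) (y n))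
    (≤-trans (+-mono-≤ (hM n (ℕₚ.m⊔n≤o⇒m≤o M N n≥)) (hN n (ℕₚ.m⊔n≤o⇒n≤o M N n≥)))
      (≤-reflexive (½+½ ε)))

null-neg : ∀ {x : ℕ → ℚ} → Null x → Null (λ n → - x n)
null-neg {x} nx ε 0<ε with nx ε 0<ε
... | N , hN = N , λ n n≥ → ≤-trans (≤-reflexive (∣-p∣≡∣p∣ (x n))) (hN n n≥)

null-∑ : ∀ n {x : ℕ → ℕ → ℚ} → (∀ k → k ℕ.< n → Null (x k)) →
         Null (λ t → ∑ℚ n λ k → x k t)
null-∑ zero        nx = null-0
null-∑ (suc n) {x} nx = null-+ {x 0} {λ t → ∑ℚ n λ k → x (suc k) t}
  (nx 0 ℕ.z<s) (null-∑ n λ k k<n → nx (suc k) (ℕ.s<s k<n))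

null-*-bounded : ∀ {x y : ℕ → ℚ} → Null x → Bounded y → Null (λ n → x n * y n)
null-*-bounded {x} {y} nx (K , M , hM) ε 0<ε with nx (inv K * ε) (0<* (0<inv K) 0<ε)
... | N , hN = M ℕ.⊔ N , λ n n≥ → begin
  ∣ x n * y n ∣              ≡⟨ ∣p*q∣≡∣p∣*∣q∣ (x n) (y n) ⟩
  ∣ x n ∣ * ∣ y n ∣          ≤⟨ *-mono {∣ x n ∣} {inv K * ε} {∣ y n ∣} {ι (suc K)}
                                  (0≤∣p∣ (x n)) (0≤ι (suc K))
                                  (hN n (ℕₚ.m⊔n≤o⇒n≤o M N n≥)) (hM n (ℕₚ.m⊔n≤o⇒m≤o M N n≥)) ⟩
  inv K * ε * ι (suc K)      ≡⟨ solve 3 (λ a e b → a :* e :* b := (a :* b) :* e) refl (inv K) ε (ι (suc K)) ⟩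
  inv K * ι (suc K) * ε      ≡⟨ cong (_* ε) (inv-* K) ⟩
  1ℚ * ε                     ≡⟨ *-identityˡ ε ⟩
  ε                          ∎
  where
  open ≤-Reasoning
  open +-*-Solver

bounded-const : ∀ p → Bounded (λ _ → p)
bounded-const p with ι-large ∣ p ∣
... | K , p≤K = K , 0 , λ _ _ → p≤K

null-*ˡ : ∀ a {x : ℕ → ℚ} → Null x → Null (λ n → a * x n)
null-*ˡ a {x} nx = null-cong {λ n → x n * a} (λ n → *-comm (x n) a)
  (null-*-bounded {x} {λ _ → a} nx (bounded-const a))

null-inv : Null inv
null-inv ε 0<ε with inv-small 0<ε
... | N , invN≤ε = N , λ n N≤n →
  ≤-trans (≤-reflexive (0≤p⇒∣p∣≡p (0≤inv n))) (≤-trans (inv-anti N≤n) invN≤ε)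

null-sqrt : ∀ {x : ℕ → ℚ} → Null (λ n → x n * x n) → Null x
null-sqrt {x} nxx ε 0<ε with nxx (ε * ε) (0<* 0<ε 0<ε)
... | N , hN = N , λ n n≥ → ∣∣≤-by-squares (<⇒≤ 0<ε) (≤-trans (p≤∣p∣ (x n * x n)) (hN n n≥))

bounded-cauchy : ∀ {x : ℕ → ℚ} → IsCauchy x → Bounded x
bounded-cauchy {x} cx with cx 1ℚ (positive⁻¹ 1ℚ)
... | N , hN with ι-large (1ℚ + ∣ x N ∣)
... | K , ≤K = K , N , λ n N≤n → begin
  ∣ x n ∣                     ≡⟨ cong ∣_∣ (solve 2 (λ a b → a := (a :- b) :+ b) refl (x n) (x N)) ⟩
  ∣ (x n - x N) + x N ∣       ≤⟨ ∣p+q∣≤∣p∣+∣q∣ (x n - x N) (x N) ⟩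
  ∣ x n - x N ∣ + ∣ x N ∣     ≤⟨ +-monoˡ-≤ ∣ x N ∣ (hN n N N≤n ℕₚ.≤-refl) ⟩
  1ℚ + ∣ x N ∣                ≤⟨ ≤K ⟩
  ι (suc K)                   ∎
  where
  open ≤-Reasoning
  open +-*-Solver

-- ζ(2) from the Leibniz series

σ : ℕ → ℚ
σ k = (- 1ℚ) ^ℚ k

σ-suc : ∀ k → σ (suc k) ≡ - σ k
σ-suc k = sym (neg-distribˡ-* 1ℚ (σ k)) ∙ cong -_ (*-identityˡ (σ k))

σ-+ : ∀ m n → σ (m ℕ.+ n) ≡ σ m * σ n
σ-+ zero    n = sym (*-identityˡ (σ n))
σ-+ (suc m) n = cong (- 1ℚ *_) (σ-+ m n) ∙ sym (*-assoc (- 1ℚ) (σ m) (σ n))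

σ² : ∀ n → σ n * σ n ≡ 1ℚ
σ² zero    = refl
σ² (suc n) = cong₂ _*_ (σ-suc n) (σ-suc n)
  ∙ solve 1 (λ s → (:- s) :* (:- s) := s :* s) refl (σ n) ∙ σ² n
  where open +-*-Solver

Antitone : (ℕ → ℚ) → Set
Antitone a = ∀ k → a (suc k) ≤ a k

alternating-suc : ∀ a n → alternating a (suc n) ≡ a 0 - alternating (a ∘ suc) n
alternating-suc a n = cong₂ _+_ (*-identityˡ (a 0))
  (∑-cong n (λ k → cong (_* a (suc k)) (σ-suc k) ∙ sym (neg-distribˡ-* (σ k) (a (suc k))))
   ∙ ∑-neg n λ k → σ k * a (suc k))

alternating-bounds : ∀ {a} → (∀ k → 0ℚ ≤ a k) → Antitone a → ∀ n →
  0ℚ ≤ alternating a n × alternating a n ≤ a 0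
alternating-bounds         0≤a a↓ zero    = ≤-refl , 0≤a 0
alternating-bounds {a} 0≤a a↓ (suc n) with alternating-bounds (0≤a ∘ suc) (a↓ ∘ suc) n
... | 0≤s , s≤a₁ = subst (0ℚ ≤_) (sym (alternating-suc a n)) (0≤q-p (≤-trans s≤a₁ (a↓ 0)))
  , ≤-trans (≤-reflexive (alternating-suc a n))
      (≤-trans (+-monoʳ-≤ (a 0) (neg-antimono-≤ 0≤s)) (≤-reflexive (+-identityʳ (a 0))))

alternating-tail : ∀ {a} → (∀ k → 0ℚ ≤ a k) → Antitone a → ∀ n j →
  ∣ alternating a (n ℕ.+ j) - alternating a n ∣ ≤ a n
alternating-tail {a} 0≤a a↓ zero j with alternating-bounds 0≤a a↓ j
... | 0≤s , s≤a₀ = ≤-trans (≤-reflexive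
  (cong ∣_∣ (+-identityʳ (alternating a j)) ∙ 0≤p⇒∣p∣≡p 0≤s)) s≤a₀
alternating-tail {a} 0≤a a↓ (suc n) j = ≤-trans (≤-reflexive eq)
  (alternating-tail (0≤a ∘ suc) (a↓ ∘ suc) n j)
  where
  open +-*-Solver
  t u : ℚ
  t = alternating (a ∘ suc) (n ℕ.+ j)
  u = alternating (a ∘ suc) n
  eq : ∣ alternating a (suc n ℕ.+ j) - alternating a (suc n) ∣ ≡ ∣ t - u ∣
  eq = cong ∣_∣ (cong₂ _-_ (alternating-suc a (n ℕ.+ j)) (alternating-suc a n)
      ∙ solve 3 (λ p q r → (p :- q) :- (p :- r) := :- (q :- r)) refl (a 0) t u)
    ∙ ∣-p∣≡∣p∣ (t - u)

odd⁻¹ : ℕ → ℚ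
odd⁻¹ k = inv (2 ℕ.* k)

odd : ℕ → ℚ
odd k = 1ℚ + (ι k + ι k)

odd⁻¹-* : ∀ k → odd⁻¹ k * odd k ≡ 1ℚ
odd⁻¹-* k = cong (odd⁻¹ k *_) (sym (ι-suc (2 ℕ.* k) ∙ cong (1ℚ +_)
    (ι-+ k (k ℕ.+ 0) ∙ cong (λ j → ι k + ι j) (ℕₚ.+-identityʳ k))))
  ∙ inv-* (2 ℕ.* k)

odd⁻¹≤inv : ∀ k → odd⁻¹ k ≤ inv k
odd⁻¹≤inv k = inv-anti (ℕₚ.m≤m+n k (k ℕ.+ 0))

Leibniz : ℕ → ℚ
Leibniz = alternating odd⁻¹

ℓ : ℕ → ℚ
ℓ = alternating inv

ℓ-suc : ∀ n → ℓ (suc n) ≡ ℓ n + σ n * inv n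
ℓ-suc n = ∑-last n λ k → σ k * inv k

oddSquares : ℕ → ℚ
oddSquares n = ∑ℚ n λ k → odd⁻¹ k * odd⁻¹ k

-- The j-th factor is the block of the alternating harmonic series with indices from N - 1 - j to N
-- + j - 1. Such blocks arise when the products 1/((2j+1)(2k+1)) are split into partial fractions
-- and collected by 1/(2j+1).
defect : ℕ → ℚ
defect N = ∑ℚ N λ j → (ℓ (N ℕ.+ j) - ℓ (N ℕ.∸ suc j)) * odd⁻¹ j

module _ (i j : ℕ) where
  private
    N : ℕ
    N = suc (i ℕ.+ j)
    ιN : ι N ≡ 1ℚ + (ι i + ι j)
    ιN = ι-suc (i ℕ.+ j) ∙ cong (1ℚ +_) (ι-+ i j)

  -- N + j = i + (2 j + 1), an odd distance. In this module i stands for N - 1 - j, and taking i and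
  -- j as the parameters keeps truncated subtraction out of the algebra.
  σ-reflect : σ (N ℕ.+ j) ≡ - σ i
  σ-reflect = σ-suc (i ℕ.+ j ℕ.+ j) ∙ cong -_
    (σ-+ (i ℕ.+ j) j ∙ cong (_* σ j) (σ-+ i j) ∙ *-assoc (σ i) (σ j) (σ j)
     ∙ cong (σ i *_) (σ² j) ∙ *-identityʳ (σ i))

  -- The odd denominators differ by (2 N + 1) - (2 j + 1) = 2 (i + 1).
  inv-*-odd⁻¹-diff : inv i * (odd⁻¹ j - odd⁻¹ N) ≡ (1ℚ + 1ℚ) * (odd⁻¹ j * odd⁻¹ N)
  inv-*-odd⁻¹-diff = cong (inv i *_)
      (recip-diff {odd⁻¹ j} {odd j} {odd⁻¹ N} {odd N} (odd⁻¹-* j) (odd⁻¹-* N))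
    ∙ cong (λ z → inv i * ((1ℚ + (z + z) - odd j) * (odd⁻¹ j * odd⁻¹ N))) ιN
    ∙ solve 4 (λ x a i j → x :* ((con 1ℚ :+ ((con 1ℚ :+ (i :+ j)) :+ (con 1ℚ :+ (i :+ j)))
          :- (con 1ℚ :+ (j :+ j))) :* a)
        := (x :* (con 1ℚ :+ i)) :* ((con 1ℚ :+ con 1ℚ) :* a)) refl
        (inv i) (odd⁻¹ j * odd⁻¹ N) (ι i) (ι j)
    ∙ cong (_* ((1ℚ + 1ℚ) * (odd⁻¹ j * odd⁻¹ N)))
        (cong (inv i *_) (sym (ι-suc i)) ∙ inv-* i)
    ∙ *-identityˡ ((1ℚ + 1ℚ) * (odd⁻¹ j * odd⁻¹ N))
    where open +-*-Solver

  -- The odd denominators add up to 2 (N + j + 1).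
  inv-*-odd⁻¹-sum : inv (N ℕ.+ j) * (odd⁻¹ j + odd⁻¹ N) ≡ (1ℚ + 1ℚ) * (odd⁻¹ j * odd⁻¹ N)
  inv-*-odd⁻¹-sum = cong (inv (N ℕ.+ j) *_)
      (recip-sum {odd⁻¹ j} {odd j} {odd⁻¹ N} {odd N} (odd⁻¹-* j) (odd⁻¹-* N))
    ∙ solve 4 (λ x a n j → x :* ((con 1ℚ :+ (n :+ n) :+ (con 1ℚ :+ (j :+ j))) :* a)
        := (x :* (con 1ℚ :+ (n :+ j))) :* ((con 1ℚ :+ con 1ℚ) :* a)) refl
        (inv (N ℕ.+ j)) (odd⁻¹ j * odd⁻¹ N) (ι N) (ι j)
    ∙ cong (_* ((1ℚ + 1ℚ) * (odd⁻¹ j * odd⁻¹ N)))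
        (cong (inv (N ℕ.+ j) *_) (sym (ι-suc (N ℕ.+ j) ∙ cong (1ℚ +_) (ι-+ N j))) ∙ inv-* (N ℕ.+ j))
    ∙ *-identityˡ ((1ℚ + 1ℚ) * (odd⁻¹ j * odd⁻¹ N))
    where open +-*-Solver

  -- Partial fractions from 2 (i + 1) + (2 j + 1) = 2 N + 1. In the bound on the defect this
  -- extracts the factor 1/(2 N + 1) and leaves two harmonic sums.
  inv-*-odd⁻¹ : inv i * odd⁻¹ j ≡ odd⁻¹ N * ((1ℚ + 1ℚ) * odd⁻¹ j + inv i)
  inv-*-odd⁻¹ = sym (
    cong₂ (λ y x → odd⁻¹ N * ((1ℚ + 1ℚ) * y + x))
      (sym (*-identityʳ (odd⁻¹ j)) ∙ cong (odd⁻¹ j *_) (sym (cong (inv i *_) (sym (ι-suc i)) ∙ inv-* i)))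
      (sym (*-identityʳ (inv i)) ∙ cong (inv i *_) (sym (odd⁻¹-* j)))
    ∙ solve 5 (λ n x a i j → n :* ((con 1ℚ :+ con 1ℚ) :* (a :* (x :* (con 1ℚ :+ i)))
           :+ x :* (a :* (con 1ℚ :+ (j :+ j))))
        := (n :* (con 1ℚ :+ ((con 1ℚ :+ (i :+ j)) :+ (con 1ℚ :+ (i :+ j))))) :* (x :* a))
        refl (odd⁻¹ N) (inv i) (odd⁻¹ j) (ι i) (ι j)
    ∙ cong (_* (inv i * odd⁻¹ j))
        (cong (λ z → odd⁻¹ N * (1ℚ + (z + z))) (sym ιN) ∙ odd⁻¹-* N)
    ∙ *-identityˡ (inv i * odd⁻¹ j))
    where open +-*-Solver

  private
    W : ℚ
    W = σ i * inv i + σ (N ℕ.+ j) * inv (N ℕ.+ j)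

  -- From N to N + 1 the block gains one term at each end, with a common sign s by `σ-reflect`.
  -- Their weight a is written as (a - o) + o for one and as (a + o) - o for the other: the brackets
  -- give the cross term of the squared Leibniz sum, and the rest is collected in `W`.
  defect-term : (ℓ (suc N ℕ.+ j) - ℓ (suc i)) * odd⁻¹ j ≡
    (ℓ (N ℕ.+ j) - ℓ i) * odd⁻¹ j
      + ((1ℚ + 1ℚ + 1ℚ + 1ℚ) * (σ N * odd⁻¹ N) * (σ j * odd⁻¹ j) - odd⁻¹ N * W)
  defect-term = cong₂ (λ u v → (u - v) * a) (ℓ-suc (N ℕ.+ j)) (ℓ-suc i)
    ∙ cong (λ t → (ℓ (N ℕ.+ j) + s * y - (ℓ i + t * x)) * a) σi
    ∙ solve 7 (λ p q s x y a o →
        (p :+ s :* y :- (q :+ (:- s) :* x)) :* a :=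
        (p :- q) :* a :+ (s :* (x :* (a :- o) :+ y :* (a :+ o)) :- o :* ((:- s) :* x :+ s :* y)))
        refl (ℓ (N ℕ.+ j)) (ℓ i) s x y a o
    ∙ cong (λ z → (ℓ (N ℕ.+ j) - ℓ i) * a + z)
        (cong₂ (λ u v → s * (u + v) - o * ((- s) * x + s * y)) inv-*-odd⁻¹-diff inv-*-odd⁻¹-sum
        ∙ cong (λ u → s * ((1ℚ + 1ℚ) * (a * o) + (1ℚ + 1ℚ) * (a * o)) - o * (u * x + s * y))
            (sym σi)
        ∙ cong (λ u → u * ((1ℚ + 1ℚ) * (a * o) + (1ℚ + 1ℚ) * (a * o)) - o * W) (σ-+ N j)
        ∙ solve 5 (λ n j a o w → n :* j :* ((con 1ℚ :+ con 1ℚ) :* (a :* o)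
              :+ (con 1ℚ :+ con 1ℚ) :* (a :* o)) :- w
            := (con 1ℚ :+ con 1ℚ :+ con 1ℚ :+ con 1ℚ) :* (n :* o) :* (j :* a) :- w)
            refl (σ N) (σ j) a o (o * W))
    where
    open +-*-Solver
    s x y a o : ℚ
    s = σ (N ℕ.+ j)
    x = inv i
    y = inv (N ℕ.+ j)
    a = odd⁻¹ j
    o = odd⁻¹ N
    σi : σ i ≡ - s
    σi = solve 1 (λ t → t := :- (:- t)) refl (σ i) ∙ cong -_ (sym σ-reflect)

∸-reflect : ∀ {N j} → j ℕ.< N → suc (N ℕ.∸ suc j ℕ.+ j) ≡ N
∸-reflect {N} {j} j<N = trans (sym (ℕₚ.+-suc (N ℕ.∸ suc j) j)) (ℕₚ.m∸n+n≡m j<N)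

∸-suc : ∀ {N j} → j ℕ.< N → N ℕ.∸ j ≡ suc (N ℕ.∸ suc j)
∸-suc {N} {j} j<N = ℕₚ.+-∸-assoc 1 j<N

2*n≡n+n : ∀ n → 2 ℕ.* n ≡ n ℕ.+ n
2*n≡n+n n = cong (n ℕ.+_) (ℕₚ.+-identityʳ n)

-- Summed over j, the two halves of `W` fill up ℓ(2N), the first half in reverse order. The
-- resulting -ℓ(2N)/(2N+1) cancels against the new term j = N, and what remains is the growth of
-- twice the squared Leibniz sum less one new odd square.
defect-suc : ∀ N → defect (suc N) ≡ defect N
  + ((1ℚ + 1ℚ + 1ℚ + 1ℚ) * (σ N * odd⁻¹ N) * Leibniz N + odd⁻¹ N * odd⁻¹ N)
defect-suc N = ∑-last N (λ j → (ℓ (suc N ℕ.+ j) - ℓ (N ℕ.∸ j)) * odd⁻¹ j)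
  ∙ cong₂ _+_
      (∑-cong-< N step ∙ ∑-+ N old new ∙ cong (defect N +_) sum-new)
      last
  ∙ solve 4 (λ d a l o → d :+ (a :- o :* l) :+ (l :+ o) :* o := d :+ (a :+ o :* o))
      refl (defect N) (4σo * Leibniz N) (ℓ (N ℕ.+ N)) o
  where
  open +-*-Solver
  o 4σo : ℚ
  o = odd⁻¹ N
  4σo = (1ℚ + 1ℚ + 1ℚ + 1ℚ) * (σ N * o)
  old W new : ℕ → ℚ
  old j = (ℓ (N ℕ.+ j) - ℓ (N ℕ.∸ suc j)) * odd⁻¹ j
  W j = σ (N ℕ.∸ suc j) * inv (N ℕ.∸ suc j) + σ (N ℕ.+ j) * inv (N ℕ.+ j)
  new j = 4σo * (σ j * odd⁻¹ j) - o * W j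
  step : ∀ j → j ℕ.< N → (ℓ (suc N ℕ.+ j) - ℓ (N ℕ.∸ j)) * odd⁻¹ j ≡ old j + new j
  step j j<N = cong (λ k → (ℓ (suc N ℕ.+ j) - ℓ k) * odd⁻¹ j) (∸-suc j<N)
    ∙ subst (λ M → (ℓ (suc M ℕ.+ j) - ℓ (suc i)) * odd⁻¹ j ≡
        (ℓ (M ℕ.+ j) - ℓ i) * odd⁻¹ j
        + ((1ℚ + 1ℚ + 1ℚ + 1ℚ) * (σ M * odd⁻¹ M) * (σ j * odd⁻¹ j)
           - odd⁻¹ M * (σ i * inv i + σ (M ℕ.+ j) * inv (M ℕ.+ j))))
        (∸-reflect j<N) (defect-term i j)
    where
    i : ℕ
    i = N ℕ.∸ suc j
  sum-W : ∑ℚ N W ≡ ℓ (N ℕ.+ N)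
  sum-W = ∑-+ N (λ j → σ (N ℕ.∸ suc j) * inv (N ℕ.∸ suc j)) (λ j → σ (N ℕ.+ j) * inv (N ℕ.+ j))
    ∙ cong (_+ ∑ℚ N λ j → σ (N ℕ.+ j) * inv (N ℕ.+ j)) (∑-reverse N λ k → σ k * inv k)
    ∙ sym (∑-split N N λ k → σ k * inv k)
  sum-new : ∑ℚ N new ≡ 4σo * Leibniz N - o * ℓ (N ℕ.+ N)
  sum-new = ∑-- N (λ j → 4σo * (σ j * odd⁻¹ j)) (λ j → o * W j)
    ∙ cong₂ _-_ (∑-*ˡ N 4σo λ j → σ j * odd⁻¹ j) (∑-*ˡ N o W ∙ cong (o *_) sum-W)
  -- For j = N the block starts at index 0, and its last term `inv (N + N)` is `odd⁻¹ N` with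
  -- positive sign.
  last : (ℓ (suc N ℕ.+ N) - ℓ (N ℕ.∸ N)) * odd⁻¹ N ≡ (ℓ (N ℕ.+ N) + o) * o
  last = cong₂ (λ u k → (u - ℓ k) * o) (ℓ-suc (N ℕ.+ N)) (ℕₚ.n∸n≡0 N)
    ∙ cong (_* o) (+-identityʳ (ℓ (N ℕ.+ N) + σ (N ℕ.+ N) * inv (N ℕ.+ N))
       ∙ cong₂ (λ s x → ℓ (N ℕ.+ N) + s * x) (σ-+ N N ∙ σ² N) (cong inv (sym (2*n≡n+n N)))
       ∙ cong (ℓ (N ℕ.+ N) +_) (*-identityˡ o))

-- Each off-diagonal product of the squared Leibniz sum is expanded once by the difference and once
-- by the sum of the two odd denominators.
Leibniz-square : ∀ N → (1ℚ + 1ℚ) * (Leibniz N * Leibniz N) ≡ oddSquares N + defect N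
Leibniz-square zero    = refl
Leibniz-square (suc N) =
  cong (λ z → (1ℚ + 1ℚ) * (z * z)) (∑-last N λ k → σ k * odd⁻¹ k)
  ∙ solve 3 (λ l s o → (con 1ℚ :+ con 1ℚ) :* ((l :+ s :* o) :* (l :+ s :* o)) :=
      (con 1ℚ :+ con 1ℚ) :* (l :* l)
      :+ ((con 1ℚ :+ con 1ℚ :+ con 1ℚ :+ con 1ℚ) :* (s :* o) :* l
          :+ (con 1ℚ :+ con 1ℚ) :* (s :* s) :* (o :* o))) refl (Leibniz N) (σ N) o
  ∙ cong₂ (λ u v → u + ((1ℚ + 1ℚ + 1ℚ + 1ℚ) * (σ N * o) * Leibniz N + (1ℚ + 1ℚ) * v * (o * o)))
      (Leibniz-square N) (σ² N)
  ∙ solve 4 (λ b d x o → b :+ d :+ (x :+ (con 1ℚ :+ con 1ℚ) :* con 1ℚ :* (o :* o)) :=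
      b :+ o :* o :+ (d :+ (x :+ o :* o))) refl
      (oddSquares N) (defect N) ((1ℚ + 1ℚ + 1ℚ + 1ℚ) * (σ N * o) * Leibniz N) o
  ∙ cong₂ _+_ (sym (∑-last N λ k → odd⁻¹ k * odd⁻¹ k)) (sym (defect-suc N))
  where
  open +-*-Solver
  o : ℚ
  o = odd⁻¹ N

-- Decay of the defect

harmonic : ℕ → ℚ
harmonic n = ∑ℚ n inv

-- An alternating block is at most its first term `inv i`. By `inv-*-odd⁻¹` the sum over j then
-- becomes 1/(2N+1) times two harmonic sums with weights 2 and 1, whence the constant 3.
∣defect∣≤ : ∀ N → ∣ defect N ∣ ≤ (1ℚ + 1ℚ + 1ℚ) * (harmonic N * inv N)
∣defect∣≤ N = begin
  ∣ defect N ∣                              ≤⟨ ∣∑∣≤ N (λ j → (ℓ (N ℕ.+ j) - ℓ (N ℕ.∸ suc j)) * odd⁻¹ j) ⟩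
  (∑ℚ N λ j → ∣ (ℓ (N ℕ.+ j) - ℓ (N ℕ.∸ suc j)) * odd⁻¹ j ∣)
                                            ≤⟨ ∑-mono-< N bound ⟩
  (∑ℚ N λ j → o * ((1ℚ + 1ℚ) * inv j + inv (N ℕ.∸ suc j)))
    ≡⟨ ∑-*ˡ N o (λ j → (1ℚ + 1ℚ) * inv j + inv (N ℕ.∸ suc j))
       ∙ cong (o *_) (∑-+ N (λ j → (1ℚ + 1ℚ) * inv j) (λ j → inv (N ℕ.∸ suc j))
         ∙ cong₂ _+_ (∑-*ˡ N (1ℚ + 1ℚ) inv) (∑-reverse N inv))
       ∙ solve 2 (λ o h → o :* ((con 1ℚ :+ con 1ℚ) :* h :+ h)
           := (con 1ℚ :+ con 1ℚ :+ con 1ℚ) :* h :* o) refl o (harmonic N) ⟩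
  (1ℚ + 1ℚ + 1ℚ) * harmonic N * o           ≤⟨ *-monoˡ (0≤* {1ℚ + 1ℚ + 1ℚ} {harmonic N}
                                                 (<⇒≤ (positive⁻¹ (1ℚ + 1ℚ + 1ℚ))) (0≤∑ N 0≤inv))
                                                 (odd⁻¹≤inv N) ⟩
  (1ℚ + 1ℚ + 1ℚ) * harmonic N * inv N       ≡⟨ *-assoc (1ℚ + 1ℚ + 1ℚ) (harmonic N) (inv N) ⟩
  (1ℚ + 1ℚ + 1ℚ) * (harmonic N * inv N)     ∎
  where
  open ≤-Reasoning
  open +-*-Solver
  o : ℚ
  o = odd⁻¹ N
  bound : ∀ j → j ℕ.< N → ∣ (ℓ (N ℕ.+ j) - ℓ (N ℕ.∸ suc j)) * odd⁻¹ j ∣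
    ≤ o * ((1ℚ + 1ℚ) * inv j + inv (N ℕ.∸ suc j))
  bound j j<N = begin
    ∣ (ℓ (N ℕ.+ j) - ℓ i) * odd⁻¹ j ∣    ≡⟨ ∣p*q∣≡∣p∣*∣q∣ (ℓ (N ℕ.+ j) - ℓ i) (odd⁻¹ j)
                                             ∙ cong (∣ ℓ (N ℕ.+ j) - ℓ i ∣ *_) (0≤p⇒∣p∣≡p 0≤a) ⟩
    ∣ ℓ (N ℕ.+ j) - ℓ i ∣ * odd⁻¹ j      ≡⟨ cong (λ k → ∣ ℓ k - ℓ i ∣ * odd⁻¹ j) i+≡ ⟨
    ∣ ℓ (i ℕ.+ (suc j ℕ.+ j)) - ℓ i ∣ * odd⁻¹ j
                                         ≤⟨ *-monoʳ 0≤a (alternating-tail 0≤inv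
                                              (λ k → inv-anti (ℕₚ.n≤1+n k)) i (suc j ℕ.+ j)) ⟩
    inv i * odd⁻¹ j                      ≡⟨ inv-*-odd⁻¹ i j ⟩
    odd⁻¹ (suc (i ℕ.+ j)) * ((1ℚ + 1ℚ) * odd⁻¹ j + inv i)
                                         ≡⟨ cong (λ M → odd⁻¹ M * ((1ℚ + 1ℚ) * odd⁻¹ j + inv i)) (∸-reflect j<N) ⟩
    o * ((1ℚ + 1ℚ) * odd⁻¹ j + inv i)    ≤⟨ *-monoˡ (0≤inv (2 ℕ.* N)) (+-monoˡ-≤ (inv i)
                                              (*-monoˡ {r = 1ℚ + 1ℚ} (<⇒≤ (positive⁻¹ (1ℚ + 1ℚ))) (odd⁻¹≤inv j))) ⟩
    o * ((1ℚ + 1ℚ) * inv j + inv i)      ∎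
    where
    i : ℕ
    i = N ℕ.∸ suc j
    0≤a : 0ℚ ≤ odd⁻¹ j
    0≤a = 0≤inv (2 ℕ.* j)
    i+≡ : i ℕ.+ (suc j ℕ.+ j) ≡ N ℕ.+ j
    i+≡ = trans (sym (ℕₚ.+-assoc i (suc j) j))
      (cong (ℕ._+ j) (trans (ℕₚ.+-suc i j) (∸-reflect j<N)))

∑-upper : ∀ n {f : ℕ → ℚ} {b} → (∀ k → f k ≤ b) → ∑ℚ n f ≤ ι n * b
∑-upper n {f} {b} f≤b = ≤-trans (∑-mono n f≤b) (≤-reflexive (∑-const n b))

-- The first K terms are at most 1 and the others at most 1/(K+1). With K chosen from ε before N,
-- this shows that the harmonic sum is o(N).
harmonic-upper : ∀ K N → K ℕ.≤ N → harmonic N ≤ ι K + ι N * inv K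
harmonic-upper K N K≤N = subst (λ M → harmonic M ≤ ι K + ι M * inv K) (ℕₚ.m+[n∸m]≡n K≤N) (begin
  harmonic (K ℕ.+ d)                         ≡⟨ ∑-split K d inv ⟩
  harmonic K + ∑ℚ d (λ k → inv (K ℕ.+ k))    ≤⟨ +-mono-≤ (∑-upper K inv≤1)
                                                  (∑-upper d λ k → inv-anti (ℕₚ.m≤m+n K k)) ⟩
  ι K * 1ℚ + ι d * inv K                     ≤⟨ +-mono-≤ (≤-reflexive (*-identityʳ (ι K)))
                                                  (*-monoʳ (0≤inv K) (ι-mono (ℕₚ.m≤n+m d K))) ⟩
  ι K + ι (K ℕ.+ d) * inv K                  ∎)
  where
  open ≤-Reasoning
  d : ℕ
  d = N ℕ.∸ K

ι-*-inv≤1 : ∀ n → ι n * inv n ≤ 1ℚ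
ι-*-inv≤1 n = ≤-trans (*-monoʳ (0≤inv n) (ι-mono (ℕₚ.n≤1+n n)))
  (≤-reflexive (*-comm (ι (suc n)) (inv n) ∙ inv-* n))

null-harmonic : Null (λ n → harmonic n * inv n)
null-harmonic ε 0<ε = N ℕ.⊔ K , λ n n≥ → begin
  ∣ harmonic n * inv n ∣              ≡⟨ 0≤p⇒∣p∣≡p (0≤* {harmonic n} {inv n} (0≤∑ n 0≤inv) (0≤inv n)) ⟩
  harmonic n * inv n                  ≤⟨ *-monoʳ (0≤inv n) (harmonic-upper K n (ℕₚ.m⊔n≤o⇒n≤o N K n≥)) ⟩
  (ι K + ι n * inv K) * inv n         ≡⟨ solve 4 (λ k n x y → (k :+ n :* x) :* y := k :* y :+ (n :* y) :* x)
                                           refl (ι K) (ι n) (inv K) (inv n) ⟩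
  ι K * inv n + ι n * inv n * inv K   ≤⟨ +-mono-≤
       (≤-trans (p≤∣p∣ (ι K * inv n)) (proj₂ small n (ℕₚ.m⊔n≤o⇒m≤o N K n≥)))
       (≤-trans (*-monoʳ (0≤inv K) (ι-*-inv≤1 n))
         (≤-trans (≤-reflexive (*-identityˡ (inv K))) (proj₂ (inv-small (0<½* 0<ε))))) ⟩
  ½ * ε + ½ * ε                       ≡⟨ ½+½ ε ⟩
  ε                                   ∎
  where
  open ≤-Reasoning
  open +-*-Solver
  K : ℕ
  K = proj₁ (inv-small (0<½* 0<ε))
  small : ∃ λ N → ∀ n → N ℕ.≤ n → ∣ ι K * inv n ∣ ≤ ½ * ε
  small = null-*ˡ (ι K) {inv} null-inv (½ * ε) (0<½* 0<ε)
  N : ℕ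
  N = proj₁ small

null-defect : Null defect
null-defect = null-squeeze 0 (λ N _ → ∣defect∣≤ N)
  (null-*ˡ (1ℚ + 1ℚ + 1ℚ) {λ N → harmonic N * inv N} null-harmonic)

-- Even and odd squares, and the value π²/6

squares : ℕ → ℚ
squares n = ∑ℚ n λ k → inv k * inv k

∑-double : ∀ n (f : ℕ → ℚ) →
  ∑ℚ (2 ℕ.* n) f ≡ ∑ℚ n (λ k → f (2 ℕ.* k)) + ∑ℚ n (λ k → f (suc (2 ℕ.* k)))
∑-double zero    f = refl
∑-double (suc n) f = cong (λ k → ∑ℚ k f) (ℕₚ.*-suc 2 n)
  ∙ ∑-last (suc (2 ℕ.* n)) f
  ∙ cong (_+ f (suc (2 ℕ.* n))) (∑-last (2 ℕ.* n) f ∙ cong (_+ f (2 ℕ.* n)) (∑-double n f))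
  ∙ solve 4 (λ a b c d → a :+ b :+ c :+ d := a :+ c :+ (b :+ d)) refl
      (∑ℚ n λ k → f (2 ℕ.* k)) (∑ℚ n λ k → f (suc (2 ℕ.* k))) (f (2 ℕ.* n)) (f (suc (2 ℕ.* n)))
  ∙ cong₂ _+_ (sym (∑-last n λ k → f (2 ℕ.* k))) (sym (∑-last n λ k → f (suc (2 ℕ.* k))))
  where open +-*-Solver

inv-even : ∀ k → inv (suc (2 ℕ.* k)) ≡ ½ * inv k
inv-even k = inverse-unique {z = ι (suc (suc (2 ℕ.* k)))} (inv-* (suc (2 ℕ.* k)))
  (cong (½ * inv k *_) (cong ι (sym (ℕₚ.*-suc 2 k)) ∙ ι-* 2 (suc k)
     ∙ cong (_* ι (suc k)) (ι-suc 1 ∙ cong (1ℚ +_) ι1))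
   ∙ solve 2 (λ x y → con ½ :* x :* ((con 1ℚ :+ con 1ℚ) :* y) := x :* y) refl (inv k) (ι (suc k))
   ∙ inv-* k)
  where open +-*-Solver

-- The even denominators reproduce a quarter of the whole sum, so the odd ones carry the share 3/4
-- of ζ(2).
squares-double : ∀ n → squares (2 ℕ.* n) ≡ oddSquares n + ½ * ½ * squares n
squares-double n = ∑-double n (λ k → inv k * inv k)
  ∙ cong (oddSquares n +_)
      (∑-cong n (λ k → cong₂ _*_ (inv-even k) (inv-even k)
         ∙ solve 1 (λ x → con ½ :* x :* (con ½ :* x) := con ½ :* con ½ :* (x :* x)) refl (inv k))
       ∙ ∑-*ˡ n (½ * ½) λ k → inv k * inv k)
  where open +-*-Solver

0≤squares-step : ∀ m n → 0ℚ ≤ ∑ℚ m (λ k → inv (n ℕ.+ k) * inv (n ℕ.+ k))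
0≤squares-step m n = 0≤∑ m λ k → 0≤² (inv (n ℕ.+ k))

squares-gap : ∀ n m → ∣ squares (n ℕ.+ m) - squares n ∣ ≤ ι m * (inv n * inv n)
squares-gap n m = begin
  ∣ squares (n ℕ.+ m) - squares n ∣   ≡⟨ cong (λ z → ∣ z - squares n ∣) (∑-split n m λ k → inv k * inv k) ⟩
  ∣ squares n + tail - squares n ∣    ≡⟨ cong ∣_∣ (solve 2 (λ a b → a :+ b :- a := b) refl (squares n) tail) ⟩
  ∣ tail ∣                            ≡⟨ 0≤p⇒∣p∣≡p (0≤squares-step m n) ⟩
  tail                                ≤⟨ ∑-upper m (λ k → *-mono (0≤inv (n ℕ.+ k)) (0≤inv n)
                                          (inv-anti (ℕₚ.m≤m+n n k)) (inv-anti (ℕₚ.m≤m+n n k))) ⟩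
  ι m * (inv n * inv n)               ∎
  where
  open ≤-Reasoning
  open +-*-Solver
  tail : ℚ
  tail = ∑ℚ m λ k → inv (n ℕ.+ k) * inv (n ℕ.+ k)

null-squares-double : Null (λ n → squares (2 ℕ.* n) - squares n)
null-squares-double = null-squeeze 0 (λ n _ → ≤-trans
  (subst (λ k → ∣ squares k - squares n ∣ ≤ ι n * (inv n * inv n)) (sym (2*n≡n+n n)) (squares-gap n n))
  (≤-trans (≤-reflexive (sym (*-assoc (ι n) (inv n) (inv n))))
    (≤-trans (*-monoʳ (0≤inv n) (ι-*-inv≤1 n)) (≤-reflexive (*-identityˡ (inv n)))))) null-inv

null-squares-shift : ∀ r → Null (λ n → squares (n ℕ.+ r) - squares n)
null-squares-shift r = null-squeeze 0 (λ n _ → ≤-trans (squares-gap n r)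
  (*-monoˡ (0≤ι r) (≤-trans (*-monoʳ (0≤inv n) (inv≤1 n)) (≤-reflexive (*-identityˡ (inv n))))))
  (null-*ˡ (ι r) {inv} null-inv)

seq-π : ∀ n → seq π n ≡ ι 4 * Leibniz n
seq-π n = ∑-cong n (λ k → cong (σ k *_) (/≡ι*inv 4 (2 ℕ.* k))
    ∙ solve 3 (λ s a b → s :* (a :* b) := a :* (s :* b)) refl (σ k) (ι 4) (odd⁻¹ k))
  ∙ ∑-*ˡ n (ι 4) λ k → σ k * odd⁻¹ k
  where open +-*-Solver

ι4 : ι 4 ≡ 1ℚ + (1ℚ + (1ℚ + 1ℚ))
ι4 = ι-suc 3 ∙ cong (1ℚ +_) (ι-suc 2 ∙ cong (1ℚ +_) (ι-suc 1 ∙ cong (1ℚ +_) ι1))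

-- The factor 4/3 undoes the share 3/4 of the odd squares. The difference equals 4/3 times the sum
-- of two null sequences: the gap between 2n and n terms of ζ(2), and the defect.
basel : Null (λ n → seq π n * seq π n * (ℤ.+ 1 / 6) - squares n)
basel = null-cong {λ n → (ℤ.+ 4 / 3) * (D n + defect n)} eq
  (null-*ˡ (ℤ.+ 4 / 3) {λ n → D n + defect n} (null-+ {D} {defect} null-squares-double null-defect))
  where
  open +-*-Solver
  D : ℕ → ℚ
  D n = squares (2 ℕ.* n) - squares n
  eq : ∀ n → (ℤ.+ 4 / 3) * (D n + defect n) ≡ seq π n * seq π n * (ℤ.+ 1 / 6) - squares n
  eq n = cong (λ z → (ℤ.+ 4 / 3) * (z - squares n + defect n)) (squares-double n)
    ∙ solve 3 (λ b d z → con (ℤ.+ 4 / 3) :* (b :+ con ½ :* con ½ :* z :- z :+ d)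
        := con (ℤ.+ 4 / 3) :* (b :+ d) :- z) refl (oddSquares n) (defect n) (squares n)
    ∙ cong (λ z → (ℤ.+ 4 / 3) * z - squares n) (sym (Leibniz-square n))
    ∙ solve 2 (λ l z → con (ℤ.+ 4 / 3) :* ((con 1ℚ :+ con 1ℚ) :* (l :* l)) :- z :=
        (con 1ℚ :+ (con 1ℚ :+ (con 1ℚ :+ con 1ℚ))) :* l :* ((con 1ℚ :+ (con 1ℚ :+ (con 1ℚ :+ con 1ℚ))) :* l)
          :* con (ℤ.+ 1 / 6) :- z) refl (Leibniz n) (squares n)
    ∙ cong (λ p → p * p * (ℤ.+ 1 / 6) - squares n)
        (cong (_* Leibniz n) (sym ι4) ∙ sym (seq-π n))

-- Moments of the Riemann sums

≤-ε : ∀ {p q} → (∀ ε → 0ℚ < ε → p ≤ q + ε) → p ≤ q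
≤-ε {p} {q} p≤ = ≮⇒≥ λ q<p →
  let d   = p - q
      0<d = subst (_< d) (+-inverseʳ q) (+-monoˡ-< (- q) q<p)
  in <-irrefl refl (<-≤-trans
       (subst₂ _<_ (+-identityʳ (q + ½ * d))
         (solve 2 (λ p q → q :+ con ½ :* (p :- q) :+ con ½ :* (p :- q) := p) refl p q)
         (+-monoʳ-< (q + ½ * d) (0<½* 0<d)))
       (p≤ (½ * d) (0<½* 0<d)))
  where open +-*-Solver

0≤^ : ∀ {x} → 0ℚ ≤ x → ∀ s → 0ℚ ≤ x ^ℚ s
0≤^     0≤x zero    = <⇒≤ (positive⁻¹ 1ℚ)
0≤^ {x} 0≤x (suc s) = 0≤* {x} {x ^ℚ s} 0≤x (0≤^ 0≤x s)

^-mono : ∀ {x y} → 0ℚ ≤ x → x ≤ y → ∀ s → x ^ℚ s ≤ y ^ℚ s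
^-mono         0≤x x≤y zero    = ≤-refl
^-mono {x} {y} 0≤x x≤y (suc s) = *-mono 0≤x (0≤^ (≤-trans 0≤x x≤y) s) x≤y (^-mono 0≤x x≤y s)

1^ : ∀ s → 1ℚ ^ℚ s ≡ 1ℚ
1^ zero    = refl
1^ (suc s) = *-identityˡ (1ℚ ^ℚ s) ∙ 1^ s

^-+ : ∀ x m n → x ^ℚ (m ℕ.+ n) ≡ x ^ℚ m * x ^ℚ n
^-+ x zero    n = sym (*-identityˡ (x ^ℚ n))
^-+ x (suc m) n = cong (x *_) (^-+ x m n) ∙ sym (*-assoc x (x ^ℚ m) (x ^ℚ n))

module _ {a b : ℚ} (0≤a : 0ℚ ≤ a) (a≤b : a ≤ b) where
  -- This and its companion are the mean value bounds for the power s + 1 on [a, b], proved by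
  -- induction on s. Summed over the nodes, their middle terms telescope to 1.
  ^-diff-lower : ∀ s → ι (suc s) * (a ^ℚ s * (b - a)) ≤ b ^ℚ suc s - a ^ℚ suc s
  ^-diff-lower zero    = ≤-reflexive (cong (_* (1ℚ * (b - a))) ι1
    ∙ solve 2 (λ a b → con 1ℚ :* (con 1ℚ :* (b :- a)) := b :* con 1ℚ :- a :* con 1ℚ) refl a b)
    where open +-*-Solver
  ^-diff-lower (suc s) = begin
    ι (suc (suc s)) * (a * A * (b - a))             ≡⟨ cong (_* (a * A * (b - a))) (ι-suc (suc s))
      ∙ solve 4 (λ n a A d → (con 1ℚ :+ n) :* (a :* A :* d) := a :* (n :* (A :* d)) :+ a :* A :* d)
          refl (ι (suc s)) a A (b - a) ⟩
    a * (ι (suc s) * (A * (b - a))) + a * A * (b - a)   ≤⟨ +-mono-≤ (*-monoˡ 0≤a (^-diff-lower s))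
      (*-monoʳ (0≤q-p a≤b) (^-mono 0≤a a≤b (suc s))) ⟩
    a * (b * B - a * A) + b * B * (b - a)           ≡⟨ solve 4 (λ a b A B →
      a :* (b :* B :- a :* A) :+ b :* B :* (b :- a) := b :* (b :* B) :- a :* (a :* A)) refl a b A B ⟩
    b * (b * B) - a * (a * A)                       ∎
    where
    open ≤-Reasoning
    open +-*-Solver
    A B : ℚ
    A = a ^ℚ s
    B = b ^ℚ s

  ^-diff-upper : ∀ s → b ^ℚ suc s - a ^ℚ suc s ≤ ι (suc s) * (b ^ℚ s * (b - a))
  ^-diff-upper zero    = ≤-reflexive (sym (cong (_* (1ℚ * (b - a))) ι1
    ∙ solve 2 (λ a b → con 1ℚ :* (con 1ℚ :* (b :- a)) := b :* con 1ℚ :- a :* con 1ℚ) refl a b))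
    where open +-*-Solver
  ^-diff-upper (suc s) = begin
    b * (b * B) - a * (a * A)                       ≡⟨ solve 4 (λ a b A B →
      b :* (b :* B) :- a :* (a :* A) := b :* (b :* B :- a :* A) :+ a :* A :* (b :- a)) refl a b A B ⟩
    b * (b * B - a * A) + a * A * (b - a)           ≤⟨ +-mono-≤
      (*-monoˡ (≤-trans 0≤a a≤b) (^-diff-upper s))
      (*-monoʳ (0≤q-p a≤b) (^-mono 0≤a a≤b (suc s))) ⟩
    b * (ι (suc s) * (B * (b - a))) + b * B * (b - a)   ≡⟨ solve 4 (λ n b B d →
      b :* (n :* (B :* d)) :+ b :* B :* d := (con 1ℚ :+ n) :* (b :* B :* d)) refl (ι (suc s)) b B (b - a)
      ∙ cong (_* (b * B * (b - a))) (sym (ι-suc (suc s))) ⟩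
    ι (suc (suc s)) * (b * B * (b - a))             ∎
    where
    open ≤-Reasoning
    open +-*-Solver
    A B : ℚ
    A = a ^ℚ s
    B = b ^ℚ s

node : ℕ → ℕ → ℚ
node M k = ι k * inv M

riemann : ℕ → ℕ → ℚ
riemann M s = inv M * ∑ℚ (suc M) λ k → node M k ^ℚ s

module _ (M : ℕ) where
  private
    y : ℕ → ℚ
    y = node M

  node-0 : y 0 ≡ 0ℚ
  node-0 = cong (_* inv M) ι0 ∙ *-zeroˡ (inv M)

  node-last : y (suc M) ≡ 1ℚ
  node-last = *-comm (ι (suc M)) (inv M) ∙ inv-* M

  0≤node : ∀ k → 0ℚ ≤ y k
  0≤node k = 0≤* {ι k} {inv M} (0≤ι k) (0≤inv M)

  node-mono : ∀ k → y k ≤ y (suc k)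
  node-mono k = *-monoʳ (0≤inv M) (ι-mono (ℕₚ.n≤1+n k))

  node-step : ∀ k → y (suc k) - y k ≡ inv M
  node-step k = cong (λ z → z * inv M - y k) (ι-suc k)
    ∙ solve 2 (λ k x → (con 1ℚ :+ k) :* x :- k :* x := x) refl (ι k) (inv M)
    where open +-*-Solver

  node-telescope : ∀ s → ∑ℚ (suc M) (λ k → y (suc k) ^ℚ suc s - y k ^ℚ suc s) ≡ 1ℚ
  node-telescope s = begin
    ∑ℚ (suc M) (λ k → Y (suc k) - Y k)        ≡⟨ ∑-cong (suc M) (λ k →
      solve 2 (λ a b → b :- a := :- (a :- b)) refl (Y k) (Y (suc k))) ⟩
    ∑ℚ (suc M) (λ k → - (Y k - Y (suc k)))    ≡⟨ ∑-neg (suc M) (λ k → Y k - Y (suc k)) ⟩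
    - ∑ℚ (suc M) (λ k → Y k - Y (suc k))      ≡⟨ cong -_ (∑-telescope (suc M) Y) ⟩
    - (Y 0 - Y (suc M))                       ≡⟨ cong₂ (λ a b → - (a ^ℚ suc s - b ^ℚ suc s)) node-0 node-last ⟩
    - (0ℚ * 0ℚ ^ℚ s - 1ℚ * 1ℚ ^ℚ s)           ≡⟨ cong (λ z → - (0ℚ * 0ℚ ^ℚ s - 1ℚ * z)) (1^ s) ⟩
    - (0ℚ * 0ℚ ^ℚ s - 1ℚ * 1ℚ)                ≡⟨ solve 1 (λ z → :- (con 0ℚ :* z :- con 1ℚ :* con 1ℚ) := con 1ℚ)
                                                   refl (0ℚ ^ℚ s) ⟩
    1ℚ                                        ∎
    where
    open ≡-Reasoning
    open +-*-Solver
    Y : ℕ → ℚ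
    Y k = y k ^ℚ suc s

  riemann-upper : ∀ s → ι (suc s) * riemann M s ≤ 1ℚ
  riemann-upper s = begin
    ι (suc s) * (inv M * ∑ℚ (suc M) Y)            ≡⟨ cong (ι (suc s) *_) (*-comm (inv M) (∑ℚ (suc M) Y)
                                                       ∙ sym (∑-*ʳ (suc M) (inv M) Y))
                                                     ∙ sym (∑-*ˡ (suc M) (ι (suc s)) λ k → Y k * inv M) ⟩
    ∑ℚ (suc M) (λ k → ι (suc s) * (Y k * inv M))  ≤⟨ ∑-mono (suc M) (λ k →
      subst (λ d → ι (suc s) * (Y k * d) ≤ y (suc k) ^ℚ suc s - y k ^ℚ suc s) (node-step k)
        (^-diff-lower (0≤node k) (node-mono k) s)) ⟩
    ∑ℚ (suc M) (λ k → y (suc k) ^ℚ suc s - y k ^ℚ suc s)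
                                                  ≡⟨ node-telescope s ⟩
    1ℚ                                            ∎
    where
    open ≤-Reasoning
    Y : ℕ → ℚ
    Y k = y k ^ℚ s

  riemann-lower : ∀ s → 1ℚ ≤ ι (suc s) * (riemann M s + inv M)
  riemann-lower s = begin
    1ℚ                                            ≡⟨ node-telescope s ⟨
    ∑ℚ (suc M) (λ k → y (suc k) ^ℚ suc s - y k ^ℚ suc s)
                                                  ≤⟨ ∑-mono (suc M) (λ k →
      subst (λ d → y (suc k) ^ℚ suc s - y k ^ℚ suc s ≤ ι (suc s) * (Y (suc k) * d)) (node-step k)
        (^-diff-upper (0≤node k) (node-mono k) s)) ⟩
    ∑ℚ (suc M) (λ k → ι (suc s) * (Y (suc k) * inv M))
                                                  ≡⟨ ∑-*ˡ (suc M) (ι (suc s)) (λ k → Y (suc k) * inv M)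
                                                     ∙ cong (ι (suc s) *_) (∑-*ʳ (suc M) (inv M) (Y ∘ suc)
                                                       ∙ *-comm (∑ℚ (suc M) (Y ∘ suc)) (inv M)) ⟩
    ι (suc s) * (inv M * ∑ℚ (suc M) (Y ∘ suc))    ≤⟨ *-monoˡ (0≤ι (suc s)) (*-monoˡ (0≤inv M) shift) ⟩
    ι (suc s) * (inv M * (∑ℚ (suc M) Y + 1ℚ))     ≡⟨ cong (ι (suc s) *_)
      (solve 2 (λ x s → x :* (s :+ con 1ℚ) := x :* s :+ x) refl (inv M) (∑ℚ (suc M) Y)) ⟩
    ι (suc s) * (riemann M s + inv M)             ∎
    where
    open ≤-Reasoning
    open +-*-Solver
    Y : ℕ → ℚ
    Y k = y k ^ℚ s
    -- Right endpoints instead of left ones: the nonnegative value at node 0 is dropped and the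
    -- value 1 at the last node is gained.
    shift : ∑ℚ (suc M) (Y ∘ suc) ≤ ∑ℚ (suc M) Y + 1ℚ
    shift = begin
      ∑ℚ (suc M) (Y ∘ suc)          ≡⟨ +-identityˡ (∑ℚ (suc M) (Y ∘ suc)) ⟨
      0ℚ + ∑ℚ (suc M) (Y ∘ suc)     ≤⟨ +-monoˡ-≤ (∑ℚ (suc M) (Y ∘ suc)) (0≤^ (0≤node 0) s) ⟩
      ∑ℚ (suc (suc M)) Y            ≡⟨ ∑-last (suc M) Y ⟩
      ∑ℚ (suc M) Y + Y (suc M)      ≡⟨ cong (∑ℚ (suc M) Y +_) (cong (_^ℚ s) node-last ∙ 1^ s) ⟩
      ∑ℚ (suc M) Y + 1ℚ             ∎

  riemann-error : ∀ s → ∣ riemann M s - inv s ∣ ≤ inv M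
  riemann-error s = ∣∣≤
    (begin
      R - x                         ≡⟨ cong (_- x) (scale R) ⟩
      x * (ι (suc s) * R) - x       ≤⟨ +-monoˡ-≤ (- x) (*-monoˡ (0≤inv s) (riemann-upper s)) ⟩
      x * 1ℚ - x                    ≡⟨ solve 1 (λ x → x :* con 1ℚ :- x := con 0ℚ) refl x ⟩
      0ℚ                            ≤⟨ 0≤inv M ⟩
      inv M                         ∎)
    (begin
      - (R - x)                     ≡⟨ solve 2 (λ r x → :- (r :- x) := x :* con 1ℚ :- r) refl R x ⟩
      x * 1ℚ - R                    ≤⟨ +-monoˡ-≤ (- R) (*-monoˡ (0≤inv s) (riemann-lower s)) ⟩
      x * (ι (suc s) * (R + inv M)) - R   ≡⟨ cong (_- R) (scale (R + inv M)) ⟨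
      R + inv M - R                 ≡⟨ solve 2 (λ r m → r :+ m :- r := m) refl R (inv M) ⟩
      inv M                         ∎)
    where
    open ≤-Reasoning
    open +-*-Solver
    x R : ℚ
    x = inv s
    R = riemann M s
    scale : ∀ z → z ≡ x * (ι (suc s) * z)
    scale z = sym (*-identityˡ z) ∙ cong (_* z) (sym (inv-* s)) ∙ *-assoc x (ι (suc s)) z

null-riemann : ∀ s → Null (λ M → riemann M s - inv s)
null-riemann s = null-squeeze 0 (λ M _ → riemann-error M s) null-inv

-- Quadratic forms of Hankel matrices

Hankel : (ℕ → ℚ) → (ℕ → ℚ) → ℕ → ℚ
Hankel μ a n = ∑ℚ n λ i → ∑ℚ n λ j → a i * a j * μ (i ℕ.+ j)

pairing : (ℕ → ℚ) → (ℕ → ℚ) → ℕ → ℕ → ℚ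
pairing μ a n m = ∑ℚ n λ i → a i * μ (i ℕ.+ m)

-- The squared norm of a₀ + … + aₙ₋₁ xⁿ⁻¹ + z xᵐ when μ is the moment sequence of the measure.
extended : (ℕ → ℚ) → (ℕ → ℚ) → ℕ → ℚ → ℕ → ℚ
extended μ a n z m = Hankel μ a n + (z + z) * pairing μ a n m + z * z * μ (m ℕ.+ m)

Hankel-suc : ∀ μ a n → Hankel μ a (suc n) ≡ extended μ a n (a n) n
Hankel-suc μ a n = ∑-last n (λ i → ∑ℚ (suc n) λ j → a i * a j * μ (i ℕ.+ j))
  ∙ cong₂ _+_
      (∑-cong n (λ i → ∑-last n λ j → a i * a j * μ (i ℕ.+ j))
       ∙ ∑-+ n (λ i → ∑ℚ n λ j → a i * a j * μ (i ℕ.+ j)) (λ i → a i * a n * μ (i ℕ.+ n))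
       ∙ cong (Hankel μ a n +_) (∑-cong n (λ i →
             solve 3 (λ x y z → x :* y :* z := y :* (x :* z)) refl (a i) (a n) (μ (i ℕ.+ n)))
           ∙ ∑-*ˡ n (a n) λ i → a i * μ (i ℕ.+ n)))
      (∑-last n (λ j → a n * a j * μ (n ℕ.+ j))
       ∙ cong (_+ a n * a n * μ (n ℕ.+ n)) (∑-cong n (λ j →
             cong (λ k → a n * a j * μ k) (ℕₚ.+-comm n j) ∙ *-assoc (a n) (a j) (μ (j ℕ.+ n)))
           ∙ ∑-*ˡ n (a n) λ j → a j * μ (j ℕ.+ n)))
  ∙ solve 4 (λ h z p w → h :+ z :* p :+ (z :* p :+ w) := h :+ (z :+ z) :* p :+ w)
      refl (Hankel μ a n) (a n) (pairing μ a n n) (a n * a n * μ (n ℕ.+ n))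
  where open +-*-Solver

module _ (a : ℕ → ℚ) (n : ℕ) (z : ℚ) (m : ℕ) where
  poly : ℚ → ℚ
  poly x = ∑ℚ n (λ i → a i * x ^ℚ i) + z * x ^ℚ m

  -- The powers of x are the moments of the point mass at x, for which the form is a perfect square.
  -- As `extended` is linear in μ, its value at a Riemann sum is a positively weighted sum of
  -- squares.
  extended-^ : ∀ x → extended (x ^ℚ_) a n z m ≡ poly x * poly x
  extended-^ x = cong₂ (λ u v → u + (z + z) * v + z * z * x ^ℚ (m ℕ.+ m))
      (∑-cong n (λ i → ∑-cong n (λ j → cong (a i * a j *_) (^-+ x i j)
            ∙ solve 4 (λ p q r s → p :* q :* (r :* s) := (p :* r) :* (q :* s))
                refl (a i) (a j) (x ^ℚ i) (x ^ℚ j))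
          ∙ ∑-*ˡ n (a i * x ^ℚ i) λ j → a j * x ^ℚ j)
        ∙ ∑-*ʳ n S λ i → a i * x ^ℚ i)
      (∑-cong n (λ i → cong (a i *_) (^-+ x i m) ∙ sym (*-assoc (a i) (x ^ℚ i) (x ^ℚ m)))
        ∙ ∑-*ʳ n (x ^ℚ m) λ i → a i * x ^ℚ i)
    ∙ cong (λ w → S * S + (z + z) * (S * x ^ℚ m) + z * z * w) (^-+ x m m)
    ∙ solve 3 (λ s z y → s :* s :+ (z :+ z) :* (s :* y) :+ z :* z :* (y :* y)
        := (s :+ z :* y) :* (s :+ z :* y)) refl S z (x ^ℚ m)
    where
    open +-*-Solver
    S : ℚ
    S = ∑ℚ n λ i → a i * x ^ℚ i

  extended-cong : ∀ {μ ν} → (∀ s → μ s ≡ ν s) → extended μ a n z m ≡ extended ν a n z m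
  extended-cong {μ} {ν} μ≡ν = cong₂ (λ u v → u + v)
    (cong₂ (λ u v → u + (z + z) * v)
      (∑-cong n λ i → ∑-cong n λ j → cong (a i * a j *_) (μ≡ν (i ℕ.+ j)))
      (∑-cong n λ i → cong (a i *_) (μ≡ν (i ℕ.+ m))))
    (cong (z * z *_) (μ≡ν (m ℕ.+ m)))

  extended-+ : ∀ μ ν → extended (λ s → μ s + ν s) a n z m ≡ extended μ a n z m + extended ν a n z m
  extended-+ μ ν = cong₂ (λ u v → u + (z + z) * v + z * z * (μ (m ℕ.+ m) + ν (m ℕ.+ m)))
      (∑-cong n (λ i → ∑-cong n (λ j → *-distribˡ-+ (a i * a j) (μ (i ℕ.+ j)) (ν (i ℕ.+ j)))
          ∙ ∑-+ n (λ j → a i * a j * μ (i ℕ.+ j)) λ j → a i * a j * ν (i ℕ.+ j))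
        ∙ ∑-+ n (λ i → ∑ℚ n λ j → a i * a j * μ (i ℕ.+ j)) (λ i → ∑ℚ n λ j → a i * a j * ν (i ℕ.+ j)))
      (∑-cong n (λ i → *-distribˡ-+ (a i) (μ (i ℕ.+ m)) (ν (i ℕ.+ m)))
        ∙ ∑-+ n (λ i → a i * μ (i ℕ.+ m)) λ i → a i * ν (i ℕ.+ m))
    ∙ solve 7 (λ h k z p q u v → h :+ k :+ (z :+ z) :* (p :+ q) :+ z :* z :* (u :+ v)
        := h :+ (z :+ z) :* p :+ z :* z :* u :+ (k :+ (z :+ z) :* q :+ z :* z :* v))
        refl (Hankel μ a n) (Hankel ν a n) z (pairing μ a n m) (pairing ν a n m)
        (μ (m ℕ.+ m)) (ν (m ℕ.+ m))
    where open +-*-Solver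

  extended-*ˡ : ∀ w μ → extended (λ s → w * μ s) a n z m ≡ w * extended μ a n z m
  extended-*ˡ w μ = cong₂ (λ u v → u + (z + z) * v + z * z * (w * μ (m ℕ.+ m)))
      (∑-cong n (λ i → ∑-cong n (λ j → swap (a i * a j) (μ (i ℕ.+ j)))
          ∙ ∑-*ˡ n w λ j → a i * a j * μ (i ℕ.+ j))
        ∙ ∑-*ˡ n w (λ i → ∑ℚ n λ j → a i * a j * μ (i ℕ.+ j)))
      (∑-cong n (λ i → swap (a i) (μ (i ℕ.+ m))) ∙ ∑-*ˡ n w λ i → a i * μ (i ℕ.+ m))
    ∙ solve 5 (λ h w z p u → w :* h :+ (z :+ z) :* (w :* p) :+ z :* z :* (w :* u)
        := w :* (h :+ (z :+ z) :* p :+ z :* z :* u))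
        refl (Hankel μ a n) w z (pairing μ a n m) (μ (m ℕ.+ m))
    where
    open +-*-Solver
    swap : ∀ p q → p * (w * q) ≡ w * (p * q)
    swap p q = solve 3 (λ p w q → p :* (w :* q) := w :* (p :* q)) refl p w q

  extended-∑ : ∀ N (μ : ℕ → ℕ → ℚ) →
    extended (λ s → ∑ℚ N λ k → μ k s) a n z m ≡ ∑ℚ N λ k → extended (μ k) a n z m
  -- The zero moments are read as a zero multiple, so that homogeneity applies.
  extended-∑ zero    μ = extended-cong {λ _ → 0ℚ} {λ _ → 0ℚ * 0ℚ} (λ _ → refl)
    ∙ extended-*ˡ 0ℚ (λ _ → 0ℚ) ∙ *-zeroˡ (extended (λ _ → 0ℚ) a n z m)
  extended-∑ (suc N) μ = extended-+ (μ 0) (λ s → ∑ℚ N λ k → μ (suc k) s)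
    ∙ cong (extended (μ 0) a n z m +_) (extended-∑ N (μ ∘ suc))

  extended-riemann : ∀ M → extended (riemann M) a n z m
    ≡ inv M * ∑ℚ (suc M) λ k → poly (node M k) * poly (node M k)
  extended-riemann M = extended-*ˡ (inv M) (λ s → ∑ℚ (suc M) λ k → node M k ^ℚ s)
    ∙ cong (inv M *_) (extended-∑ (suc M) (λ k → node M k ^ℚ_)
      ∙ ∑-cong (suc M) λ k → extended-^ (node M k))

-- The limit M → ∞ of quantities that are only known up to t → ∞

-- The threshold for M is independent of t, while the one for t may depend on M: `Limit` quantifies
-- in this order, since each of its inequalities between reals holds only from some index on.
UNull : (ℕ → ℕ → ℚ) → Set
UNull x = ∀ ε → 0ℚ < ε → ∃ λ N → ∀ M → N ℕ.≤ M → ∃ λ T → ∀ t → T ℕ.≤ t → ∣ x M t ∣ ≤ ε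

unull-null : ∀ {ν : ℕ → ℚ} → Null ν → UNull (λ M _ → ν M)
unull-null nν ε 0<ε with nν ε 0<ε
... | N , hN = N , λ M M≥ → 0 , λ _ _ → hN M M≥

unull-cong : ∀ {x y : ℕ → ℕ → ℚ} → (∀ M t → x M t ≡ y M t) → UNull x → UNull y
unull-cong {x} {y} x≡y ux ε 0<ε with ux ε 0<ε
... | N , hN = N , λ M M≥ → proj₁ (hN M M≥) , λ t t≥ →
  subst (λ p → ∣ p ∣ ≤ ε) (x≡y M t) (proj₂ (hN M M≥) t t≥)

unull-+ : ∀ {x y : ℕ → ℕ → ℚ} → UNull x → UNull y → UNull (λ M t → x M t + y M t)
unull-+ {x} {y} ux uy ε 0<ε with ux (½ * ε) (0<½* 0<ε) | uy (½ * ε) (0<½* 0<ε)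
... | K , hK | L , hL = K ℕ.⊔ L , λ M M≥ →
  let T , hT = hK M (ℕₚ.m⊔n≤o⇒m≤o K L M≥)
      U , hU = hL M (ℕₚ.m⊔n≤o⇒n≤o K L M≥)
  in T ℕ.⊔ U , λ t t≥ → ≤-trans (∣p+q∣≤∣p∣+∣q∣ (x M t) (y M t))
    (≤-trans (+-mono-≤ (hT t (ℕₚ.m⊔n≤o⇒m≤o T U t≥)) (hU t (ℕₚ.m⊔n≤o⇒n≤o T U t≥)))
      (≤-reflexive (½+½ ε)))

unull-∑ : ∀ n {x : ℕ → ℕ → ℕ → ℚ} → (∀ k → UNull (x k)) →
          UNull (λ M t → ∑ℚ n λ k → x k M t)
unull-∑ zero        ux = unull-null {λ _ → 0ℚ} null-0
unull-∑ (suc n) {x} ux = unull-+ {x 0} {λ M t → ∑ℚ n λ k → x (suc k) M t}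
  (ux 0) (unull-∑ n (ux ∘ suc))

unull-bounded-* : ∀ {w : ℕ → ℚ} {x : ℕ → ℕ → ℚ} → Bounded w → UNull x → UNull (λ M t → w t * x M t)
unull-bounded-* {w} {x} (K , S , hS) ux ε 0<ε with ux (inv K * ε) (0<* (0<inv K) 0<ε)
... | N , hN = N , λ M M≥ → let T , hT = hN M M≥ in S ℕ.⊔ T , λ t t≥ → begin
  ∣ w t * x M t ∣            ≡⟨ ∣p*q∣≡∣p∣*∣q∣ (w t) (x M t) ⟩
  ∣ w t ∣ * ∣ x M t ∣        ≤⟨ *-mono {∣ w t ∣} {ι (suc K)} {∣ x M t ∣} {inv K * ε} (0≤∣p∣ (w t))
                                  (<⇒≤ (0<* (0<inv K) 0<ε))
                                  (hS t (ℕₚ.m⊔n≤o⇒m≤o S T t≥)) (hT t (ℕₚ.m⊔n≤o⇒n≤o S T t≥)) ⟩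
  ι (suc K) * (inv K * ε)    ≡⟨ solve 3 (λ a b e → b :* (a :* e) := (a :* b) :* e) refl (inv K) (ι (suc K)) ε ⟩
  inv K * ι (suc K) * ε      ≡⟨ cong (_* ε) (inv-* K) ⟩
  1ℚ * ε                     ≡⟨ *-identityˡ ε ⟩
  ε                          ∎
  where
  open ≤-Reasoning
  open +-*-Solver

bounded-* : ∀ {x y : ℕ → ℚ} → Bounded x → Bounded y → Bounded (λ n → x n * y n)
bounded-* {x} {y} (K , M , hM) (L , N , hN) = L ℕ.+ K ℕ.* suc L , M ℕ.⊔ N , λ n n≥ →
  ≤-trans (≤-reflexive (∣p*q∣≡∣p∣*∣q∣ (x n) (y n)))
    (≤-trans (*-mono {∣ x n ∣} {ι (suc K)} {∣ y n ∣} {ι (suc L)} (0≤∣p∣ (x n)) (0≤ι (suc L))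
        (hM n (ℕₚ.m⊔n≤o⇒m≤o M N n≥)) (hN n (ℕₚ.m⊔n≤o⇒n≤o M N n≥)))
      (≤-reflexive (sym (ι-* (suc K) (suc L)))))

bounded-+ : ∀ {x y : ℕ → ℚ} → Bounded x → Bounded y → Bounded (λ n → x n + y n)
bounded-+ {x} {y} (K , M , hM) (L , N , hN) = K ℕ.+ suc L , M ℕ.⊔ N , λ n n≥ →
  ≤-trans (∣p+q∣≤∣p∣+∣q∣ (x n) (y n))
    (≤-trans (+-mono-≤ (hM n (ℕₚ.m⊔n≤o⇒m≤o M N n≥)) (hN n (ℕₚ.m⊔n≤o⇒n≤o M N n≥)))
      (≤-reflexive (sym (ι-+ (suc K) (suc L)))))

module _ {a : ℕ → ℕ → ℚ} {z : ℕ → ℚ} (ba : ∀ k → Bounded (a k)) (bz : Bounded z) (n m : ℕ) where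
  -- By linearity in μ the difference is the form at the moment errors `ν M`. These tend to 0 in M,
  -- and their coefficients stay bounded as t varies.
  riemann-limit : UNull (λ M t → extended (riemann M) (λ k → a k t) n (z t) m
                               - extended inv (λ k → a k t) n (z t) m)
  riemann-limit = unull-cong {λ M t → extended (ν M) (λ k → a k t) n (z t) m} diff
    (unull-+ {λ M t → Hankel (ν M) (λ k → a k t) n + (z t + z t) * pairing (ν M) (λ k → a k t) n m}
       {λ M t → z t * z t * ν M (m ℕ.+ m)}
      (unull-+ {λ M t → Hankel (ν M) (λ k → a k t) n}
        {λ M t → (z t + z t) * pairing (ν M) (λ k → a k t) n m}
        (unull-∑ n {λ i M t → ∑ℚ n λ j → a i t * a j t * ν M (i ℕ.+ j)} λ i →
          unull-∑ n {λ j M t → a i t * a j t * ν M (i ℕ.+ j)} λ j →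
            term {λ t → a i t * a j t} (bounded-* {a i} {a j} (ba i) (ba j)) (i ℕ.+ j))
        (unull-bounded-* {λ t → z t + z t} {λ M t → pairing (ν M) (λ k → a k t) n m}
          (bounded-+ {z} {z} bz bz)
          (unull-∑ n {λ i M t → a i t * ν M (i ℕ.+ m)} λ i → term {a i} (ba i) (i ℕ.+ m))))
      (term {λ t → z t * z t} (bounded-* {z} {z} bz bz) (m ℕ.+ m)))
    where
    open +-*-Solver
    ν : ℕ → ℕ → ℚ
    ν M s = riemann M s - inv s
    term : ∀ {w} → Bounded w → ∀ s → UNull (λ M t → w t * ν M s)
    term {w} bw s = unull-bounded-* {w} {λ M _ → ν M s} bw (unull-null (null-riemann s))
    diff : ∀ M t → extended (ν M) (λ k → a k t) n (z t) m ≡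
      extended (riemann M) (λ k → a k t) n (z t) m - extended inv (λ k → a k t) n (z t) m
    diff M t = extended-cong b n (z t) m {ν M} {λ s → riemann M s + (- 1ℚ) * inv s}
        (λ s → cong (riemann M s +_) (cong -_ (sym (*-identityˡ (inv s))) ∙ neg-distribˡ-* 1ℚ (inv s)))
      ∙ extended-+ b n (z t) m (riemann M) (λ s → (- 1ℚ) * inv s)
      ∙ cong (extended (riemann M) b n (z t) m +_) (extended-*ˡ b n (z t) m (- 1ℚ) inv
        ∙ sym (neg-distribˡ-* 1ℚ e) ∙ cong -_ (*-identityˡ e))
      where
      b : ℕ → ℚ
      b k = a k t
      e : ℚ
      e = extended inv b n (z t) m

-- A limit of sums of squares over the nodes; the coefficients are taken constant in t.
hilbert-nonneg : ∀ a n z m → 0ℚ ≤ extended inv a n z m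
hilbert-nonneg a n z m = ≤-ε λ ε 0<ε →
  let N , hN = riemann-limit {λ k _ → a k} {λ _ → z} (λ k → bounded-const (a k)) (bounded-const z)
                 n m ε 0<ε
      T , hT = hN N ℕₚ.≤-refl
  in ≤-trans (0≤riemann N) (∣-∣≤⇒≤+ {extended (riemann N) a n z m} (hT T ℕₚ.≤-refl))
  where
  0≤riemann : ∀ M → 0ℚ ≤ extended (riemann M) a n z m
  0≤riemann M = subst (0ℚ ≤_) (sym (extended-riemann a n z m M))
    (0≤* {inv M} {∑ℚ (suc M) λ k → poly a n z m (node M k) * poly a n z m (node M k)} (0≤inv M)
      (0≤∑ (suc M) λ k → 0≤² (poly a n z m (node M k))))

-- The greedy coefficients

-- residual n m is ⟨p_{n-1}, xᵐ⟩.
mutual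
  -- Projection onto a single monomial: the factor 2n + 3 is the reciprocal of ‖xⁿ⁺¹‖².
  coeff : ℕ → ℚ
  coeff zero    = 1ℚ
  coeff (suc n) = - (ι (suc (suc n ℕ.+ suc n)) * residual (suc n) (suc n))

  residual : ℕ → ℕ → ℚ
  residual zero    m = 0ℚ
  residual (suc n) m = residual n m + coeff n * inv (n ℕ.+ m)

-- The term-by-term recursion of `residual` keeps the mutual definition with `coeff` visibly
-- well-founded; here it is identified with the sum.
residual-∑ : ∀ n m → residual n m ≡ pairing inv coeff n m
residual-∑ zero    m = refl
residual-∑ (suc n) m = cong (_+ coeff n * inv (n ℕ.+ m)) (residual-∑ n m)
  ∙ sym (∑-last n λ k → coeff k * inv (k ℕ.+ m))

coeff-* : ∀ n → coeff (suc n) * inv (suc n ℕ.+ suc n) ≡ - residual (suc n) (suc n)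
coeff-* n = solve 3 (λ i f x → (:- (i :* f)) :* x := :- ((x :* i) :* f)) refl
    (ι (suc (suc n ℕ.+ suc n))) f (inv (suc n ℕ.+ suc n))
  ∙ cong (λ w → - (w * f)) (inv-* (suc n ℕ.+ suc n)) ∙ cong -_ (*-identityˡ f)
  where
  open +-*-Solver
  f : ℚ
  f = residual (suc n) (suc n)

residual-orthogonal : ∀ n → residual (suc (suc n)) (suc n) ≡ 0ℚ
residual-orthogonal n = cong (residual (suc n) (suc n) +_) (coeff-* n) ∙ +-inverseʳ (residual (suc n) (suc n))

-- Norms of the greedy polynomials and Cauchy-Schwarz

norm² : ℕ → ℚ
norm² = Hankel inv coeff

-- Pythagoras: the new polynomial is orthogonal to its last term, so the squared norm drops by the
-- squared norm of that term.
norm²-suc : ∀ n → norm² (suc (suc n)) ≤ norm² (suc n)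
norm²-suc n = subst (_≤ norm² (suc n)) (sym eq) (≤-trans
  (+-monoʳ-≤ (norm² (suc n)) (neg-antimono-≤ (0≤* {c * c} {x} (0≤² c) (0≤inv (suc n ℕ.+ suc n)))))
  (≤-reflexive (+-identityʳ (norm² (suc n)))))
  where
  open +-*-Solver
  c x f : ℚ
  c = coeff (suc n)
  x = inv (suc n ℕ.+ suc n)
  f = residual (suc n) (suc n)
  eq : norm² (suc (suc n)) ≡ norm² (suc n) - c * c * x
  eq = Hankel-suc inv coeff (suc n)
    ∙ cong (λ p → norm² (suc n) + (c + c) * p + c * c * x)
        (sym (residual-∑ (suc n) (suc n))
         ∙ solve 1 (λ f → f := :- (:- f)) refl f ∙ cong -_ (sym (coeff-* n)))
    ∙ solve 3 (λ h c x → h :+ (c :+ c) :* (:- (c :* x)) :+ c :* c :* x := h :- c :* c :* x)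
        refl (norm² (suc n)) c x

norm²≤1 : ∀ n → norm² n ≤ 1ℚ
-- The empty polynomial has norm 0; the decrease sets in only from ‖p₀‖ = 1.
norm²≤1 zero          = <⇒≤ (positive⁻¹ 1ℚ)
norm²≤1 (suc zero)    = ≤-reflexive (cong (λ x → 1ℚ * 1ℚ * x + 0ℚ + 0ℚ) inv0)
norm²≤1 (suc (suc n)) = ≤-trans (norm²-suc n) (norm²≤1 (suc n))

-- Cauchy-Schwarz: nonnegativity of ‖p + z xᵐ‖² at its minimiser z = -(2m+1)⟨p, xᵐ⟩, combined with
-- ‖p‖ ≤ 1.
residual-² : ∀ n m → residual n m * residual n m ≤ inv (m ℕ.+ m)
residual-² n m = 0≤q-p⇒p≤q (subst (0ℚ ≤_) eq
  (0≤* {x} {1ℚ - d * (f * f)} (0≤inv (m ℕ.+ m)) (≤-trans 0≤ (+-monoˡ-≤ (- (d * (f * f))) (norm²≤1 n)))))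
  where
  open +-*-Solver
  x d f z : ℚ
  x = inv (m ℕ.+ m)
  d = ι (suc (m ℕ.+ m))
  f = residual n m
  z = - (d * f)
  0≤ : 0ℚ ≤ norm² n - d * (f * f)
  0≤ = subst (0ℚ ≤_)
    (cong (λ p → norm² n + (z + z) * p + z * z * x) (sym (residual-∑ n m))
     ∙ solve 4 (λ h d f x → h :+ (:- (d :* f) :+ :- (d :* f)) :* f :+ (:- (d :* f)) :* (:- (d :* f)) :* x
         := h :+ (x :* d :- (con 1ℚ :+ con 1ℚ)) :* (d :* (f :* f))) refl (norm² n) d f x
     ∙ cong (λ w → norm² n + (w - (1ℚ + 1ℚ)) * (d * (f * f))) (inv-* (m ℕ.+ m))
     ∙ solve 2 (λ h w → h :+ (con 1ℚ :- (con 1ℚ :+ con 1ℚ)) :* w := h :- w) refl (norm² n) (d * (f * f)))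
    (hilbert-nonneg coeff n z m)
  eq : x * (1ℚ - d * (f * f)) ≡ x - f * f
  eq = solve 3 (λ x d f → x :* (con 1ℚ :- d :* (f :* f)) := x :- (x :* d) :* (f :* f)) refl x d f
    ∙ cong (λ w → x - w * (f * f)) (inv-* (m ℕ.+ m)) ∙ cong (λ w → x - w) (*-identityˡ (f * f))

-- central m is the normalised central binomial coefficient C(2m,m)/4ᵐ, a rational substitute for
-- 1/√m for which central m/(m+1) telescopes.
central : ℕ → ℚ
central zero    = 1ℚ
central (suc m) = central m * (odd m * (½ * inv m))

odd-suc : ∀ m → odd (suc m) ≡ 1ℚ + 1ℚ + odd m
odd-suc m = cong (λ z → 1ℚ + (z + z)) (ι-suc m)
  ∙ solve 1 (λ m → con 1ℚ :+ ((con 1ℚ :+ m) :+ (con 1ℚ :+ m)) :=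
      con 1ℚ :+ con 1ℚ :+ (con 1ℚ :+ (m :+ m))) refl (ι m)
  where open +-*-Solver

0≤odd : ∀ m → 0ℚ ≤ odd m
0≤odd m = 0≤+ (<⇒≤ (positive⁻¹ 1ℚ)) (0≤+ (0≤ι m) (0≤ι m))

0≤½inv : ∀ m → 0ℚ ≤ ½ * inv m
0≤½inv m = 0≤* {½} {inv m} (<⇒≤ (positive⁻¹ ½)) (0≤inv m)

½inv-* : ∀ m → ½ * inv m * (1ℚ + odd m) ≡ 1ℚ
½inv-* m = solve 2 (λ x m → con ½ :* x :* (con 1ℚ :+ (con 1ℚ :+ (m :+ m))) := x :* (con 1ℚ :+ m))
    refl (inv m) (ι m)
  ∙ cong (inv m *_) (sym (ι-suc m)) ∙ inv-* m
  where open +-*-Solver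

0≤central : ∀ m → 0ℚ ≤ central m
0≤central zero    = <⇒≤ (positive⁻¹ 1ℚ)
0≤central (suc m) = 0≤* {central m} {odd m * (½ * inv m)} (0≤central m)
  (0≤* {odd m} {½ * inv m} (0≤odd m) (0≤½inv m))

-- Consecutive values have the ratio 1 - 1/(2 (m + 1)).
central-telescope : ∀ m → central m * inv m ≡ (1ℚ + 1ℚ) * (central m - central (suc m))
central-telescope m = sym (
  cong (λ w → (1ℚ + 1ℚ) * (w - u * (odd m * y)))
    (sym (*-identityʳ u) ∙ cong (u *_) (sym (½inv-* m)))
  ∙ solve 3 (λ u o x → (con 1ℚ :+ con 1ℚ) :* (u :* (con ½ :* x :* (con 1ℚ :+ o)) :- u :* (o :* (con ½ :* x)))
      := u :* x) refl u (odd m) (inv m))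
  where
  open +-*-Solver
  u y : ℚ
  u = central m
  y = ½ * inv m

-- As in Wallis's product, each step multiplies the left side by 1 - 1/(2m+2)².
central-upper : ∀ m → central m * central m * odd m ≤ 1ℚ
central-upper zero    = ≤-reflexive (cong (λ z → 1ℚ * 1ℚ * (1ℚ + (z + z))) ι0)
central-upper (suc m) = begin
  u * (o * y) * (u * (o * y)) * odd (suc m)
    ≡⟨ cong (u * (o * y) * (u * (o * y)) *_) (odd-suc m)
       ∙ solve 3 (λ u o y → u :* (o :* y) :* (u :* (o :* y)) :* (con 1ℚ :+ con 1ℚ :+ o) :=
           u :* u :* o :* ((y :* (con 1ℚ :+ o)) :* (y :* (con 1ℚ :+ o)) :- y :* y)) refl u o y
       ∙ cong (λ w → u * u * o * (w * w - y * y)) (½inv-* m) ⟩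
  u * u * o * (1ℚ * 1ℚ - y * y)
    ≤⟨ *-monoˡ (0≤* {u * u} {o} (0≤² u) (0≤odd m))
        (+-monoʳ-≤ (1ℚ * 1ℚ) (neg-antimono-≤ (0≤² y))) ⟩
  u * u * o * (1ℚ * 1ℚ - 0ℚ)
    ≡⟨ *-identityʳ (u * u * o) ⟩
  u * u * o
    ≤⟨ central-upper m ⟩
  1ℚ ∎
  where
  open ≤-Reasoning
  open +-*-Solver
  u o y : ℚ
  u = central m
  o = odd m
  y = ½ * inv m

-- The last factor is 4m + 1. The right side is 1 at m = 0 and increases, because (2m+1)²(4m+5)
-- exceeds (4m+1)(2m+2)² by exactly 1.
central-lower : ∀ m → 1ℚ ≤ central m * central m * (odd m + odd m - 1ℚ)
central-lower zero    = ≤-reflexive (sym (cong (λ z → 1ℚ * 1ℚ * (1ℚ + (z + z) + (1ℚ + (z + z)) - 1ℚ)) ι0))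
central-lower (suc m) = begin
  1ℚ
    ≤⟨ central-lower m ⟩
  u * u * (o + o - 1ℚ)
    ≡⟨ cong (u * u * (o + o - 1ℚ) *_) (cong₂ _*_ (½inv-* m) (½inv-* m))
       ∙ *-identityʳ (u * u * (o + o - 1ℚ)) ⟨
  u * u * (o + o - 1ℚ) * (y * (1ℚ + o) * (y * (1ℚ + o)))
    ≤⟨ 0≤q-p⇒p≤q (subst (0ℚ ≤_) eq (0≤² (u * y))) ⟩
  u * (o * y) * (u * (o * y)) * (1ℚ + 1ℚ + o + (1ℚ + 1ℚ + o) - 1ℚ)
    ≡⟨ cong (λ w → u * (o * y) * (u * (o * y)) * (w + w - 1ℚ)) (odd-suc m) ⟨
  u * (o * y) * (u * (o * y)) * (odd (suc m) + odd (suc m) - 1ℚ) ∎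
  where
  open ≤-Reasoning
  open +-*-Solver
  u o y : ℚ
  u = central m
  o = odd m
  y = ½ * inv m
  eq : u * y * (u * y) ≡ u * (o * y) * (u * (o * y)) * (1ℚ + 1ℚ + o + (1ℚ + 1ℚ + o) - 1ℚ)
    - u * u * (o + o - 1ℚ) * (y * (1ℚ + o) * (y * (1ℚ + o)))
  eq = solve 3 (λ u o y → u :* y :* (u :* y) :=
      u :* (o :* y) :* (u :* (o :* y)) :* (con 1ℚ :+ con 1ℚ :+ o :+ (con 1ℚ :+ con 1ℚ :+ o) :- con 1ℚ)
      :- u :* u :* (o :+ o :- con 1ℚ) :* (y :* (con 1ℚ :+ o) :* (y :* (con 1ℚ :+ o)))) refl u o y

-- The squared residual is at most 1/(2m+1), which `central-lower` turns into a multiple of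
-- `central m` squared. The factor 2 o - 1 is relaxed to 4 o because 4, unlike 2, is the square of a
-- rational.
residual-central : ∀ n m → ∣ residual n m ∣ ≤ (1ℚ + 1ℚ) * central m
residual-central n m = ∣∣≤-by-squares
  (0≤* {1ℚ + 1ℚ} {u} (<⇒≤ (positive⁻¹ (1ℚ + 1ℚ))) (0≤central m))
  (≤-trans (residual-² n m) (begin
    x                                 ≡⟨ *-identityʳ x ⟨
    x * 1ℚ                            ≤⟨ *-monoˡ (0≤inv (m ℕ.+ m)) (central-lower m) ⟩
    x * (u * u * (o + o - 1ℚ))        ≤⟨ 0≤q-p⇒p≤q (subst (0ℚ ≤_) slack
                                           (0≤* {x} {u * u * (o + o + 1ℚ)} (0≤inv (m ℕ.+ m))
                                             (0≤* {u * u} {o + o + 1ℚ} (0≤² u)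
                                               (0≤+ {o + o} (0≤+ (0≤odd m) (0≤odd m)) (<⇒≤ (positive⁻¹ 1ℚ)))))) ⟩
    x * (u * u * (o + o + (o + o)))   ≡⟨ solve 3 (λ x u o → x :* (u :* u :* (o :+ o :+ (o :+ o))) :=
                                           (con 1ℚ :+ con 1ℚ) :* u :* ((con 1ℚ :+ con 1ℚ) :* u) :* (x :* o))
                                           refl x u o ⟩
    (1ℚ + 1ℚ) * u * ((1ℚ + 1ℚ) * u) * (x * o)
                                      ≡⟨ cong ((1ℚ + 1ℚ) * u * ((1ℚ + 1ℚ) * u) *_) xo
                                         ∙ *-identityʳ ((1ℚ + 1ℚ) * u * ((1ℚ + 1ℚ) * u)) ⟩
    (1ℚ + 1ℚ) * u * ((1ℚ + 1ℚ) * u)   ∎))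
  where
  open ≤-Reasoning
  open +-*-Solver
  x u o : ℚ
  x = inv (m ℕ.+ m)
  u = central m
  o = odd m
  xo : x * o ≡ 1ℚ
  xo = cong (λ k → inv k * o) (sym (2*n≡n+n m)) ∙ odd⁻¹-* m
  slack : x * (u * u * (o + o + 1ℚ)) ≡ x * (u * u * (o + o + (o + o))) - x * (u * u * (o + o - 1ℚ))
  slack = solve 3 (λ x u o → x :* (u :* u :* (o :+ o :+ con 1ℚ)) :=
    x :* (u :* u :* (o :+ o :+ (o :+ o))) :- x :* (u :* u :* (o :+ o :- con 1ℚ))) refl x u o

-- One factor 2 comes from `residual-central`, the other from the telescoping. The bound does not
-- depend on N, so it survives when the truncation point moves with t.
residual-tail : ∀ r n N →
  ∣ (∑ℚ N λ j → residual n (n ℕ.+ j) * inv (n ℕ.+ j ℕ.+ r)) ∣ ≤ (1ℚ + 1ℚ) * (1ℚ + 1ℚ) * central n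
residual-tail r n N = begin
  ∣ ∑ℚ N f ∣                                    ≤⟨ ∣∑∣≤ N f ⟩
  ∑ℚ N (λ j → ∣ f j ∣)                          ≤⟨ ∑-mono N bound ⟩
  ∑ℚ N (λ j → 4ℚ * (u j - u (suc j)))           ≡⟨ ∑-*ˡ N 4ℚ (λ j → u j - u (suc j))
                                                   ∙ cong (4ℚ *_) (∑-telescope N u) ⟩
  4ℚ * (u 0 - u N)                              ≤⟨ *-monoˡ {r = 4ℚ} 0≤4 (+-monoʳ-≤ (u 0)
                                                     (neg-antimono-≤ (0≤central (n ℕ.+ N)))) ⟩
  4ℚ * (u 0 - 0ℚ)                               ≡⟨ cong (4ℚ *_) (+-identityʳ (u 0)
                                                     ∙ cong central (ℕₚ.+-identityʳ n)) ⟩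
  4ℚ * central n                                ∎
  where
  open ≤-Reasoning
  4ℚ : ℚ
  4ℚ = (1ℚ + 1ℚ) * (1ℚ + 1ℚ)
  0≤4 : 0ℚ ≤ 4ℚ
  0≤4 = <⇒≤ (positive⁻¹ 4ℚ)
  f u : ℕ → ℚ
  f j = residual n (n ℕ.+ j) * inv (n ℕ.+ j ℕ.+ r)
  u j = central (n ℕ.+ j)
  bound : ∀ j → ∣ f j ∣ ≤ 4ℚ * (u j - u (suc j))
  bound j = begin
    ∣ f j ∣                                     ≡⟨ ∣p*q∣≡∣p∣*∣q∣ (residual n m) (inv (m ℕ.+ r))
      ∙ cong (∣ residual n m ∣ *_) (0≤p⇒∣p∣≡p (0≤inv (m ℕ.+ r))) ⟩
    ∣ residual n m ∣ * inv (m ℕ.+ r)            ≤⟨ *-mono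
      {∣ residual n m ∣} {(1ℚ + 1ℚ) * u j} {inv (m ℕ.+ r)} {inv m}
      (0≤∣p∣ (residual n m)) (0≤inv m) (residual-central n m) (inv-anti (ℕₚ.m≤m+n m r)) ⟩
    (1ℚ + 1ℚ) * u j * inv m                     ≡⟨ *-assoc (1ℚ + 1ℚ) (u j) (inv m)
      ∙ cong ((1ℚ + 1ℚ) *_) (central-telescope m)
      ∙ sym (*-assoc (1ℚ + 1ℚ) (1ℚ + 1ℚ) (u j - central (suc m)))
      ∙ cong (λ k → 4ℚ * (u j - central k)) (sym (ℕₚ.+-suc n j)) ⟩
    4ℚ * (u j - u (suc j))                      ∎
    where
    m : ℕ
    m = n ℕ.+ j

null-central : Null central
null-central = null-sqrt (null-squeeze 0 (λ m _ → ≤-trans (≤-reflexive (0≤p⇒∣p∣≡p (0≤² (central m)))) (begin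
  central m * central m                          ≡⟨ *-identityʳ (central m * central m) ⟨
  central m * central m * 1ℚ                     ≡⟨ cong (central m * central m *_)
                                                      (*-comm (odd m) (odd⁻¹ m) ∙ odd⁻¹-* m) ⟨
  central m * central m * (odd m * odd⁻¹ m)      ≡⟨ *-assoc (central m * central m) (odd m) (odd⁻¹ m) ⟨
  central m * central m * odd m * odd⁻¹ m        ≤⟨ *-monoʳ (0≤inv (2 ℕ.* m)) (central-upper m) ⟩
  1ℚ * odd⁻¹ m                                   ≡⟨ *-identityˡ (odd⁻¹ m) ⟩
  odd⁻¹ m                                        ≤⟨ odd⁻¹≤inv m ⟩
  inv m                                          ∎)) null-inv)
  where open ≤-Reasoning

-- The numbers h r k as sums over m ≥ k

summand : ℕ → ℕ → ℕ → ℚ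
summand r k m = inv (k ℕ.+ m) * inv (m ℕ.+ r)

-- The sum over k ≤ m < T as a difference of sums from 0: the first runs over a rectangle, where the
-- order of summation can be exchanged, the second over a triangle.
truncated : ℕ → ℕ → ℕ → ℚ
truncated r k T = ∑ℚ T (summand r k) - ∑ℚ k (summand r k)

∑-coeff-summand : ∀ r n T →
  ∑ℚ n (λ k → coeff k * ∑ℚ T (summand r k)) ≡ ∑ℚ T λ m → residual n m * inv (m ℕ.+ r)
∑-coeff-summand r n T =
  ∑-cong n (λ k → sym (∑-*ˡ T (coeff k) (summand r k)))
  ∙ ∑-swap n T (λ k m → coeff k * summand r k m)
  ∙ ∑-cong T λ m →
      ∑-cong n (λ k → sym (*-assoc (coeff k) (inv (k ℕ.+ m)) (inv (m ℕ.+ r))))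
      ∙ ∑-*ʳ n (inv (m ℕ.+ r)) (λ k → coeff k * inv (k ℕ.+ m))
      ∙ cong (_* inv (m ℕ.+ r)) (sym (residual-∑ n m))

-- In the square k, m ≤ n the part k ≤ m contributes ⟨p_m, xᵐ⟩/(m+r+1) for each m. This is 0 except
-- at m = 0, where it is 1/(r+1).
∑-coeff-triangle : ∀ r n →
  ∑ℚ (suc n) (λ k → coeff k * ∑ℚ k (summand r k)) + inv r
    ≡ ∑ℚ (suc n) λ m → residual (suc n) m * inv (m ℕ.+ r)
∑-coeff-triangle r zero = solve 1 (λ x → con 1ℚ :* con 0ℚ :+ con 0ℚ :+ x :=
    (con 0ℚ :+ con 1ℚ :* con 1ℚ) :* x :+ con 0ℚ) refl (inv r)
  ∙ cong (λ y → (0ℚ + 1ℚ * y) * inv r + 0ℚ) (sym inv0)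
  where open +-*-Solver
∑-coeff-triangle r (suc n) =
  cong (_+ inv r) (∑-last (suc n) λ k → coeff k * ∑ℚ k (summand r k))
  ∙ solve 3 (λ a b x → a :+ b :+ x := a :+ x :+ b) refl
      (∑ℚ (suc n) λ k → coeff k * ∑ℚ k (summand r k)) (c * ∑ℚ (suc n) (summand r (suc n))) (inv r)
  ∙ cong₂ _+_ (∑-coeff-triangle r n) (sym (∑-*ˡ (suc n) c (summand r (suc n))))
  ∙ sym (∑-+ (suc n) (λ m → residual (suc n) m * inv (m ℕ.+ r)) λ m → c * summand r (suc n) m)
  ∙ ∑-cong (suc n) (λ m → solve 4 (λ f c x y → f :* y :+ c :* (x :* y) := (f :+ c :* x) :* y) refl
      (residual (suc n) m) c (inv (suc n ℕ.+ m)) (inv (m ℕ.+ r)))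
  ∙ sym (+-identityʳ (∑ℚ (suc n) F))
  -- The column m = n + 1 can be added to the square because it vanishes by orthogonality.
  ∙ cong (∑ℚ (suc n) F +_) (sym (cong (_* inv (suc n ℕ.+ r)) (residual-orthogonal n)
      ∙ *-zeroˡ (inv (suc n ℕ.+ r))))
  ∙ sym (∑-last (suc n) F)
  where
  open +-*-Solver
  c : ℚ
  c = coeff (suc n)
  F : ℕ → ℚ
  F m = residual (suc (suc n)) m * inv (m ℕ.+ r)

-- Rectangle minus triangle minus 1/(r+1) leaves the columns n < m < T, that is, the tail already
-- estimated.
∑-coeff-truncated : ∀ r n T → suc n ℕ.≤ T →
  ∣ ∑ℚ (suc n) (λ k → coeff k * truncated r k T) - inv r ∣ ≤ (1ℚ + 1ℚ) * (1ℚ + 1ℚ) * central (suc n)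
∑-coeff-truncated r n T n<T = subst (λ p → ∣ p ∣ ≤ (1ℚ + 1ℚ) * (1ℚ + 1ℚ) * central (suc n)) (sym eq)
  (residual-tail r (suc n) (T ℕ.∸ suc n))
  where
  open +-*-Solver
  F : ℕ → ℚ
  F m = residual (suc n) m * inv (m ℕ.+ r)
  A B tail : ℚ
  A = ∑ℚ (suc n) λ k → coeff k * ∑ℚ T (summand r k)
  B = ∑ℚ (suc n) λ k → coeff k * ∑ℚ k (summand r k)
  tail = ∑ℚ (T ℕ.∸ suc n) λ j → F (suc n ℕ.+ j)
  eq : ∑ℚ (suc n) (λ k → coeff k * truncated r k T) - inv r ≡ tail
  eq = cong (_- inv r) (∑-cong (suc n) (λ k → solve 3 (λ c a b → c :* (a :- b) := c :* a :- c :* b)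
          refl (coeff k) (∑ℚ T (summand r k)) (∑ℚ k (summand r k)))
        ∙ ∑-- (suc n) (λ k → coeff k * ∑ℚ T (summand r k)) λ k → coeff k * ∑ℚ k (summand r k))
    ∙ solve 3 (λ a b x → a :- b :- x := a :- (b :+ x)) refl A B (inv r)
    ∙ cong₂ _-_ (∑-coeff-summand r (suc n) T
        ∙ cong (λ k → ∑ℚ k F) (sym (ℕₚ.m+[n∸m]≡n n<T)) ∙ ∑-split (suc n) (T ℕ.∸ suc n) F)
        (∑-coeff-triangle r n)
    ∙ solve 2 (λ s t → s :+ t :- s := t) refl (∑ℚ (suc n) F) tail

-- Identification of h r k as the limit of the truncated sums

H≡harmonic : ∀ n → H n ≡ harmonic n
H≡harmonic n = ∑-cong n λ k → sym (inv≡ k)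

null-harmonic-shift : ∀ r → Null (λ n → harmonic (r ℕ.+ n) - harmonic n)
null-harmonic-shift r = null-squeeze 0 (λ n _ → begin
    ∣ harmonic (r ℕ.+ n) - harmonic n ∣
      ≡⟨ cong (λ k → ∣ harmonic k - harmonic n ∣) (ℕₚ.+-comm r n)
         ∙ cong (λ z → ∣ z - harmonic n ∣) (∑-split n r inv)
         ∙ cong ∣_∣ (solve 2 (λ a b → a :+ b :- a := b) refl (harmonic n) (∑ℚ r λ k → inv (n ℕ.+ k)))
         ∙ 0≤p⇒∣p∣≡p (0≤∑ r λ k → 0≤inv (n ℕ.+ k)) ⟩
    (∑ℚ r λ k → inv (n ℕ.+ k))
      ≤⟨ ∑-upper r (λ k → inv-anti (ℕₚ.m≤m+n n k)) ⟩
    ι r * inv n ∎)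
  (null-*ˡ (ι r) {inv} null-inv)
  where
  open ≤-Reasoning
  open +-*-Solver

-- The two denominators differ by k - r whatever m is, so multiplying by this constant splits every
-- summand at once.
summand-diff : ∀ r k m → (ι k - ι r) * summand r k m ≡ inv (r ℕ.+ m) - inv (k ℕ.+ m)
summand-diff r k m = sym (
  recip-diff {inv (r ℕ.+ m)} {ι (suc (r ℕ.+ m))} {inv (k ℕ.+ m)} {ι (suc (k ℕ.+ m))}
    (inv-* (r ℕ.+ m)) (inv-* (k ℕ.+ m))
  ∙ cong₂ (λ Y X → (Y - X) * (inv (r ℕ.+ m) * inv (k ℕ.+ m)))
      (ι-suc (k ℕ.+ m) ∙ cong (1ℚ +_) (ι-+ k m)) (ι-suc (r ℕ.+ m) ∙ cong (1ℚ +_) (ι-+ r m))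
  ∙ solve 5 (λ k r m x y → (con 1ℚ :+ (k :+ m) :- (con 1ℚ :+ (r :+ m))) :* (x :* y) := (k :- r) :* (y :* x))
      refl (ι k) (ι r) (ι m) (inv (r ℕ.+ m)) (inv (k ℕ.+ m))
  ∙ cong (λ j → (ι k - ι r) * (inv (k ℕ.+ m) * inv j)) (ℕₚ.+-comm r m))
  where open +-*-Solver

∑-summand-diff : ∀ r k T → (ι k - ι r) * ∑ℚ T (summand r k)
  ≡ (harmonic (r ℕ.+ T) - harmonic r) - (harmonic (k ℕ.+ T) - harmonic k)
∑-summand-diff r k T = sym (∑-*ˡ T (ι k - ι r) (summand r k))
  ∙ ∑-cong T (summand-diff r k)
  ∙ ∑-- T (λ m → inv (r ℕ.+ m)) (λ m → inv (k ℕ.+ m))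
  ∙ cong₂ _-_ (part r) (part k)
  where
  open +-*-Solver
  part : ∀ j → ∑ℚ T (λ m → inv (j ℕ.+ m)) ≡ harmonic (j ℕ.+ T) - harmonic j
  part j = solve 2 (λ a b → b := a :+ b :- a) refl (harmonic j) (∑ℚ T λ m → inv (j ℕ.+ m))
    ∙ cong (_- harmonic j) (sym (∑-split j T inv))

-- `harmonic r` and `harmonic k` cancel between the two sums. `harmonic T` is inserted so that the
-- remainder is a difference of two shifts, each of which tends to 0 in T.
truncated-diff : ∀ r k T → (ι k - ι r) * truncated r k T
  ≡ (H (2 ℕ.* k) - H (k ℕ.+ r)) + ((harmonic (r ℕ.+ T) - harmonic T) - (harmonic (k ℕ.+ T) - harmonic T))
truncated-diff r k T =
  solve 3 (λ d a b → d :* (a :- b) := d :* a :- d :* b) refl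
    (ι k - ι r) (∑ℚ T (summand r k)) (∑ℚ k (summand r k))
  ∙ cong₂ _-_ (∑-summand-diff r k T) (∑-summand-diff r k k)
  ∙ solve 7 (λ rT r kT k rk kk T → ((rT :- r) :- (kT :- k)) :- ((rk :- r) :- (kk :- k)) :=
      (kk :- rk) :+ ((rT :- T) :- (kT :- T))) refl
      (harmonic (r ℕ.+ T)) (harmonic r) (harmonic (k ℕ.+ T)) (harmonic k)
      (harmonic (r ℕ.+ k)) (harmonic (k ℕ.+ k)) (harmonic T)
  ∙ cong (_+ ((harmonic (r ℕ.+ T) - harmonic T) - (harmonic (k ℕ.+ T) - harmonic T)))
      (cong₂ _-_ (cong harmonic (sym (2*n≡n+n k)) ∙ sym (H≡harmonic (2 ℕ.* k)))
        (cong harmonic (ℕₚ.+-comm r k) ∙ sym (H≡harmonic (k ℕ.+ r))))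
  where open +-*-Solver

/1-- : ∀ m n → (ℤ.+ m ℤ.- ℤ.+ n) / 1 ≡ ι m - ι n
/1-- m n = /1-homo-+ (ℤ.+ m) (ℤ.- ℤ.+ n)
  ∙ cong₂ _+_ (sym (ι≡ m)) (/1-neg (ℤ.+ n) ∙ cong -_ (sym (ι≡ n)))

ι-< : ∀ {m n} → m ℕ.< n → ι m < ι n
ι-< {m} m<n = <-≤-trans
  (subst₂ _<_ (+-identityˡ (ι m)) (sym (ι-suc m)) (+-monoˡ-< (ι m) (positive⁻¹ 1ℚ)))
  (ι-mono m<n)

ι-injective : ∀ {m n} → ι m ≡ ι n → m ≡ n
ι-injective {m} {n} eq with ℕₚ.<-cmp m n
... | tri< m<n _ _ = contradiction eq (<⇒≢ (ι-< m<n))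
... | tri≈ _ m≡n _ = m≡n
... | tri> _ _ n<m = contradiction (sym eq) (<⇒≢ (ι-< n<m))

/1-nonZero : ∀ {k r} → k ≢ r → NonZero ((ℤ.+ k ℤ.- ℤ.+ r) / 1)
/1-nonZero {k} {r} k≢r = ≢-nonZero λ d≡0 → k≢r (ι-injective
  (solve 2 (λ x y → x := x :- y :+ y) refl (ι k) (ι r)
   ∙ cong (_+ ι r) (sym (/1-- k r) ∙ d≡0) ∙ +-identityˡ (ι r)))
  where open +-*-Solver

h-off-diagonal : ∀ r k → k ≢ r → ∃ λ w → w * (ι k - ι r) ≡ 1ℚ ×
  (∀ t → seq (h r k) t ≡ (H (2 ℕ.* k) - H (k ℕ.+ r)) * w)
h-off-diagonal r k k≢r with k ℕₚ.≟ r
... | yes k≡r = contradiction k≡r k≢r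
... | no  k≢r = (1/ d) {{d≢0}}
  , (cong ((1/ d) {{d≢0}} *_) (sym (/1-- k r)) ∙ *-inverseˡ d {{d≢0}})
  -- The reciprocal does not depend on the proof of nonzeroness, so it agrees with the one inside
  -- `h`.
  , λ _ → refl
  where
  d : ℚ
  d = (ℤ.+ k ℤ.- ℤ.+ r) / 1
  d≢0 : NonZero d
  d≢0 = /1-nonZero k≢r

h-diagonal : ∀ r t → seq (h r r) t ≡ seq π t * seq π t * (ℤ.+ 1 / 6) - squares (2 ℕ.* r)
h-diagonal r t with r ℕₚ.≟ r
... | yes _   = cong (λ z → seq π t * seq π t * (ℤ.+ 1 / 6) - z) (∑-cong (2 ℕ.* r) inv-square)
... | no  r≢r = contradiction refl r≢r

truncated-diagonal : ∀ r T → truncated r r T ≡ squares (T ℕ.+ r) - squares (2 ℕ.* r)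
truncated-diagonal r T = cong₂ _-_ (sums T) (sums r)
  ∙ solve 3 (λ a b c → (a :- c) :- (b :- c) := a :- b) refl
      (squares (r ℕ.+ T)) (squares (r ℕ.+ r)) (squares r)
  ∙ cong₂ (λ i j → squares i - squares j) (ℕₚ.+-comm r T) (sym (2*n≡n+n r))
  where
  open +-*-Solver
  sums : ∀ m → ∑ℚ m (summand r r) ≡ squares (r ℕ.+ m) - squares r
  sums m = ∑-cong m (λ k → cong (λ j → inv (r ℕ.+ k) * inv j) (ℕₚ.+-comm k r))
    ∙ solve 2 (λ a b → b := a :+ b :- a) refl (squares r) (∑ℚ m λ k → inv (r ℕ.+ k) * inv (r ℕ.+ k))
    ∙ cong (_- squares r) (sym (∑-split r m λ k → inv k * inv k))

-- For k ≠ r the error is a difference of harmonic shifts divided by k - r. For k = r the truncated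
-- sum is a segment of ζ(2), compared with π²/6 by `basel`. The decision is passed to `go` as an
-- argument, which leaves the test inside `h` to the two lemmas about it.
null-h-truncated : ∀ r k → Null (λ t → seq (h r k) t - truncated r k t)
null-h-truncated r k = go (k ℕₚ.≟ r)
  where
  open +-*-Solver
  gap : ℕ → ℕ → ℚ
  gap j t = harmonic (j ℕ.+ t) - harmonic t
  go : Dec (k ≡ r) → Null (λ t → seq (h r k) t - truncated r k t)
  go (yes refl) = null-cong {λ t → ζ t + - (squares (t ℕ.+ r) - squares t)}
    (λ t → solve 4 (λ p s u v → p :- s :+ :- (u :- s) := p :- v :- (u :- v)) refl
        (seq π t * seq π t * (ℤ.+ 1 / 6)) (squares t) (squares (t ℕ.+ r)) (squares (2 ℕ.* r))
      ∙ cong₂ _-_ (sym (h-diagonal r t)) (sym (truncated-diagonal r t)))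
    (null-+ {ζ} {λ t → - (squares (t ℕ.+ r) - squares t)} basel
      (null-neg {λ t → squares (t ℕ.+ r) - squares t} (null-squares-shift r)))
    where
    ζ : ℕ → ℚ
    ζ t = seq π t * seq π t * (ℤ.+ 1 / 6) - squares t
  go (no k≢r) = null-cong {λ t → - w * (gap r t + - gap k t)} eq
    (null-*ˡ (- w) {λ t → gap r t + - gap k t} (null-+ {gap r} {λ t → - gap k t}
      (null-harmonic-shift r) (null-neg {gap k} (null-harmonic-shift k))))
    where
    w X : ℚ
    w = proj₁ (h-off-diagonal r k k≢r)
    X = H (2 ℕ.* k) - H (k ℕ.+ r)
    wd : w * (ι k - ι r) ≡ 1ℚ
    wd = proj₁ (proj₂ (h-off-diagonal r k k≢r))
    eq : ∀ t → - w * (gap r t + - gap k t) ≡ seq (h r k) t - truncated r k t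
    eq t = solve 3 (λ w x g → (:- w) :* g := x :* w :- w :* (x :+ g)) refl w X (gap r t + - gap k t)
      ∙ cong₂ _-_ (sym (proj₂ (proj₂ (h-off-diagonal r k k≢r)) t))
          (cong (w *_) (sym (truncated-diff r k t))
           ∙ sym (*-assoc w (ι k - ι r) (truncated r k t))
           ∙ cong (_* truncated r k t) wd ∙ *-identityˡ (truncated r k t))

-- Components of real and complex expressions

seq-∑ : ∀ n (f : ℕ → ℝ) t → seq (∑ℝ n f) t ≡ ∑ℚ n λ k → seq (f k) t
seq-∑ zero    f t = refl
seq-∑ (suc n) f t = cong (seq (f 0) t +_) (seq-∑ n (f ∘ suc) t)

seq-re-∑ : ∀ n (f : ℕ → ℂ) t → seq (re (∑ℂ n f)) t ≡ ∑ℚ n λ k → seq (re (f k)) t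
seq-re-∑ zero    f t = refl
seq-re-∑ (suc n) f t = cong (seq (re (f 0)) t +_) (seq-re-∑ n (f ∘ suc) t)

seq-im-∑ : ∀ n (f : ℕ → ℂ) t → seq (im (∑ℂ n f)) t ≡ ∑ℚ n λ k → seq (im (f k)) t
seq-im-∑ zero    f t = refl
seq-im-∑ (suc n) f t = cong (seq (im (f 0)) t +_) (seq-im-∑ n (f ∘ suc) t)

module _ (x : ℚ) (t : ℕ) where
  private
    X : ℂ
    X = fromℝ (fromℚ x)

  seq-^ : ∀ k → seq (re (X ^ℂ k)) t ≡ x ^ℚ k × seq (im (X ^ℂ k)) t ≡ 0ℚ
  seq-^ zero    = refl , refl
  seq-^ (suc k) =
    (cong₂ (λ p q → x * p - 0ℚ * q) (proj₁ (seq-^ k)) (proj₂ (seq-^ k)) ∙ +-identityʳ (x * x ^ℚ k))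
    , (cong₂ (λ p q → x * p + 0ℚ * q) (proj₂ (seq-^ k)) (proj₁ (seq-^ k))
       ∙ solve 2 (λ x y → x :* con 0ℚ :+ con 0ℚ :* y := con 0ℚ) refl x (x ^ℚ k))
    where open +-*-Solver

  seq-re-monomial : ∀ a k → seq (re (monomial a k (fromℚ x))) t ≡ seq (re a) t * x ^ℚ k
  seq-re-monomial a k =
    cong₂ (λ p q → seq (re a) t * p - seq (im a) t * q) (proj₁ (seq-^ k)) (proj₂ (seq-^ k))
    ∙ solve 2 (λ p q → p :- q :* con 0ℚ := p) refl (seq (re a) t * x ^ℚ k) (seq (im a) t)
    where open +-*-Solver

  seq-im-monomial : ∀ a k → seq (im (monomial a k (fromℚ x))) t ≡ seq (im a) t * x ^ℚ k
  seq-im-monomial a k =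
    cong₂ (λ p q → seq (re a) t * q + seq (im a) t * p) (proj₁ (seq-^ k)) (proj₂ (seq-^ k))
    ∙ solve 2 (λ p q → q :* con 0ℚ :+ p := p) refl (seq (im a) t * x ^ℚ k) (seq (re a) t)
    where open +-*-Solver

module _ (c : ℕ → ℂ) (n : ℕ) (z : ℂ) where
  reₜ imₜ : ℕ → ℕ → ℚ
  reₜ t k = seq (re (c k)) t
  imₜ t k = seq (im (c k)) t

  form : (ℕ → ℚ) → ℕ → ℚ
  form μ t = extended μ (reₜ t) (suc n) (seq (re z) t) (suc n)
           + extended μ (imₜ t) (suc n) (seq (im z) t) (suc n)

  -- At a real point the real and imaginary parts of the polynomial have the real and imaginary
  -- parts of the coefficients, so the complex norm splits into two real forms.
  seq-∣extend∣² : ∀ x t → seq ∣ extend c n z (fromℚ x) ∣² t ≡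
    poly (reₜ t) (suc n) (seq (re z) t) (suc n) x * poly (reₜ t) (suc n) (seq (re z) t) (suc n) x
    + poly (imₜ t) (suc n) (seq (im z) t) (suc n) x * poly (imₜ t) (suc n) (seq (im z) t) (suc n) x
  seq-∣extend∣² x t = cong₂ (λ p q → p * p + q * q)
    (cong₂ _+_
      (seq-re-∑ (suc n) (λ k → monomial (c k) k (fromℚ x)) t
       ∙ ∑-cong (suc n) λ k → seq-re-monomial x t (c k) k)
      (seq-re-monomial x t z (suc n)))
    (cong₂ _+_
      (seq-im-∑ (suc n) (λ k → monomial (c k) k (fromℚ x)) t
       ∙ ∑-cong (suc n) λ k → seq-im-monomial x t (c k) k)
      (seq-im-monomial x t z (suc n)))

  riemannSum : ℕ → ℝ
  riemannSum M = fromℚ (ℤ.+ 1 / suc M) D.*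
    ∑ℝ (suc M) λ k → ∣ extend c n z (fromℚ (ℤ.+ k / suc M)) ∣²

  seq-riemannSum : ∀ M t → seq (riemannSum M) t ≡ form (riemann M) t
  seq-riemannSum M t =
    cong₂ _*_ (sym (inv≡ M))
      (seq-∑ (suc M) (λ k → ∣ extend c n z (fromℚ (ℤ.+ k / suc M)) ∣²) t
       ∙ ∑-cong (suc M) (λ k → seq-∣extend∣² (ℤ.+ k / suc M) t
           ∙ cong (λ x → P x * P x + Q x * Q x) (/≡ι*inv k M))
       ∙ ∑-+ (suc M) (λ k → P (node M k) * P (node M k)) λ k → Q (node M k) * Q (node M k))
    ∙ *-distribˡ-+ (inv M) (∑ℚ (suc M) λ k → P (node M k) * P (node M k))
        (∑ℚ (suc M) λ k → Q (node M k) * Q (node M k))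
    ∙ cong₂ _+_ (sym (extended-riemann (reₜ t) (suc n) (seq (re z) t) (suc n) M))
        (sym (extended-riemann (imₜ t) (suc n) (seq (im z) t) (suc n) M))
    where
    P Q : ℚ → ℚ
    P = poly (reₜ t) (suc n) (seq (re z) t) (suc n)
    Q = poly (imₜ t) (suc n) (seq (im z) t) (suc n)

-- `extended inv` built from real operations, which supply the modulus of convergence, while each
-- index is still computed in ℚ.
extendedℝ : (ℕ → ℝ) → ℕ → ℝ → ℕ → ℝ
extendedℝ a n z m =
  ∑ℝ n (λ i → ∑ℝ n λ j → a i D.* a j D.* fromℚ (inv (i ℕ.+ j)))
  D.+ (z D.+ z) D.* ∑ℝ n (λ i → a i D.* fromℚ (inv (i ℕ.+ m)))
  D.+ z D.* z D.* fromℚ (inv (m ℕ.+ m))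

seq-extendedℝ : ∀ a n z m t →
  seq (extendedℝ a n z m) t ≡ extended inv (λ k → seq (a k) t) n (seq z t) m
seq-extendedℝ a n z m t = cong₂
  (λ p q → p + (seq z t + seq z t) * q + seq z t * seq z t * inv (m ℕ.+ m))
  (seq-∑ n (λ i → ∑ℝ n λ j → a i D.* a j D.* fromℚ (inv (i ℕ.+ j))) t
   ∙ ∑-cong n λ i → seq-∑ n (λ j → a i D.* a j D.* fromℚ (inv (i ℕ.+ j))) t)
  (seq-∑ n (λ i → a i D.* fromℚ (inv (i ℕ.+ m))) t)

norm²ℝ : (ℕ → ℂ) → ℕ → ℂ → ℝ
norm²ℝ c n z = extendedℝ (λ k → re (c k)) (suc n) (re z) (suc n)
           D.+ extendedℝ (λ k → im (c k)) (suc n) (im z) (suc n)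

seq-norm²ℝ : ∀ c n z t → seq (norm²ℝ c n z) t ≡ form c n z inv t
seq-norm²ℝ c n z t = cong₂ _+_
  (seq-extendedℝ (λ k → re (c k)) (suc n) (re z) (suc n) t)
  (seq-extendedℝ (λ k → im (c k)) (suc n) (im z) (suc n) t)

bounded-seq : ∀ x → Bounded (seq x)
bounded-seq x = bounded-cauchy (cauchy x)

≤-within : ∀ {x y : ℝ} {δ T} → (∀ t → T ℕ.≤ t → seq x t ≤ seq y t + δ) → x D.≤ y D.+ fromℚ δ
≤-within {x} {y} {δ} {T} x≤ = mk≤ λ ε 0<ε → T , λ t t≥ → ≤-trans (x≤ t t≥)
  (≤-trans (≤-reflexive (sym (+-identityʳ (seq y t + δ)))) (+-monoʳ-≤ (seq y t + δ) (<⇒≤ 0<ε)))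

-- Exhibits the integrals that `IsGreedy` asks for before it compares norms. The two real forms are
-- handled separately by `riemann-limit`.
hasNorm² : ∀ c n z → HasNorm² (extend c n z) (norm²ℝ c n z)
hasNorm² c n z ε 0<ε = proj₁ limit , λ M M≥ →
  let T , hT = proj₂ limit M M≥ in
    ≤-within {riemannSum c n z M} {norm²ℝ c n z} (λ t t≥ → ∣-∣≤⇒≤+ (hT t t≥))
  , ≤-within {norm²ℝ c n z} {riemannSum c n z M} (λ t t≥ → ∣-∣≤⇒≤+
      (≤-trans (≤-reflexive (∣p-q∣≡∣q-p∣ (seq (norm²ℝ c n z) t) (seq (riemannSum c n z M) t))) (hT t t≥)))
  where
  open +-*-Solver
  E : (ℕ → ℝ) → ℝ → (ℕ → ℚ) → ℕ → ℚ
  E a w μ t = extended μ (λ k → seq (a k) t) (suc n) (seq w t) (suc n)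
  err : (a : ℕ → ℝ) (w : ℝ) → UNull (λ M t → E a w (riemann M) t - E a w inv t)
  err a w = riemann-limit {λ k → seq (a k)} {seq w} (λ k → bounded-seq (a k)) (bounded-seq w) (suc n) (suc n)
  limit : ∃ λ N → ∀ M → N ℕ.≤ M → ∃ λ T → ∀ t → T ℕ.≤ t →
    ∣ seq (riemannSum c n z M) t - seq (norm²ℝ c n z) t ∣ ≤ ε
  limit = unull-cong
    {λ M t → (E (λ k → re (c k)) (re z) (riemann M) t - E (λ k → re (c k)) (re z) inv t)
           + (E (λ k → im (c k)) (im z) (riemann M) t - E (λ k → im (c k)) (im z) inv t)}
    {λ M t → seq (riemannSum c n z M) t - seq (norm²ℝ c n z) t}
    (λ M t → solve 4 (λ a b c d → a :- b :+ (c :- d) := a :+ c :- (b :+ d)) refl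
        (E (λ k → re (c k)) (re z) (riemann M) t) (E (λ k → re (c k)) (re z) inv t)
        (E (λ k → im (c k)) (im z) (riemann M) t) (E (λ k → im (c k)) (im z) inv t)
      ∙ cong₂ _-_ (sym (seq-riemannSum c n z M t)) (sym (seq-norm²ℝ c n z t)))
    (unull-+ {λ M t → E (λ k → re (c k)) (re z) (riemann M) t - E (λ k → re (c k)) (re z) inv t}
             {λ M t → E (λ k → im (c k)) (im z) (riemann M) t - E (λ k → im (c k)) (im z) inv t}
      (err (λ k → re (c k)) (re z)) (err (λ k → im (c k)) (im z)))
    ε 0<ε

-- The coefficient produced by minimising the norm exactly

-- Formed from the given real coefficients rather than from `coeff`: both norms to be compared then
-- contain the same polynomial.
best : (ℕ → ℝ) → ℕ → ℝ
best a n = fromℚ (- ι (suc (suc n ℕ.+ suc n))) D.* ∑ℝ (suc n) λ k → a k D.* fromℚ (inv (k ℕ.+ suc n))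

seq-best : ∀ a n t → seq (best a n) t
  ≡ - ι (suc (suc n ℕ.+ suc n)) * pairing inv (λ k → seq (a k) t) (suc n) (suc n)
seq-best a n t = cong (- ι (suc (suc n ℕ.+ suc n)) *_)
  (seq-∑ (suc n) (λ k → a k D.* fromℚ (inv (k ℕ.+ suc n))) t)

-- Completing the square: w is the vertex, where the pairing equals -w/(2m+1).
extended-excess : ∀ a n m z →
  let w = - ι (suc (m ℕ.+ m)) * pairing inv a n m in
  extended inv a n z m - extended inv a n w m ≡ (z - w) * (z - w) * inv (m ℕ.+ m)
extended-excess a n m z =
  cong (λ p → g + (z + z) * p + z * z * x - (g + (w + w) * p + w * w * x)) p≡
  ∙ solve 4 (λ g z w x → g :+ (z :+ z) :* (:- (x :* w)) :+ z :* z :* x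
        :- (g :+ (w :+ w) :* (:- (x :* w)) :+ w :* w :* x)
      := (z :- w) :* (z :- w) :* x) refl g z w x
  where
  open +-*-Solver
  x d p g w : ℚ
  x = inv (m ℕ.+ m)
  d = ι (suc (m ℕ.+ m))
  p = pairing inv a n m
  g = Hankel inv a n
  w = - d * p
  p≡ : p ≡ - (x * w)
  p≡ = sym (solve 3 (λ x d p → :- (x :* ((:- d) :* p)) := (x :* d) :* p) refl x d p
    ∙ cong (_* p) (inv-* (m ℕ.+ m)) ∙ *-identityˡ p)

Close : ℝ → ℚ → Set
Close x p = Null (λ t → seq x t - p)

≈⇒close : ∀ {x p} → x D.≈ fromℚ p → Close x p
≈⇒close {x} {p} (mk≤ x≤ , mk≤ ≤x) ε 0<ε =
  let M , hM = x≤ ε 0<ε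
      N , hN = ≤x ε 0<ε
  in M ℕ.⊔ N , λ t t≥ → ∣∣≤
    (shift (seq x t) p (hM t (ℕₚ.m⊔n≤o⇒m≤o M N t≥)))
    (subst (_≤ ε) (solve 2 (λ x p → p :- x := :- (x :- p)) refl (seq x t) p)
      (shift p (seq x t) (hN t (ℕₚ.m⊔n≤o⇒n≤o M N t≥))))
  where
  open +-*-Solver
  shift : ∀ a b → a ≤ b + ε → a - b ≤ ε
  shift a b a≤ = subst (a - b ≤_) (solve 2 (λ b e → b :+ e :- b := e) refl b ε) (+-monoˡ-≤ (- b) a≤)

-- Greedy sequences approximate the rational coefficients

module _ (c : ℕ → ℂ) (greedy : IsGreedy c) where
  reᶜ imᶜ : ℕ → ℝ
  reᶜ k = re (c k)
  imᶜ k = im (c k)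

  module _ (n : ℕ) where
    private
      Δre Δim : ℕ → ℚ
      Δre t = seq (reᶜ (suc n)) t - seq (best reᶜ n) t
      Δim t = seq (imᶜ (suc n)) t - seq (best imᶜ n) t
      z : ℂ
      z = best reᶜ n +i best imᶜ n
      x d : ℚ
      x = inv (suc n ℕ.+ suc n)
      d = ι (suc (suc n ℕ.+ suc n))

    excess : ∀ t → seq (norm²ℝ c n (c (suc n))) t - seq (norm²ℝ c n z) t
      ≡ (Δre t * Δre t + Δim t * Δim t) * x
    excess t = cong₂ _-_ (seq-norm²ℝ c n (c (suc n)) t) (seq-norm²ℝ c n z t)
      ∙ solve 4 (λ a b c d → a :+ c :- (b :+ d) := a :- b :+ (c :- d)) refl
          (E reᶜ (reᶜ (suc n))) (E reᶜ (best reᶜ n)) (E imᶜ (imᶜ (suc n))) (E imᶜ (best imᶜ n))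
      ∙ cong₂ _+_ (part reᶜ) (part imᶜ)
      ∙ sym (*-distribʳ-+ x (Δre t * Δre t) (Δim t * Δim t))
      where
      open +-*-Solver
      E : (ℕ → ℝ) → ℝ → ℚ
      E a w = extended inv (λ k → seq (a k) t) (suc n) (seq w t) (suc n)
      part : ∀ a → E a (a (suc n)) - E a (best a n)
        ≡ (seq (a (suc n)) t - seq (best a n) t) * (seq (a (suc n)) t - seq (best a n) t) * x
      part a = cong (λ w → extended inv b (suc n) (b (suc n)) (suc n) - extended inv b (suc n) w (suc n))
          (seq-best a n t)
        ∙ extended-excess b (suc n) (suc n) (b (suc n))
        ∙ cong (λ w → (b (suc n) - w) * (b (suc n) - w) * x) (sym (seq-best a n t))
        where
        b : ℕ → ℚ
        b k = seq (a k) t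

    -- Minimality bounds the excess above by any tolerance, eventually, and the excess is a sum of
    -- squares divided by 2n + 3.
    null-excess : Null (λ t → Δre t * Δre t + Δim t * Δim t)
    null-excess ε 0<ε = T , λ t t≥ → begin
      ∣ Δre t * Δre t + Δim t * Δim t ∣     ≡⟨ 0≤p⇒∣p∣≡p (0≤+ (0≤² (Δre t)) (0≤² (Δim t))) ⟩
      S t                                   ≡⟨ scale (S t) ⟨
      S t * x * d                           ≡⟨ cong (_* d) (excess t) ⟨
      (I t - J t) * d                       ≤⟨ *-monoʳ (0≤ι (suc (suc n ℕ.+ suc n)))
        (subst (I t - J t ≤_) (solve 2 (λ j e → j :+ e :- j := e) refl (J t) (ε * x))
          (+-monoˡ-≤ (- J t) (hT t t≥))) ⟩
      ε * x * d                             ≡⟨ scale ε ⟩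
      ε                                     ∎
      where
      open ≤-Reasoning
      open +-*-Solver
      I J S : ℕ → ℚ
      I t = seq (norm²ℝ c n (c (suc n))) t
      J t = seq (norm²ℝ c n z) t
      S t = Δre t * Δre t + Δim t * Δim t
      scale : ∀ s → s * x * d ≡ s
      scale s = *-assoc s x d ∙ cong (s *_) (inv-* (suc n ℕ.+ suc n)) ∙ *-identityʳ s
      bound : ∃ λ T → ∀ t → T ℕ.≤ t → I t ≤ J t + ε * x
      bound = D._≤_.eventually-≤
        (proj₂ greedy n z (hasNorm² c n (c (suc n))) (hasNorm² c n z))
        -- The tolerance ε/(2n+3) compensates for the denominator of the excess.
        (ε * x) (0<* 0<ε (0<inv (suc n ℕ.+ suc n)))
      T : ℕ
      T = proj₁ bound
      hT : ∀ t → T ℕ.≤ t → I t ≤ J t + ε * x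
      hT = proj₂ bound

    null-Δre : Null Δre
    null-Δre = null-sqrt {Δre} (null-squeeze {λ t → Δre t * Δre t} 0 (λ t _ →
      ≤-trans (≤-reflexive (0≤p⇒∣p∣≡p (0≤² (Δre t))))
        (≤-trans (≤-reflexive (sym (+-identityʳ (Δre t * Δre t)))) (+-monoʳ-≤ (Δre t * Δre t) (0≤² (Δim t)))))
      null-excess)

    null-Δim : Null Δim
    null-Δim = null-sqrt {Δim} (null-squeeze {λ t → Δim t * Δim t} 0 (λ t _ →
      ≤-trans (≤-reflexive (0≤p⇒∣p∣≡p (0≤² (Δim t))))
        (≤-trans (≤-reflexive (sym (+-identityˡ (Δim t * Δim t)))) (+-monoˡ-≤ (Δim t * Δim t) (0≤² (Δre t)))))
      null-excess)

  null-best : ∀ a (b : ℕ → ℚ) n → (∀ k → k ℕ.< suc n → Close (a k) (b k)) →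
    Close (best a n) (- ι (suc (suc n ℕ.+ suc n)) * pairing inv b (suc n) (suc n))
  null-best a b n close = null-cong
    {λ t → d * ∑ℚ (suc n) λ k → (seq (a k) t - b k) * inv (k ℕ.+ suc n)}
    (λ t → cong (d *_) (∑-cong (suc n) (λ k → solve 3 (λ a b x → (a :- b) :* x := a :* x :- b :* x)
          refl (seq (a k) t) (b k) (inv (k ℕ.+ suc n)))
        ∙ ∑-- (suc n) (λ k → seq (a k) t * inv (k ℕ.+ suc n)) λ k → b k * inv (k ℕ.+ suc n))
      ∙ solve 3 (λ d p q → d :* (p :- q) := d :* p :- d :* q) refl d
          (pairing inv (λ k → seq (a k) t) (suc n) (suc n)) (pairing inv b (suc n) (suc n))
      ∙ cong (_- d * pairing inv b (suc n) (suc n)) (sym (seq-best a n t)))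
    (null-*ˡ d {λ t → ∑ℚ (suc n) λ k → (seq (a k) t - b k) * inv (k ℕ.+ suc n)}
      (null-∑ (suc n) {λ k t → (seq (a k) t - b k) * inv (k ℕ.+ suc n)} λ k k<n →
        null-*-bounded {λ t → seq (a k) t - b k} {λ _ → inv (k ℕ.+ suc n)}
          (close k k<n) (bounded-const (inv (k ℕ.+ suc n)))))
    where
    open +-*-Solver
    d : ℚ
    d = - ι (suc (suc n ℕ.+ suc n))

  close-trans : ∀ x y {p} → Null (λ t → seq x t - seq y t) → Close y p → Close x p
  close-trans x y {p} xy yp = null-cong {λ t → seq x t - seq y t + (seq y t - p)}
    (λ t → solve 3 (λ x y p → x :- y :+ (y :- p) := x :- p) refl (seq x t) (seq y t) p)
    (null-+ {λ t → seq x t - seq y t} {λ t → seq y t - p} xy yp)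
    where open +-*-Solver

  Approximates : ℕ → Set
  Approximates k = Close (reᶜ k) (coeff k) × Close (imᶜ k) 0ℚ

  greedy-first : Approximates 0
  greedy-first = ≈⇒close {reᶜ 0} (proj₁ (proj₁ greedy)) , ≈⇒close {imᶜ 0} (proj₂ (proj₁ greedy))

  -- The coefficient is close to the exact minimiser for c₀, ..., cₙ, which depends linearly on them
  -- and hence is close to the minimiser for their rational values.
  greedy-next : ∀ n → (∀ k → k ℕ.< suc n → Approximates k) → Approximates (suc n)
  greedy-next n approx =
      close-trans (reᶜ (suc n)) (best reᶜ n) {coeff (suc n)} (null-Δre n)
        (subst (Close (best reᶜ n)) re-value
          (null-best reᶜ coeff n λ k k<n → proj₁ (approx k k<n)))
    , close-trans (imᶜ (suc n)) (best imᶜ n) {0ℚ} (null-Δim n)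
        (subst (Close (best imᶜ n)) im-value
          (null-best imᶜ (λ _ → 0ℚ) n λ k k<n → proj₂ (approx k k<n)))
    where
    d : ℚ
    d = ι (suc (suc n ℕ.+ suc n))
    re-value : - d * pairing inv coeff (suc n) (suc n) ≡ coeff (suc n)
    re-value = sym (neg-distribˡ-* d (pairing inv coeff (suc n) (suc n)))
      ∙ cong (λ p → - (d * p)) (sym (residual-∑ (suc n) (suc n)))
    im-value : - d * pairing inv (λ _ → 0ℚ) (suc n) (suc n) ≡ 0ℚ
    im-value = cong (- d *_) (∑-cong (suc n) (λ k → *-zeroˡ (inv (k ℕ.+ suc n))) ∙ ∑-zero (suc n))
      ∙ *-zeroʳ (- d)

  greedy-coeff : ∀ n k → k ℕ.< n → Approximates k
  greedy-coeff (suc zero)    zero ℕ.z<s = greedy-first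
  greedy-coeff (suc (suc n)) k    k<    =
    [ greedy-coeff (suc n) k
    , (λ k≡ → subst Approximates (sym k≡) (greedy-next n (greedy-coeff (suc n)))) ]′
    (ℕₚ.m<1+n⇒m<n∨m≡n k<)

  -- Convergence of the series

  module _ (r : ℕ) where
    private
      term : ℕ → ℂ
      term k = c k *ℂ fromℝ (h r k)

    -- The two factors are replaced one after the other, each error being multiplied by a bounded
    -- sequence.
    null-re-term : ∀ k → Null (λ t → seq (re (term k)) t - coeff k * truncated r k t)
    null-re-term k = null-cong
      {λ t → (seq (reᶜ k) t - coeff k) * seq (h r k) t + coeff k * (seq (h r k) t - truncated r k t)}
      (λ t → solve 5 (λ a i q h u → (a :- q) :* h :+ q :* (h :- u) := a :* h :- i :* con 0ℚ :- q :* u) refl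
        (seq (reᶜ k) t) (seq (imᶜ k) t) (coeff k) (seq (h r k) t) (truncated r k t))
      (null-+ {λ t → (seq (reᶜ k) t - coeff k) * seq (h r k) t}
              {λ t → coeff k * (seq (h r k) t - truncated r k t)}
        (null-*-bounded {λ t → seq (reᶜ k) t - coeff k} {seq (h r k)}
          (proj₁ (greedy-coeff (suc k) k ℕₚ.≤-refl)) (bounded-seq (h r k)))
        (null-*ˡ (coeff k) {λ t → seq (h r k) t - truncated r k t} (null-h-truncated r k)))
      where open +-*-Solver

    null-im-term : ∀ k → Null (λ t → seq (im (term k)) t)
    null-im-term k = null-cong {λ t → (seq (imᶜ k) t - 0ℚ) * seq (h r k) t}
      (λ t → solve 3 (λ a i h → (i :- con 0ℚ) :* h := a :* con 0ℚ :+ i :* h) refl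
        (seq (reᶜ k) t) (seq (imᶜ k) t) (seq (h r k) t))
      (null-*-bounded {λ t → seq (imᶜ k) t - 0ℚ} {seq (h r k)}
        (proj₂ (greedy-coeff (suc k) k ℕₚ.≤-refl)) (bounded-seq (h r k)))
      where open +-*-Solver

    partial : ℕ → ℂ
    partial n = ∑ℂ n term -ℂ fromℝ (fromℚ (ℤ.+ 1 / suc r))

    null-re-partial : ∀ n → Null (λ t → seq (re (partial n)) t
      - (∑ℚ n (λ k → coeff k * truncated r k t) - inv r))
    null-re-partial n = null-cong
      {λ t → ∑ℚ n λ k → seq (re (term k)) t - coeff k * truncated r k t}
      (λ t → ∑-- n (λ k → seq (re (term k)) t) (λ k → coeff k * truncated r k t)
        ∙ solve 3 (λ a b x → a :- b := a :- x :- (b :- x)) refl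
            (∑ℚ n λ k → seq (re (term k)) t) (∑ℚ n λ k → coeff k * truncated r k t) (inv r)
        ∙ cong (_- (∑ℚ n (λ k → coeff k * truncated r k t) - inv r))
            (cong₂ _-_ (sym (seq-re-∑ n term t)) (inv≡ r)))
      (null-∑ n {λ k t → seq (re (term k)) t - coeff k * truncated r k t} λ k _ → null-re-term k)
      where open +-*-Solver

    null-im-partial : ∀ n → Null (λ t → seq (im (partial n)) t)
    null-im-partial n = null-cong {λ t → ∑ℚ n λ k → seq (im (term k)) t}
      (λ t → sym (seq-im-∑ n term t) ∙ sym (+-identityʳ (seq (im (∑ℂ n term)) t)))
      (null-∑ n {λ k t → seq (im (term k)) t} λ k _ → null-im-term k)

    module _ (ε : ℚ) (0<ε : 0ℚ < ε) where
      private
        δ 4ℚ : ℚ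
        -- Real and imaginary part are each kept below ε/2; the sum of their squares is then at most
        -- ε²/2.
        δ = ½ * ε
        4ℚ = (1ℚ + 1ℚ) * (1ℚ + 1ℚ)
        0<δ : 0ℚ < δ
        0<δ = 0<½* 0<ε
        small : ∃ λ N → ∀ n → N ℕ.≤ n → ∣ 4ℚ * central n ∣ ≤ ½ * δ
        small = null-*ˡ 4ℚ {central} null-central (½ * δ) (0<½* 0<δ)

      re-partial-small : ∀ n → proj₁ small ℕ.≤ suc n →
        ∃ λ T → ∀ t → T ℕ.≤ t → ∣ seq (re (partial (suc n))) t ∣ ≤ δ
      -- As t is also the truncation point, it must exceed n for the tail to start beyond the
      -- square.
      re-partial-small n n≥ = proj₁ close ℕ.⊔ suc n , λ t t≥ → begin
        ∣ X t ∣                           ≡⟨ cong ∣_∣ (solve 2 (λ x y → x := (x :- y) :+ y) refl (X t) (Y t)) ⟩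
        ∣ (X t - Y t) + Y t ∣             ≤⟨ ∣p+q∣≤∣p∣+∣q∣ (X t - Y t) (Y t) ⟩
        ∣ X t - Y t ∣ + ∣ Y t ∣           ≤⟨ +-mono-≤ (proj₂ close t (ℕₚ.m⊔n≤o⇒m≤o (proj₁ close) (suc n) t≥))
            (≤-trans (∑-coeff-truncated r n t (ℕₚ.m⊔n≤o⇒n≤o (proj₁ close) (suc n) t≥))
              (≤-trans (p≤∣p∣ (4ℚ * central (suc n))) (proj₂ small (suc n) n≥))) ⟩
        ½ * δ + ½ * δ                     ≡⟨ ½+½ δ ⟩
        δ                                 ∎
        where
        open ≤-Reasoning
        open +-*-Solver
        X Y : ℕ → ℚ
        X t = seq (re (partial (suc n))) t
        Y t = ∑ℚ (suc n) (λ k → coeff k * truncated r k t) - inv r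
        close : ∃ λ T → ∀ t → T ℕ.≤ t → ∣ X t - Y t ∣ ≤ ½ * δ
        close = null-re-partial (suc n) (½ * δ) (0<½* 0<δ)

      square-≤ : ∀ {p} → ∣ p ∣ ≤ δ → p * p ≤ δ * δ
      square-≤ {p} p≤ = ≤-trans (≤-reflexive (sym (∣∣-² p)))
        (*-mono (0≤∣p∣ p) (<⇒≤ 0<δ) p≤ p≤)

      partial-small : ∀ n → suc (proj₁ small) ℕ.≤ n → ∣ partial n ∣² D.≤ fromℚ (ε * ε)
      partial-small (suc n) (ℕ.s≤s n≥) = mk≤ λ η 0<η → proj₁ R ℕ.⊔ proj₁ I , λ t t≥ → begin
        seq ∣ partial (suc n) ∣² t        ≤⟨ +-mono-≤
            (square-≤ (proj₂ R t (ℕₚ.m⊔n≤o⇒m≤o (proj₁ R) (proj₁ I) t≥)))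
            (square-≤ (proj₂ I t (ℕₚ.m⊔n≤o⇒n≤o (proj₁ R) (proj₁ I) t≥))) ⟩
        δ * δ + δ * δ                     ≤⟨ 0≤q-p⇒p≤q (subst (0ℚ ≤_)
            (solve 1 (λ d → con ½ :* d :* (con ½ :* d) :+ con ½ :* d :* (con ½ :* d) :=
              d :* d :- (con ½ :* d :* (con ½ :* d) :+ con ½ :* d :* (con ½ :* d))) refl ε)
            (0≤+ (0≤² δ) (0≤² δ))) ⟩
        ε * ε                             ≡⟨ +-identityʳ (ε * ε) ⟨
        ε * ε + 0ℚ                        ≤⟨ +-monoʳ-≤ (ε * ε) (<⇒≤ 0<η) ⟩
        ε * ε + η                         ∎
        where
        open ≤-Reasoning
        open +-*-Solver
        R : ∃ λ T → ∀ t → T ℕ.≤ t → ∣ seq (re (partial (suc n))) t ∣ ≤ δ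
        R = re-partial-small n (ℕₚ.m≤n⇒m≤1+n n≥)
        I : ∃ λ T → ∀ t → T ℕ.≤ t → ∣ seq (im (partial (suc n))) t ∣ ≤ δ
        I = null-im-partial (suc n) δ 0<δ

      partial-tends-to-0 : ∃ λ N → ∀ n → N ℕ.≤ n → ∣ partial n ∣² D.≤ fromℚ (ε * ε)
      -- The successor excludes the empty partial sum, since the tail estimate concerns n + 1 terms.
      partial-tends-to-0 = suc (proj₁ small) , partial-small

open import Data.Integer.Base using (+_)

theorem3 : (c : ℕ → ℂ) → IsGreedy c → (r : ℕ) →
    HasSum (λ n → c n *ℂ fromℝ (h r n)) (fromℝ (fromℚ (+ 1 / suc r)))
theorem3 = partial-tends-to-0
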